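{- Let $n\ge 1$ and let $w\in S_n$ be a permutation such that every nonzero coefficient in the monomial expansion of the Schubert polynomial $\mathfrak{S}_w$ equals $1$. Let $P_w$ be the poset defined below and let $\mu_w$ be its M\"obius function. Then the Grothendieck polynomial satisfies \[ \mathfrak{G}_w=-\sum_{\beta\in P_w\smallsetminus\{\widehat{0}\}}\mu_w(\widehat{0},\beta)\,x_1^{\beta_1}x_2^{\beta_2}\cdots x_n^{\beta_n}. \]
   Context: Schubert and Grothendieck polynomials: for $f\in\mathbb{Z}[x_1,\dots,x_n]$ let $\partial_i f=(f-s_if)/(x_i-x_{i+1})$, where $s_i$ swaps $x_i$ and $x_{i+1}$. Let $w_0=n\,(n-1)\cdots 1$ be the longest permutation. Set $\mathfrak{S}_{w_0}=\mathfrak{G}_{w_0}=x_1^{n-1}x_2^{n-2}\cdots x_{n-1}$, and whenever $\ell(ws_i)<\ell(w)$ (Coxeter length) set $\mathfrak{S}_{ws_i}=\partial_i\mathfrak{S}_w$ and $\mathfrak{G}_{ws_i}=\partial_i\big((1-x_{i+1})\mathfrak{G}_w\big)$. (With this convention the lowest-degree homogeneous part of $\mathfrak{G}_w$ is $\mathfrak{S}_w$; e.g. $\mathfrak{G}_{132}=x_1+x_2-x_1x_2$.) For $\alpha\in\mathbb{Z}_{\ge0}^n$ write $\alpha\in\operatorname{supp}(\mathfrak{G}_w)$ if the monomial $x_1^{\alpha_1}\cdots x_n^{\alpha_n}$ has nonzero coefficient in $\mathfrak{G}_w$. The vector $\mathrm{wt}(\overline{D(w)})$: the Rothe diagram is $D(w)=\{(i,j)\in[n]\times[n]: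 j<w(i),\ i<w^{ -1}(j)\}$ (row $i$, column $j$). Let $\overline{D(w)}=\{(i,j)\in[n]\times[n]:\ (k,j)\in D(w)\text{ for some }k\ge i\}$ (close each column of $D(w)$ upward). For a diagram $D\subseteq[n]\times[n]$, $\mathrm{wt}(D)\in\mathbb{Z}^n$ is the vector whose $i$th entry is the number of boxes of $D$ in row $i$. (For example, for $w=143562$ one gets $\mathrm{wt}(\overline{D(w)})=(2,2,1,1,1,0)$.) The poset: $P_w=\{\beta\in\mathbb{Z}^n:\ \alpha\le\beta\le\mathrm{wt}(\overline{D(w)})\text{ for some }\alpha\in\operatorname{supp}(\mathfrak{G}_w)\}\sqcup\{\widehat{0}\}$, where integer vectors are ordered componentwise and $\widehat{0}$ is an adjoined unique minimum element. Its M\"obius function is given by $\mu_w(\widehat{0},\widehat{0})=1$ and $\mu_w(\widehat{0},\beta)=-\sum_{\widehat{0}\le\gamma<\beta}\mu_w(\widehat{0},\gamma)$ for $\beta>\widehat{0}$. -}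

module Defs where

open import Data.Bool using (Bool; true; false; if_then_else_; _∧_; not)
open import Data.Nat as ℕ using (ℕ; zero; suc; _∸_; _<ᵇ_; _≡ᵇ_; _*_)
open import Data.Integer as ℤ using (ℤ; 0ℤ; 1ℤ)
open import Data.List using (List; []; _∷_; _++_; map; concatMap; upTo; allFin; length; foldr)
open import Data.Maybe using (Maybe; just; nothing)
open import Data.Product using (_×_; _,_; proj₂)
open import Data.Fin using (Fin; toℕ)
open import Data.Fin.Permutation using (Permutation′; _⟨$⟩ʳ_; _⟨$⟩ˡ_)

-- Conventions.  Positions/rows/columns are 0-indexed internally:
-- paper index k (1 ≤ k ≤ n) corresponds to index k-1 here.
-- Exponent vectors are lists of naturals (length n);
-- a polynomial in ℤ[x_1..x_n] is a finite list of terms (coefficient, exponent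
-- vector); its coefficient at α is the sum of coefficients of the terms
-- whose exponent vector equals α (so polynomials are compared through `coeff`).

Exp : Set
Exp = List ℕ

Poly : Set
Poly = List (ℤ × Exp)

filterB : {A : Set} → (A → Bool) → List A → List A
filterB p [] = []
filterB p (x ∷ xs) = if p x then x ∷ filterB p xs else filterB p xs

countB : {A : Set} → (A → Bool) → List A → ℕ
countB p xs = length (filterB p xs)

anyB : {A : Set} → (A → Bool) → List A → Bool
anyB p [] = false
anyB p (x ∷ xs) = p x Data.Bool.∨ anyB p xs
  where import Data.Bool

isZeroℤ : ℤ → Bool
isZeroℤ (ℤ.+ zero) = true
isZeroℤ _ = false

sumℤ : List ℤ → ℤ
sumℤ = foldr ℤ._+_ 0ℤ

at : Exp → ℕ → ℕ
at [] k = 0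
at (a ∷ e) zero = a
at (a ∷ e) (suc k) = at e k

setAt : ℕ → ℕ → Exp → Exp
setAt k v [] = []
setAt zero v (a ∷ e) = v ∷ e
setAt (suc k) v (a ∷ e) = a ∷ setAt k v e

eqE : Exp → Exp → Bool
eqE [] [] = true
eqE (a ∷ e) (b ∷ f) = (a ≡ᵇ b) ∧ eqE e f
eqE _ _ = false

leqE : Exp → Exp → Bool
leqE [] [] = true
leqE (a ∷ e) (b ∷ f) = (a ℕ.≤ᵇ b) ∧ leqE e f
leqE _ _ = false

ltE : Exp → Exp → Bool
ltE e f = leqE e f ∧ not (eqE e f)

coeff : Poly → Exp → ℤ
coeff p α = sumℤ (map (λ t → let (c , e) = t in if eqE e α then c else 0ℤ) p)

negP : Poly → Poly
negP = map (λ t → let (c , e) = t in (ℤ.- c , e))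

mulX : ℕ → Poly → Poly
mulX k = map (λ t → let (c , e) = t in (c , setAt k (suc (at e k)) e))

oneMinusX : ℕ → Poly → Poly
oneMinusX k p = p ++ negP (mulX k p)

-- Divided difference ∂_i (0-indexed: acting on positions i and i+1),
-- i.e. f ↦ (f - s_i f)/(x_i - x_{i+1}), computed termwise (it is ℤ-linear):
-- for a monomial m·x_i^p x_{i+1}^q (m free of x_i, x_{i+1}), with a = min p q,
-- b = max p q, the exact quotient (x_i^p x_{i+1}^q - x_i^q x_{i+1}^p)/(x_i - x_{i+1})
-- equals  ± m · Σ_{k=0}^{b-a-1} x_i^{a+k} x_{i+1}^{b-1-k},  sign + iff p ≥ q.
ddTerm : ℕ → ℤ × Exp → Poly
ddTerm i (c , e) with at e i | at e (suc i)
... | p | q =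
  if q ℕ.≤ᵇ p
  then map (λ k → (c , setAt (suc i) (p ∸ 1 ∸ k) (setAt i (q ℕ.+ k) e))) (upTo (p ∸ q))
  else map (λ k → (ℤ.- c , setAt (suc i) (q ∸ 1 ∸ k) (setAt i (p ℕ.+ k) e))) (upTo (q ∸ p))

dd : ℕ → Poly → Poly
dd i = concatMap (ddTerm i)

oneLine : {n : ℕ} → Permutation′ n → List ℕ
oneLine {n} w = map (λ i → toℕ (w ⟨$⟩ʳ i)) (allFin n)

firstAscent : List ℕ → Maybe ℕ
firstAscent (a ∷ b ∷ l) = if a <ᵇ b then just 0 else Data.Maybe.map suc (firstAscent (b ∷ l))
  where import Data.Maybe
firstAscent _ = nothing

swapAt : ℕ → List ℕ → List ℕ
swapAt zero (a ∷ b ∷ l) = b ∷ a ∷ l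
swapAt (suc i) (a ∷ l) = a ∷ swapAt i l
swapAt _ l = l

topPoly : ℕ → Poly
topPoly n = (1ℤ , map (λ k → n ∸ 1 ∸ k) (upTo n)) ∷ []

-- Recursion of the definition, read upward: if w ≠ w₀ choose the first
-- ascent i of w; then w' = w s_i satisfies ℓ(w' s_i) < ℓ(w') and w = w' s_i, so
--   𝔖_w = ∂_i 𝔖_{w'},   𝔊_w = ∂_i((1 - x_{i+1}) 𝔊_{w'}).
-- A permutation without ascents is w₀.  The fuel argument only bounds the
-- recursion (ℓ(w₀) ≤ n*n steps suffice).
schubF : ℕ → ℕ → List ℕ → Poly
schubF n zero w = []
schubF n (suc f) w with firstAscent w
... | nothing = topPoly n
... | just i = dd i (schubF n f (swapAt i w))

grothF : ℕ → ℕ → List ℕ → Poly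
grothF n zero w = []
grothF n (suc f) w with firstAscent w
... | nothing = topPoly n
... | just i = dd i (oneMinusX (suc i) (grothF n f (swapAt i w)))

Schubert : (n : ℕ) → Permutation′ n → Poly
Schubert n w = schubF n (n * n) (oneLine w)

Grothendieck : (n : ℕ) → Permutation′ n → Poly
Grothendieck n w = grothF n (n * n) (oneLine w)

inRothe : {n : ℕ} → Permutation′ n → Fin n → Fin n → Bool
inRothe w i j = (toℕ j <ᵇ toℕ (w ⟨$⟩ʳ i)) ∧ (toℕ i <ᵇ toℕ (w ⟨$⟩ˡ j))

inClosedRothe : {n : ℕ} → Permutation′ n → Fin n → Fin n → Bool
inClosedRothe {n} w i j = anyB (λ k → (toℕ i ℕ.≤ᵇ toℕ k) ∧ inRothe w k j) (allFin n)

wtClosed : {n : ℕ} → Permutation′ n → Exp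
wtClosed {n} w = map (λ i → countB (inClosedRothe w i) (allFin n)) (allFin n)

box : Exp → List Exp
box [] = [] ∷ []
box (b ∷ bs) = concatMap (λ x → map (x ∷_) (box bs)) (upTo (suc b))

support : Poly → List Exp
support p = map proj₂ (filterB (λ t → not (isZeroℤ (coeff p (proj₂ t)))) p)

-- the elements β of P_w ∖ {0̂}: α ≤ β ≤ wt(closure D(w)) for some α ∈ supp 𝔊_w
-- (such β are automatically nonnegative, hence lie in the box [0 , wt])
posetElems : (n : ℕ) → Permutation′ n → List Exp
posetElems n w =
  filterB (λ β → anyB (λ α → leqE α β) (support (Grothendieck n w))) (box (wtClosed w))

-- μ(0̂ , β) = - Σ_{0̂ ≤ γ < β} μ(0̂ , γ) = -(1 + Σ_{γ ∈ P_w∖0̂, γ < β} μ(0̂ , γ)),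
-- computed by recursion with fuel (γ < β strictly decreases the entry sum).
muF : ℕ → List Exp → Exp → ℤ
muF zero P β = 0ℤ
muF (suc f) P β = ℤ.- (1ℤ ℤ.+ sumℤ (map (muF f P) (filterB (λ γ → ltE γ β) P)))

entrySum : Exp → ℕ
entrySum = foldr ℕ._+_ 0

mobius : (n : ℕ) → Permutation′ n → Exp → ℤ
mobius n w β = muF (suc (entrySum β)) (posetElems n w) β

mobiusPoly : (n : ℕ) → Permutation′ n → Poly
mobiusPoly n w = map (λ β → (ℤ.- mobius n w β , β)) (posetElems n w)

{-# OPTIONS --safe #-}
module Submission where

-- Let h_w = 𝔊_w / ∏ (1 − xⱼ).  Since the coefficient of h_w at β is the sum of the coefficients
-- of 𝔊_w at all γ ≤ β, Möbius inversion reduces the theorem to two facts: the exponents of 𝔊_w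
-- are bounded by wt of the closed Rothe diagram, and h_w is the indicator series of an upward
-- closed set.  Both follow the defining recursion from w′ = w sᵢ to w, with i the first ascent
-- of w; on the series h it reads h_w = ∂ᵢ((1 − xᵢ₊₁) h_w′).
--
-- That w′ is again multiplicity-free comes from the co-transition formula
-- xᵢ 𝔖_w = Σ 𝔖_{w tᵢⱼ}, the sum over the covers of w with j > i: it shows 𝔖 ≥ 0 by induction,
-- and then xᵢ 𝔖_w ≥ 𝔖_w′ coefficientwise, as w′ is one of the covers.
--
-- The upward closed set is generated by M(w), the sums over the columns C of the Rothe diagram
-- of the 0/1 vectors B ≤ C.  Such sums satisfy an exchange property, so for fixed entries off
-- i, i + 1 the closure of M(w′) is a slice {x > l, y ≥ m, x + y > d} whose minimal elements
-- all occur in M(w′) with one and the same context.  There the coefficients of 𝔖_w are 0 or 1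
-- only if m ≤ l and (l = m or d = l + m), and for such slices ∂ᵢ((1 − xᵢ₊₁) ·) gives the
-- indicator of {x, y ≥ m, x + y ≥ d}, which is the slice of the closure of M(w).

open import Defs
import Data.Nat.Properties as ℕₚ
open import Algebra.Properties.CommutativeSemigroup ℕₚ.+-commutativeSemigroup using (interchange)
open import Data.Bool using (Bool; true; false; if_then_else_; _∧_; _∨_; not; T)
open import Data.Empty using (⊥; ⊥-elim)
open import Data.Fin using (Fin; toℕ; fromℕ<)
import Data.Fin as Fin
import Data.Fin.Properties as Finₚ
open import Data.Fin.Permutation using (Permutation′; _⟨$⟩ʳ_; _⟨$⟩ˡ_; inverseˡ; inverseʳ)
open import Data.Integer using (ℤ; 0ℤ; 1ℤ) renaming (_+_ to _+ᶻ_; _-_ to _-ᶻ_; -_ to -ᶻ_; _≤_ to _≤ᶻ_)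
import Data.Integer as ℤ
import Data.Integer.Properties as ℤₚ
open import Data.Integer.Tactic.RingSolver using (solve-∀)
open import Data.List using (List; []; _∷_; [_]; _++_; map; concatMap; upTo; applyUpTo; downFrom; length; zipWith; replicate; allFin; tabulate)
import Data.List.Properties as Listₚ
open import Data.List.Membership.Propositional using (_∈_)
open import Data.List.Membership.Propositional.Properties using (∈-upTo⁺; ∈-allFin)
open import Data.List.Relation.Binary.Permutation.Propositional using (_↭_; ↭-refl; ↭-sym; ↭-trans; ↭-prep; ↭-swap; ↭⇒↭ₛ)
open import Data.List.Relation.Binary.Permutation.Propositional.Properties using (++⁺ˡ)
import Data.List.Relation.Binary.Permutation.Setoid.Properties as Permutationₚ
open import Data.List.Relation.Binary.Pointwise as Pointwise using (Pointwise; []; _∷_)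
open import Data.List.Relation.Unary.All as All using (All; []; _∷_)
import Data.List.Relation.Unary.All.Properties as Allₚ
open import Data.List.Relation.Unary.AllPairs using (AllPairs; []; _∷_)
import Data.List.Relation.Unary.AllPairs.Properties as AllPairsₚ
open import Data.List.Relation.Unary.Any as Any using (Any; here; there; any?)
import Data.List.Relation.Unary.Any.Properties as Anyₚ
open import Data.List.Relation.Unary.Unique.Propositional using (Unique)
open import Data.List.Relation.Unary.Unique.Propositional.Properties using (upTo⁺; allFin⁺) renaming (map⁺ to Unique-map⁺)
open import Data.List.Reverse using (Reverse; reverseView; []; _∶_∶ʳ_)
import Data.Maybe
open import Data.Maybe using (Maybe; just; nothing)
open import Data.Nat using (ℕ; zero; suc; _+_; _∸_; _*_; _≤_; _<_; z≤n; s≤s)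
import Data.Nat as ℕ
open import Data.Nat.ListAction using (sum)
open import Data.Nat.ListAction.Properties using (sum-++; sum-↭)
open import Data.Nat.Tactic.RingSolver using () renaming (solve-∀ to ℕsolve-∀)
open import Data.Product using (_×_; _,_; proj₁; proj₂; ∃)
open import Data.Sum using (_⊎_; inj₁; inj₂)
open import Data.Vec using (Vec; toList; fromList)
import Data.Vec.Properties as Vecₚ
open import Function using (_∘_; id; _|>_)
open import Relation.Binary.Definitions using (tri<; tri≈; tri>)
open import Relation.Binary.PropositionalEquality
  using (_≡_; _≢_; refl; sym; trans; cong; cong₂; subst; subst₂; setoid; module ≡-Reasoning)
open import Relation.Nullary using (¬_; Dec; yes; no)
open import Relation.Nullary.Decidable using (decidable-stable)

-- Power series and divided differences

-- The definition always descends through the first ascent, but the co-transition formula is proved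
-- by removing ascents anywhere in the word. The Schubert recursion must therefore hold at every
-- ascent, which is the role of the braid relation. The Grothendieck recursion is followed only at
-- the first ascent: there the entries before w(i) decrease, hence exceed w(i), so that column w(i)
-- of the diagram is an initial segment of rows and loses exactly its last box. Working with h
-- removes the signs of 𝔊 and costs nothing: ∏ (1 - xⱼ) is symmetric and commutes with ∂ᵢ. The
-- series 𝔖 must be carried along with h. The induction records it as the indicator of M(w), and its
-- coefficients on a single antidiagonal are what restrict the possible slices. A slice is described
-- through minima of predicates that are not decided. These minima exist only under double negation,
-- which suffices because every conclusion drawn from them is an equation between integers.

Series : Set
Series = Exp → ℤ

infix 4 _≗_
_≗_ : {A : Set} → (A → ℤ) → (A → ℤ) → Set
f ≗ g = ∀ e → f e ≡ g e

-- Coefficients of (f(x,y) − f(y,x)) / (x − y), solved for along antidiagonals.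
δ : (ℕ → ℕ → ℤ) → ℕ → ℕ → ℤ
δ f zero    b = f (suc b) 0 -ᶻ f 0 (suc b)
δ f (suc a) b = δ f a (suc b) +ᶻ (f (suc b) (suc a) -ᶻ f (suc a) (suc b))

∂ : ℕ → Series → Series
∂ zero    f (a ∷ b ∷ e) = δ (λ x y → f (x ∷ y ∷ e)) a b
∂ zero    f _           = 0ℤ
∂ (suc i) f (a ∷ e)     = ∂ i (λ e′ → f (a ∷ e′)) e
∂ (suc i) f []          = 0ℤ

X : ℕ → Series → Series
X i       f []          = 0ℤ
X zero    f (zero ∷ e)  = 0ℤ
X zero    f (suc a ∷ e) = f (a ∷ e)
X (suc i) f (a ∷ e)     = X i (λ e′ → f (a ∷ e′)) e

δ-cong : ∀ {f g} → (∀ a b → f a b ≡ g a b) → ∀ a b → δ f a b ≡ δ g a b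
δ-cong h zero    b = cong₂ _-ᶻ_ (h _ _) (h _ _)
δ-cong h (suc a) b = cong₂ _+ᶻ_ (δ-cong h a (suc b)) (cong₂ _-ᶻ_ (h _ _) (h _ _))

δ-zero : ∀ a b → δ (λ _ _ → 0ℤ) a b ≡ 0ℤ
δ-zero zero    b = refl
δ-zero (suc a) b = cong (_+ᶻ 0ℤ) (δ-zero a (suc b))

δ-symmetric≡0 : ∀ {f} → (∀ a b → f a b ≡ f b a) → ∀ a b → δ f a b ≡ 0ℤ
δ-symmetric≡0 {f} s zero b = ℤₚ.i≡j⇒i-j≡0 (s (suc b) 0)
δ-symmetric≡0 {f} s (suc a) b =
  cong₂ _+ᶻ_ (δ-symmetric≡0 s a (suc b)) (ℤₚ.i≡j⇒i-j≡0 (s (suc b) (suc a)))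

private
  δ-shift : ∀ f a b → δ f a (suc b) ≡ δ f (suc b) a → δ f (suc a) b ≡ δ f b (suc a)
  δ-shift f a b h = trans (cong (_+ᶻ (f (suc b) (suc a) -ᶻ f (suc a) (suc b))) h) (cancel (δ f b (suc a)) (f (suc b) (suc a)) (f (suc a) (suc b)))
    where
    cancel : ∀ u p q → (u +ᶻ (q -ᶻ p)) +ᶻ (p -ᶻ q) ≡ u
    cancel = solve-∀

  δ-unshift : ∀ f a b → δ f (suc a) b ≡ δ f b (suc a) → δ f a (suc b) ≡ δ f (suc b) a
  δ-unshift f a b h = sym (δ-shift f b a (sym h))

  -- Stepping inwards shrinks the gap by two, because the increments that `δ` picks up at the two
  -- ends are opposite. Hence two base cases: gap 0 is trivial, and at gap 1 the increment compares
  -- a coefficient with itself.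
  δ-sym-gap : ∀ f d a → δ f a (d + a) ≡ δ f (d + a) a
  δ-sym-gap f zero a = refl
  δ-sym-gap f (suc zero) a = sym (cancel (δ f a (suc a)) (f (suc a) (suc a)))
    where
    cancel : ∀ u p → u +ᶻ (p -ᶻ p) ≡ u
    cancel = solve-∀
  δ-sym-gap f (suc (suc d)) a = δ-unshift f a (suc (d + a))
    (subst (λ m → δ f (suc a) m ≡ δ f m (suc a)) (ℕₚ.+-suc d a) (δ-sym-gap f d (suc a)))

δ-sym : ∀ f a b → δ f a b ≡ δ f b a
δ-sym f a b with ℕₚ.≤-total a b
... | inj₁ a≤b = subst (λ m → δ f a m ≡ δ f m a) (ℕₚ.m∸n+n≡m a≤b) (δ-sym-gap f (b ∸ a) a)
... | inj₂ b≤a = sym (subst (λ m → δ f b m ≡ δ f m b) (ℕₚ.m∸n+n≡m b≤a) (δ-sym-gap f (a ∸ b) b))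

-- `δ` is assembled from sums and differences of coefficients, so an operator that respects these
-- commutes with a `δ` in other coordinates, as in `commute-δ`. The lemmas `∂-far` and `X-∂-above`
-- rest on this.
record Additive {A : Set} (L : (A → ℤ) → ℤ) : Set where
  field
    ext   : ∀ {f g} → f ≗ g → L f ≡ L g
    add   : ∀ f g → L (λ e → f e +ᶻ g e) ≡ L f +ᶻ L g
    minus : ∀ f g → L (λ e → f e -ᶻ g e) ≡ L f -ᶻ L g

  null : L (λ _ → 0ℤ) ≡ 0ℤ
  null = trans (minus (λ _ → 0ℤ) (λ _ → 0ℤ)) (ℤₚ.i≡j⇒i-j≡0 {L (λ _ → 0ℤ)} refl)

  commute-δ : ∀ (F : ℕ → ℕ → A → ℤ) a b →
    L (λ e → δ (λ x y → F x y e) a b) ≡ δ (λ x y → L (F x y)) a b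
  commute-δ F zero b = minus _ _
  commute-δ F (suc a) b = trans (add _ _) (cong₂ _+ᶻ_ (commute-δ F a (suc b)) (minus _ _))

open Additive

sub-of-sums : ∀ a b c d → (a +ᶻ b) -ᶻ (c +ᶻ d) ≡ (a -ᶻ c) +ᶻ (b -ᶻ d)
sub-of-sums = solve-∀

sum-of-sums : ∀ a b c d → (a +ᶻ b) +ᶻ (c +ᶻ d) ≡ (a +ᶻ c) +ᶻ (b +ᶻ d)
sum-of-sums = solve-∀

sub-of-subs : ∀ a b c d → (a -ᶻ b) -ᶻ (c -ᶻ d) ≡ (a -ᶻ c) -ᶻ (b -ᶻ d)
sub-of-subs = solve-∀

sum-of-subs : ∀ a b c d → (a -ᶻ b) +ᶻ (c -ᶻ d) ≡ (a +ᶻ c) -ᶻ (b +ᶻ d)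
sum-of-subs = solve-∀

δ-add : ∀ f g a b → δ (λ x y → f x y +ᶻ g x y) a b ≡ δ f a b +ᶻ δ g a b
δ-add f g zero b = sub-of-sums (f (suc b) 0) (g (suc b) 0) (f 0 (suc b)) (g 0 (suc b))
δ-add f g (suc a) b =
  trans (cong₂ _+ᶻ_ (δ-add f g a (suc b)) (sub-of-sums (f (suc b) (suc a)) _ _ _)) (sum-of-sums (δ f a (suc b)) _ _ _)

δ-minus : ∀ f g a b → δ (λ x y → f x y -ᶻ g x y) a b ≡ δ f a b -ᶻ δ g a b
δ-minus f g zero b = sub-of-subs (f (suc b) 0) (g (suc b) 0) (f 0 (suc b)) (g 0 (suc b))
δ-minus f g (suc a) b =
  trans (cong₂ _+ᶻ_ (δ-minus f g a (suc b)) (sub-of-subs (f (suc b) (suc a)) _ _ _)) (sum-of-subs (δ f a (suc b)) _ _ _)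

∂-additive : ∀ i e → Additive (λ f → ∂ i f e)
∂-additive zero [] = record { ext = λ _ → refl ; add = λ _ _ → refl ; minus = λ _ _ → refl }
∂-additive zero (a ∷ []) = record { ext = λ _ → refl ; add = λ _ _ → refl ; minus = λ _ _ → refl }
∂-additive zero (a ∷ b ∷ e) = record
  { ext = λ h → δ-cong (λ _ _ → h _) a b
  ; add = λ f g → δ-add _ _ a b
  ; minus = λ f g → δ-minus _ _ a b }
∂-additive (suc i) [] = record { ext = λ _ → refl ; add = λ _ _ → refl ; minus = λ _ _ → refl }
∂-additive (suc i) (a ∷ e) = record
  { ext = λ h → ext (∂-additive i e) (λ _ → h _)
  ; add = λ f g → add (∂-additive i e) _ _
  ; minus = λ f g → minus (∂-additive i e) _ _ }

X-additive : ∀ i e → Additive (λ f → X i f e)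
X-additive i [] = record { ext = λ _ → refl ; add = λ _ _ → refl ; minus = λ _ _ → refl }
X-additive zero (zero ∷ e) = record { ext = λ _ → refl ; add = λ _ _ → refl ; minus = λ _ _ → refl }
X-additive zero (suc a ∷ e) = record { ext = λ h → h _ ; add = λ _ _ → refl ; minus = λ _ _ → refl }
X-additive (suc i) (a ∷ e) = record
  { ext = λ h → ext (X-additive i e) (λ _ → h _)
  ; add = λ f g → add (X-additive i e) _ _
  ; minus = λ f g → minus (X-additive i e) _ _ }

∂-cong : ∀ i {f g} → f ≗ g → ∂ i f ≗ ∂ i g
∂-cong i h e = ext (∂-additive i e) h

X-cong : ∀ i {f g} → f ≗ g → X i f ≗ X i g
X-cong i h e = ext (X-additive i e) h

∂-far : ∀ {i k} → suc i < k → ∀ f → ∂ i (∂ k f) ≗ ∂ k (∂ i f)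
∂-far {zero} {suc (suc k)} _ f [] = refl
∂-far {zero} {suc (suc k)} _ f (a ∷ []) = refl
∂-far {zero} {suc (suc k)} _ f (a ∷ b ∷ e) =
  sym (commute-δ (∂-additive k e) (λ x y e′ → f (x ∷ y ∷ e′)) a b)
∂-far {zero} {suc zero} (s≤s ()) f e
∂-far {suc i} {suc k} (s≤s p) f [] = refl
∂-far {suc i} {suc k} (s≤s p) f (a ∷ e) = ∂-far p (λ e′ → f (a ∷ e′)) e

∂∂≡0 : ∀ i f e → ∂ i (∂ i f) e ≡ 0ℤ
∂∂≡0 zero f [] = refl
∂∂≡0 zero f (a ∷ []) = refl
∂∂≡0 zero f (a ∷ b ∷ e) = δ-symmetric≡0 (δ-sym _) a b
∂∂≡0 (suc i) f [] = refl
∂∂≡0 (suc i) f (a ∷ e) = ∂∂≡0 i _ e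

X-∂-below : ∀ {r k} → r < k → ∀ f → X r (∂ k f) ≗ ∂ k (X r f)
X-∂-below {zero} {suc k} _ f [] = refl
X-∂-below {zero} {suc k} _ f (zero ∷ e) = sym (null (∂-additive k e))
X-∂-below {zero} {suc k} _ f (suc a ∷ e) = refl
X-∂-below {suc r} {suc k} (s≤s p) f [] = refl
X-∂-below {suc r} {suc k} (s≤s p) f (a ∷ e) = X-∂-below p _ e

X-∂-above : ∀ {r k} → suc k < r → ∀ f → X r (∂ k f) ≗ ∂ k (X r f)
X-∂-above {suc (suc r)} {zero} _ f [] = refl
X-∂-above {suc (suc r)} {zero} _ f (a ∷ []) = refl
X-∂-above {suc (suc r)} {zero} _ f (a ∷ b ∷ e) = commute-δ (X-additive r e) (λ x y e′ → f (x ∷ y ∷ e′)) a b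
X-∂-above {suc zero} {zero} (s≤s ()) f e
X-∂-above {suc r} {suc k} (s≤s p) f [] = refl
X-∂-above {suc r} {suc k} (s≤s p) f (a ∷ e) = X-∂-above p _ e

x· y· : (ℕ → ℕ → ℤ) → ℕ → ℕ → ℤ
x· f zero    b = 0ℤ
x· f (suc a) b = f a b
y· f a zero    = 0ℤ
y· f a (suc b) = f a b

-- The twisted Leibniz rule for ∂(y f), solved for x ∂f: in this form it later produces the
-- additional cover in the co-transition formula.
δ-Leibniz : ∀ f a b → x· (δ f) a b ≡ δ (y· f) a b +ᶻ f a b
δ-Leibniz f zero b = cancel (f 0 b)
  where
  cancel : ∀ p → 0ℤ ≡ (0ℤ -ᶻ p) +ᶻ p
  cancel = solve-∀
δ-Leibniz f (suc zero) b = cancel (f 0 (suc b)) (f (suc b) 0) (f 1 b)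
  where
  cancel : ∀ p q r → q -ᶻ p ≡ ((0ℤ -ᶻ p) +ᶻ (q -ᶻ r)) +ᶻ r
  cancel = solve-∀
δ-Leibniz f (suc (suc a)) b =
  trans (cong (_+ᶻ (f (suc b) (suc a) -ᶻ f (suc a) (suc b))) (δ-Leibniz f (suc a) (suc b)))
        (cancel (δ (y· f) (suc a) (suc b)) (f (suc a) (suc b)) (f (suc b) (suc a)) (f (suc (suc a)) b))
  where
  cancel : ∀ u p q r → (u +ᶻ p) +ᶻ (q -ᶻ p) ≡ (u +ᶻ (q -ᶻ r)) +ᶻ r
  cancel = solve-∀

Leibniz : ∀ r f e → suc r < length e → X r (∂ r f) e ≡ ∂ r (X (suc r) f) e +ᶻ f e
Leibniz zero f (a ∷ b ∷ e) _ = trans (lhs a) (trans (δ-Leibniz F a b) (cong (_+ᶻ F a b) (δ-cong rhs a b)))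
  where
  F : ℕ → ℕ → ℤ
  F x y = f (x ∷ y ∷ e)
  lhs : ∀ a → X 0 (∂ 0 f) (a ∷ b ∷ e) ≡ x· (δ F) a b
  lhs zero = refl
  lhs (suc a) = refl
  rhs : ∀ x y → y· F x y ≡ X 1 f (x ∷ y ∷ e)
  rhs x zero = refl
  rhs x (suc y) = refl
Leibniz zero f (a ∷ []) (s≤s ())
Leibniz (suc r) f (a ∷ e) (s≤s p) = Leibniz r (λ e′ → f (a ∷ e′)) e p

-- The equation from which the recursion for `δ` was solved. Apart from the symmetry of `δ f`, the
-- braid relation uses nothing else about `δ`.
δ-spec : ∀ f a b → x· (δ f) a b -ᶻ y· (δ f) a b ≡ f a b -ᶻ f b a
δ-spec f zero zero = sym (ℤₚ.i≡j⇒i-j≡0 {f 0 0} refl)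
δ-spec f zero (suc b) = cancel (f (suc b) 0) (f 0 (suc b))
  where
  cancel : ∀ p q → 0ℤ -ᶻ (p -ᶻ q) ≡ q -ᶻ p
  cancel = solve-∀
δ-spec f (suc a) zero = trans (ℤₚ.+-identityʳ _) (δ-sym f a 0)
δ-spec f (suc a) (suc b) = cancel (δ f a (suc b)) (f (suc b) (suc a)) (f (suc a) (suc b))
  where
  cancel : ∀ u p q → u -ᶻ (u +ᶻ (p -ᶻ q)) ≡ q -ᶻ p
  cancel = solve-∀

-- The braid relation in three variables

Series₃ : Set
Series₃ = ℕ → ℕ → ℕ → ℤ

infix 4 _≈₃_
_≈₃_ : Series₃ → Series₃ → Set
f ≈₃ g = ∀ a b c → f a b c ≡ g a b c

infixl 6 _⊝_
_⊝_ : Series₃ → Series₃ → Series₃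
(f ⊝ g) a b c = f a b c -ᶻ g a b c

x₁ x₂ x₃ : Series₃ → Series₃
x₁ f zero b c = 0ℤ
x₁ f (suc a) b c = f a b c
x₂ f a zero c = 0ℤ
x₂ f a (suc b) c = f a b c
x₃ f a b zero = 0ℤ
x₃ f a b (suc c) = f a b c

s₁₂ s₂₃ : Series₃ → Series₃
s₁₂ f a b c = f b a c
s₂₃ f a b c = f a c b

δ₁₂ δ₂₃ : Series₃ → Series₃
δ₁₂ f a b c = δ (λ x y → f x y c) a b
δ₂₃ f a b c = δ (λ y z → f a y z) b c

m₁₂ m₂₃ m₁₃ : Series₃ → Series₃
m₁₂ f = x₁ f ⊝ x₂ f
m₂₃ f = x₂ f ⊝ x₃ f
m₁₃ f = x₁ f ⊝ x₃ f

-- One half of the braid relation: multiplied by the Vandermonde product, either threefold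
-- divided difference becomes the same alternating sum over S₃.  The roles of (1 2) and (2 3)
-- are abstract so that both halves are instances.
module Braid
  (d₁ d₂ s₁ s₂ m₁ m₂ m₃ : Series₃ → Series₃)
  (m₂-cong : ∀ {f g} → f ≈₃ g → m₂ f ≈₃ m₂ g)
  (m₃-cong : ∀ {f g} → f ≈₃ g → m₃ f ≈₃ m₃ g)
  (s₁-cong : ∀ {f g} → f ≈₃ g → s₁ f ≈₃ s₁ g)
  (s₂-cong : ∀ {f g} → f ≈₃ g → s₂ f ≈₃ s₂ g)
  (m₂-sub : ∀ f g → m₂ (f ⊝ g) ≈₃ m₂ f ⊝ m₂ g)
  (m₃-sub : ∀ f g → m₃ (f ⊝ g) ≈₃ m₃ f ⊝ m₃ g)
  (s₁-sub : ∀ f g → s₁ (f ⊝ g) ≈₃ s₁ f ⊝ s₁ g)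
  (m₃m₂ : ∀ f → m₃ (m₂ f) ≈₃ m₂ (m₃ f))
  (m₃-m₂ : ∀ f → m₃ f ⊝ m₂ f ≈₃ m₁ f)
  (spec₁ : ∀ f → m₁ (d₁ f) ≈₃ f ⊝ s₁ f)
  (spec₂ : ∀ f → m₂ (d₂ f) ≈₃ f ⊝ s₂ f)
  (inv₁ : ∀ f → s₁ (d₁ f) ≈₃ d₁ f)
  (m₃s₁ : ∀ f → m₃ (s₁ f) ≈₃ s₁ (m₂ f))
  (m₂s₁ : ∀ f → m₂ (s₁ f) ≈₃ s₁ (m₃ f))
  (m₃s₂ : ∀ f → m₃ (s₂ f) ≈₃ s₂ (m₁ f))
  where

  private
    sub-cong : ∀ {f f′ g g′} → f ≈₃ f′ → g ≈₃ g′ → f ⊝ g ≈₃ f′ ⊝ g′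
    sub-cong p q a b c = cong₂ _-ᶻ_ (p a b c) (q a b c)
    infixr 5 _then_
    _then_ : ∀ {f g h} → f ≈₃ g → g ≈₃ h → f ≈₃ h
    (p then q) a b c = trans (p a b c) (q a b c)

  alternating : Series₃ → Series₃
  alternating f = (f ⊝ s₁ f) ⊝ (s₂ (f ⊝ s₁ f) ⊝ s₁ (s₂ (f ⊝ s₁ f)))

  vandermonde : ∀ f → m₃ (m₂ (m₁ (d₁ (d₂ (d₁ f))))) ≈₃ alternating f
  vandermonde f =
    m₃-cong (m₂-cong (spec₁ B) then m₂-sub B (s₁ B)) then m₃-sub _ _ then
    sub-cong (m₃-cong (spec₂ A) then m₃-sub A (s₂ A))
             (m₃m₂ (s₁ B) then m₂-cong m₃s₁B then m₂-sub A _) then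
    (λ a b c → sub-of-subs (m₃ A a b c) _ _ _) then
    -- The two terms in `A` alone combine to `m₁ A`, since `m₃ f ⊝ m₂ f` is `m₁ f`. That removes the
    -- last divided difference from them; the other two terms lose theirs once `m₂` and `m₃` are
    -- moved through the swaps.
    sub-cong (m₃-m₂ A then spec₁ f) (sub-cong m₃s₂A (m₂s₁ (s₂ A) then s₁-cong m₃s₂A))
    where
    A B : Series₃
    A = d₁ f
    B = d₂ A
    m₃s₁B : m₃ (s₁ B) ≈₃ A ⊝ s₁ (s₂ A)
    m₃s₁B = m₃s₁ B then s₁-cong (spec₂ A) then s₁-sub A (s₂ A) then
      sub-cong (inv₁ f) (λ _ _ _ → refl)
    m₃s₂A : m₃ (s₂ A) ≈₃ s₂ (f ⊝ s₁ f)
    m₃s₂A = m₃s₂ A then s₂-cong (spec₁ f)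

-- x - y is not a zero divisor: the hypothesis makes `g` constant along each antidiagonal, and at
-- the end with first exponent 0 a single coefficient of `g` remains, up to sign.
x-y≡0⇒≡0 : ∀ (g : ℕ → ℕ → ℤ) → (∀ a b → x· g a b -ᶻ y· g a b ≡ 0ℤ) → ∀ a b → g a b ≡ 0ℤ
x-y≡0⇒≡0 g h zero b = trans (sym (ℤₚ.neg-involutive (g 0 b)))
  (cong (-ᶻ_) (trans (sym (ℤₚ.+-identityˡ _)) (h 0 (suc b))))
x-y≡0⇒≡0 g h (suc a) b =
  trans (sym (ℤₚ.i-j≡0⇒i≡j (g a (suc b)) (g (suc a) b) (h (suc a) (suc b)))) (x-y≡0⇒≡0 g h a (suc b))

m₁₂-cancel : ∀ f → (∀ a b c → m₁₂ f a b c ≡ 0ℤ) → ∀ a b c → f a b c ≡ 0ℤ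
m₁₂-cancel f h a b c = x-y≡0⇒≡0 (λ x y → f x y c) h′ a b
  where
  h′ : ∀ x y → _
  h′ zero zero = h 0 0 c
  h′ zero (suc y) = h 0 (suc y) c
  h′ (suc x) zero = h (suc x) 0 c
  h′ (suc x) (suc y) = h (suc x) (suc y) c

m₂₃-cancel : ∀ f → (∀ a b c → m₂₃ f a b c ≡ 0ℤ) → ∀ a b c → f a b c ≡ 0ℤ
m₂₃-cancel f h a b c = x-y≡0⇒≡0 (λ y z → f a y z) h′ b c
  where
  h′ : ∀ x y → _
  h′ zero zero = h a 0 0
  h′ zero (suc y) = h a 0 (suc y)
  h′ (suc x) zero = h a (suc x) 0
  h′ (suc x) (suc y) = h a (suc x) (suc y)

m₁₃-cancel : ∀ f → (∀ a b c → m₁₃ f a b c ≡ 0ℤ) → ∀ a b c → f a b c ≡ 0ℤ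
m₁₃-cancel f h a b c = x-y≡0⇒≡0 (λ x z → f x b z) h′ a c
  where
  h′ : ∀ x y → _
  h′ zero zero = h 0 b 0
  h′ zero (suc y) = h 0 b (suc y)
  h′ (suc x) zero = h (suc x) b 0
  h′ (suc x) (suc y) = h (suc x) b (suc y)

x₁-cong : ∀ {f g} → f ≈₃ g → x₁ f ≈₃ x₁ g
x₁-cong h zero b c = refl
x₁-cong h (suc a) b c = h a b c
x₂-cong : ∀ {f g} → f ≈₃ g → x₂ f ≈₃ x₂ g
x₂-cong h a zero c = refl
x₂-cong h a (suc b) c = h a b c
x₃-cong : ∀ {f g} → f ≈₃ g → x₃ f ≈₃ x₃ g
x₃-cong h a b zero = refl
x₃-cong h a b (suc c) = h a b c

x₁-sub : ∀ f g → x₁ (f ⊝ g) ≈₃ x₁ f ⊝ x₁ g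
x₁-sub f g zero b c = refl
x₁-sub f g (suc a) b c = refl
x₂-sub : ∀ f g → x₂ (f ⊝ g) ≈₃ x₂ f ⊝ x₂ g
x₂-sub f g a zero c = refl
x₂-sub f g a (suc b) c = refl
x₃-sub : ∀ f g → x₃ (f ⊝ g) ≈₃ x₃ f ⊝ x₃ g
x₃-sub f g a b zero = refl
x₃-sub f g a b (suc c) = refl

x₁x₂ : ∀ f → x₁ (x₂ f) ≈₃ x₂ (x₁ f)
x₁x₂ f zero zero c = refl
x₁x₂ f zero (suc b) c = refl
x₁x₂ f (suc a) zero c = refl
x₁x₂ f (suc a) (suc b) c = refl
x₁x₃ : ∀ f → x₁ (x₃ f) ≈₃ x₃ (x₁ f)
x₁x₃ f zero b zero = refl
x₁x₃ f zero b (suc c) = refl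
x₁x₃ f (suc a) b zero = refl
x₁x₃ f (suc a) b (suc c) = refl
x₂x₃ : ∀ f → x₂ (x₃ f) ≈₃ x₃ (x₂ f)
x₂x₃ f a zero zero = refl
x₂x₃ f a zero (suc c) = refl
x₂x₃ f a (suc b) zero = refl
x₂x₃ f a (suc b) (suc c) = refl

module Difference
  (u v : Series₃ → Series₃)
  (u-cong : ∀ {f g} → f ≈₃ g → u f ≈₃ u g) (v-cong : ∀ {f g} → f ≈₃ g → v f ≈₃ v g)
  (u-sub : ∀ f g → u (f ⊝ g) ≈₃ u f ⊝ u g) (v-sub : ∀ f g → v (f ⊝ g) ≈₃ v f ⊝ v g)
  where
  d-cong : ∀ {f g} → f ≈₃ g → u f ⊝ v f ≈₃ u g ⊝ v g
  d-cong h a b c = cong₂ _-ᶻ_ (u-cong h a b c) (v-cong h a b c)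
  d-sub : ∀ f g → u (f ⊝ g) ⊝ v (f ⊝ g) ≈₃ (u f ⊝ v f) ⊝ (u g ⊝ v g)
  d-sub f g a b c = trans (cong₂ _-ᶻ_ (u-sub f g a b c) (v-sub f g a b c)) (sub-of-subs (u f a b c) _ _ _)

open Difference x₁ x₂ x₁-cong x₂-cong x₁-sub x₂-sub renaming (d-cong to m₁₂-cong; d-sub to m₁₂-sub)
open Difference x₂ x₃ x₂-cong x₃-cong x₂-sub x₃-sub renaming (d-cong to m₂₃-cong; d-sub to m₂₃-sub)
open Difference x₁ x₃ x₁-cong x₃-cong x₁-sub x₃-sub renaming (d-cong to m₁₃-cong; d-sub to m₁₃-sub)

private
  m₁₃m₂₃ : ∀ f → m₁₃ (m₂₃ f) ≈₃ m₂₃ (m₁₃ f)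
  m₁₃m₂₃ f a b c = trans
    (cong₂ _-ᶻ_ (trans (x₁-sub _ _ a b c) (cong₂ _-ᶻ_ (x₁x₂ f a b c) (x₁x₃ f a b c)))
                (trans (x₃-sub _ _ a b c) (cong (_-ᶻ x₃ (x₃ f) a b c) (sym (x₂x₃ f a b c)))))
    (trans (sub-of-subs (x₂ (x₁ f) a b c) _ _ _)
           (sym (cong₂ _-ᶻ_ (x₂-sub _ _ a b c) (x₃-sub _ _ a b c))))

  m₁₃m₁₂ : ∀ f → m₁₃ (m₁₂ f) ≈₃ m₁₂ (m₁₃ f)
  m₁₃m₁₂ f a b c = trans
    (cong₂ _-ᶻ_ (x₁-sub _ _ a b c) (trans (x₃-sub _ _ a b c)
      (sym (cong₂ _-ᶻ_ (x₁x₃ f a b c) (x₂x₃ f a b c)))))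
    (trans (sub-of-subs (x₁ (x₁ f) a b c) _ _ _)
           (sym (cong₂ _-ᶻ_ (x₁-sub _ _ a b c)
             (trans (x₂-sub _ _ a b c) (cong (_-ᶻ x₂ (x₃ f) a b c) (sym (x₁x₂ f a b c)))))))

  x₁s₁₂ : ∀ f → x₁ (s₁₂ f) ≈₃ s₁₂ (x₂ f)
  x₁s₁₂ f zero b c = refl
  x₁s₁₂ f (suc a) b c = refl
  x₂s₁₂ : ∀ f → x₂ (s₁₂ f) ≈₃ s₁₂ (x₁ f)
  x₂s₁₂ f a zero c = refl
  x₂s₁₂ f a (suc b) c = refl
  x₃s₁₂ : ∀ f → x₃ (s₁₂ f) ≈₃ s₁₂ (x₃ f)
  x₃s₁₂ f a b zero = refl
  x₃s₁₂ f a b (suc c) = refl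
  x₁s₂₃ : ∀ f → x₁ (s₂₃ f) ≈₃ s₂₃ (x₁ f)
  x₁s₂₃ f zero b c = refl
  x₁s₂₃ f (suc a) b c = refl
  x₂s₂₃ : ∀ f → x₂ (s₂₃ f) ≈₃ s₂₃ (x₃ f)
  x₂s₂₃ f a zero c = refl
  x₂s₂₃ f a (suc b) c = refl
  x₃s₂₃ : ∀ f → x₃ (s₂₃ f) ≈₃ s₂₃ (x₂ f)
  x₃s₂₃ f a b zero = refl
  x₃s₂₃ f a b (suc c) = refl

  sub-sub-cancelʳ : ∀ a b c → (a -ᶻ c) -ᶻ (b -ᶻ c) ≡ a -ᶻ b
  sub-sub-cancelʳ = solve-∀

  sub-sub-cancelˡ : ∀ a b c → (a -ᶻ c) -ᶻ (a -ᶻ b) ≡ b -ᶻ c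
  sub-sub-cancelˡ = solve-∀

  spec₁₂ : ∀ f → m₁₂ (δ₁₂ f) ≈₃ f ⊝ s₁₂ f
  spec₁₂ f a b c = trans (xy a b) (δ-spec (λ x y → f x y c) a b)
    where
    xy : ∀ a b → m₁₂ (δ₁₂ f) a b c ≡ x· (δ (λ x y → f x y c)) a b -ᶻ y· (δ (λ x y → f x y c)) a b
    xy zero zero = refl
    xy zero (suc b) = refl
    xy (suc a) zero = refl
    xy (suc a) (suc b) = refl
  spec₂₃ : ∀ f → m₂₃ (δ₂₃ f) ≈₃ f ⊝ s₂₃ f
  spec₂₃ f a b c = trans (yz b c) (δ-spec (λ y z → f a y z) b c)
    where
    yz : ∀ b c → m₂₃ (δ₂₃ f) a b c ≡ x· (δ (λ y z → f a y z)) b c -ᶻ y· (δ (λ y z → f a y z)) b c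
    yz zero zero = refl
    yz zero (suc c) = refl
    yz (suc b) zero = refl
    yz (suc b) (suc c) = refl

  module First = Braid δ₁₂ δ₂₃ s₁₂ s₂₃ m₁₂ m₂₃ m₁₃ m₂₃-cong m₁₃-cong
    (λ h a b c → h b a c) (λ h a b c → h a c b) m₂₃-sub m₁₃-sub (λ _ _ _ _ _ → refl)
    m₁₃m₂₃ (λ f a b c → sub-sub-cancelʳ (x₁ f a b c) (x₂ f a b c) (x₃ f a b c))
    (λ f a b c → spec₁₂ f a b c) (λ f a b c → spec₂₃ f a b c) (λ f a b c → δ-sym _ b a)
    (λ f a b c → cong₂ _-ᶻ_ (x₁s₁₂ f a b c) (x₃s₁₂ f a b c))
    (λ f a b c → cong₂ _-ᶻ_ (x₂s₁₂ f a b c) (x₃s₁₂ f a b c))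
    (λ f a b c → cong₂ _-ᶻ_ (x₁s₂₃ f a b c) (x₃s₂₃ f a b c))

  module Second = Braid δ₂₃ δ₁₂ s₂₃ s₁₂ m₂₃ m₁₂ m₁₃ m₁₂-cong m₁₃-cong
    (λ h a b c → h a c b) (λ h a b c → h b a c) m₁₂-sub m₁₃-sub (λ _ _ _ _ _ → refl)
    m₁₃m₁₂ (λ f a b c → sub-sub-cancelˡ (x₁ f a b c) (x₂ f a b c) (x₃ f a b c))
    spec₂₃ spec₁₂ (λ f a b c → δ-sym _ c b)
    (λ f a b c → cong₂ _-ᶻ_ (x₁s₂₃ f a b c) (x₃s₂₃ f a b c))
    (λ f a b c → cong₂ _-ᶻ_ (x₁s₂₃ f a b c) (x₂s₂₃ f a b c))
    (λ f a b c → cong₂ _-ᶻ_ (x₁s₁₂ f a b c) (x₃s₁₂ f a b c))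

  m₁₂m₂₃ : ∀ f → m₁₂ (m₂₃ f) ≈₃ m₂₃ (m₁₂ f)
  m₁₂m₂₃ f a b c = trans
    (cong₂ _-ᶻ_ (trans (x₁-sub _ _ a b c) (cong₂ _-ᶻ_ (x₁x₂ f a b c) (x₁x₃ f a b c)))
                (trans (x₂-sub _ _ a b c) (cong (λ u → x₂ (x₂ f) a b c -ᶻ u) (x₂x₃ f a b c))))
    (trans (sub-of-subs (x₂ (x₁ f) a b c) _ _ _)
           (sym (cong₂ _-ᶻ_ (x₂-sub _ _ a b c) (x₃-sub _ _ a b c))))

  m-injective : ∀ {m : Series₃ → Series₃} → (∀ f g → m (f ⊝ g) ≈₃ m f ⊝ m g) →
    (∀ f → (∀ a b c → m f a b c ≡ 0ℤ) → ∀ a b c → f a b c ≡ 0ℤ) →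
    ∀ {f g} → m f ≈₃ m g → f ≈₃ g
  m-injective m-sub m-cancel {f} {g} h a b c = ℤₚ.i-j≡0⇒i≡j _ _
    (m-cancel (f ⊝ g) (λ a b c → trans (m-sub f g a b c) (ℤₚ.i≡j⇒i-j≡0 (h a b c))) a b c)

δ₁₂-δ₂₃-braid : ∀ f → δ₁₂ (δ₂₃ (δ₁₂ f)) ≈₃ δ₂₃ (δ₁₂ (δ₂₃ f))
δ₁₂-δ₂₃-braid f =
  m-injective m₁₂-sub m₁₂-cancel (m-injective m₂₃-sub m₂₃-cancel (m-injective m₁₃-sub m₁₃-cancel
    λ a b c → trans (First.vandermonde f a b c)
      (trans (regroup (f a b c) (f b a c) (f a c b) (f c a b) (f b c a) (f c b a))
        (trans (sym (Second.vandermonde f a b c)) (m₁₃-cong (m₁₂m₂₃ _) a b c)))))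
  where
  regroup : ∀ p q r s t u → (p -ᶻ q) -ᶻ ((r -ᶻ s) -ᶻ (t -ᶻ u)) ≡ (p -ᶻ r) -ᶻ ((q -ᶻ t) -ᶻ (s -ᶻ u))
  regroup = solve-∀

∂-braid : ∀ i f → ∂ i (∂ (suc i) (∂ i f)) ≗ ∂ (suc i) (∂ i (∂ (suc i) f))
∂-braid zero f [] = refl
∂-braid zero f (a ∷ []) = refl
∂-braid zero f (a ∷ b ∷ []) = δ-zero a b
∂-braid zero f (a ∷ b ∷ c ∷ e) = δ₁₂-δ₂₃-braid (λ x y z → f (x ∷ y ∷ z ∷ e)) a b c
∂-braid (suc i) f [] = refl
∂-braid (suc i) f (a ∷ e) = ∂-braid i _ e

-- Coefficients of the list polynomials

term : ℤ → Exp → Series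
term c e α = if eqE e α then c else 0ℤ

coeff-++ : ∀ p q α → coeff (p ++ q) α ≡ coeff p α +ᶻ coeff q α
coeff-++ [] q α = sym (ℤₚ.+-identityˡ _)
coeff-++ ((c , e) ∷ p) q α = trans (cong (term c e α +ᶻ_) (coeff-++ p q α))
  (sym (ℤₚ.+-assoc (term c e α) (coeff p α) (coeff q α)))

coeff-neg : ∀ p α → coeff (negP p) α ≡ -ᶻ coeff p α
coeff-neg [] α = refl
coeff-neg ((c , e) ∷ p) α = trans (cong₂ _+ᶻ_ (neg-term (eqE e α)) (coeff-neg p α))
  (sym (ℤₚ.neg-distrib-+ (term c e α) (coeff p α)))
  where
  neg-term : ∀ b → (if b then -ᶻ c else 0ℤ) ≡ -ᶻ (if b then c else 0ℤ)
  neg-term true = refl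
  neg-term false = refl

HasLength : ℕ → Poly → Set
HasLength n = All (λ t → length (proj₂ t) ≡ n)

eqE-length : ∀ e α → eqE e α ≡ true → length e ≡ length α
eqE-length [] [] _ = refl
eqE-length (a ∷ e) (b ∷ α) h with a ℕ.≡ᵇ b
... | true = cong suc (eqE-length e α h)

coeff-length : ∀ {n p} → HasLength n p → ∀ α → length α ≢ n → coeff p α ≡ 0ℤ
coeff-length [] α _ = refl
coeff-length {n} {(c , e) ∷ p} (h ∷ hs) α ≢n = cong₂ _+ᶻ_ vanish (coeff-length hs α ≢n)
  where
  vanish : term c e α ≡ 0ℤ
  vanish with eqE e α in eq
  ... | true = ⊥-elim (≢n (trans (sym (eqE-length e α eq)) h))
  ... | false = refl

term-X : ∀ k c e → k < length e → term c (setAt k (suc (at e k)) e) ≗ X k (term c e)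
term-X zero c (a ∷ e) _ [] = refl
term-X zero c (a ∷ e) _ (zero ∷ α) = refl
term-X zero c (a ∷ e) _ (suc x ∷ α) = refl
term-X (suc k) c (a ∷ e) _ [] = refl
term-X (suc k) c (a ∷ e) (s≤s h) (x ∷ α) with a ℕ.≡ᵇ x
... | true = term-X k c e h α
... | false = sym (null (X-additive k α))

coeff-mulX : ∀ {n} k p → HasLength n p → k < n → coeff (mulX k p) ≗ X k (coeff p)
coeff-mulX k [] _ _ α = sym (null (X-additive k α))
coeff-mulX k ((c , e) ∷ p) (refl ∷ hs) k<n α = trans
  (cong₂ _+ᶻ_ (term-X k c e k<n α) (coeff-mulX k p hs k<n α))
  (sym (add (X-additive k α) (term c e) (coeff p)))

monomial₂ : ℕ → ℕ → ℤ → ℕ → ℕ → ℤ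
monomial₂ p q c x y = if (p ℕ.≡ᵇ x) ∧ (q ℕ.≡ᵇ y) then c else 0ℤ

-- The companion of `δ-Leibniz`. At second exponent 0 the right side loses its first summand, and
-- the symmetry of `δ f` closes the gap.
δ-x· : ∀ f a b → δ (x· f) a b ≡ y· (δ f) a b +ᶻ f a b
δ-x· f zero zero = cancel (f 0 0)
  where
  cancel : ∀ p → p -ᶻ 0ℤ ≡ 0ℤ +ᶻ p
  cancel = solve-∀
δ-x· f zero (suc b) = cancel (f (suc b) 0) (f 0 (suc b))
  where
  cancel : ∀ p q → p -ᶻ 0ℤ ≡ (p -ᶻ q) +ᶻ q
  cancel = solve-∀
δ-x· f (suc a) zero = trans (cong (_+ᶻ (f 0 (suc a) -ᶻ f a 1)) (δ-x· f a 1))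
  (trans (cancel (δ f a 0) (f a 1) (f 0 (suc a)))
    (trans (cong (_+ᶻ f 0 (suc a)) (δ-sym f a 0)) (cancel′ (f (suc a) 0) (f 0 (suc a)))))
  where
  cancel : ∀ u p q → (u +ᶻ p) +ᶻ (q -ᶻ p) ≡ u +ᶻ q
  cancel = solve-∀
  cancel′ : ∀ p q → (p -ᶻ q) +ᶻ q ≡ 0ℤ +ᶻ p
  cancel′ = solve-∀
δ-x· f (suc a) (suc b) = trans (cong (_+ᶻ (f (suc b) (suc a) -ᶻ f a (suc (suc b)))) (δ-x· f a (suc (suc b))))
  (cancel (δ f a (suc b)) (f a (suc (suc b))) (f (suc b) (suc a)) (f (suc a) (suc b)))
  where
  cancel : ∀ u p q r → (u +ᶻ p) +ᶻ (q -ᶻ p) ≡ (u +ᶻ (q -ᶻ r)) +ᶻ r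
  cancel = solve-∀

δ-transpose : ∀ f a b → δ (λ x y → f y x) a b ≡ -ᶻ δ f a b
δ-transpose f zero b = cancel (f 0 (suc b)) (f (suc b) 0)
  where
  cancel : ∀ p q → p -ᶻ q ≡ -ᶻ (q -ᶻ p)
  cancel = solve-∀
δ-transpose f (suc a) b = trans (cong (_+ᶻ (f (suc a) (suc b) -ᶻ f (suc b) (suc a))) (δ-transpose f a (suc b)))
  (cancel (δ f a (suc b)) (f (suc a) (suc b)) (f (suc b) (suc a)))
  where
  cancel : ∀ u p q → -ᶻ u +ᶻ (p -ᶻ q) ≡ -ᶻ (u +ᶻ (q -ᶻ p))
  cancel = solve-∀

sumTo : ℕ → (ℕ → ℤ) → ℤ
sumTo zero    φ = 0ℤ
sumTo (suc m) φ = sumTo m φ +ᶻ φ m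

sumTo-cong : ∀ m {φ ψ} → (∀ k → k < m → φ k ≡ ψ k) → sumTo m φ ≡ sumTo m ψ
sumTo-cong zero h = refl
sumTo-cong (suc m) h = cong₂ _+ᶻ_ (sumTo-cong m (λ k k<m → h k (ℕₚ.m<n⇒m<1+n k<m))) (h m ℕₚ.≤-refl)

sumTo-zero : ∀ m → sumTo m (λ _ → 0ℤ) ≡ 0ℤ
sumTo-zero zero = refl
sumTo-zero (suc m) = cong (_+ᶻ 0ℤ) (sumTo-zero m)

sumTo-step : ∀ m φ → sumTo (suc m) φ ≡ φ 0 +ᶻ sumTo m (φ ∘ suc)
sumTo-step zero φ = ℤₚ.+-comm 0ℤ (φ 0)
sumTo-step (suc m) φ = trans (cong (_+ᶻ φ (suc m)) (sumTo-step m φ))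
  (ℤₚ.+-assoc (φ 0) _ _)

sum-applyUpTo : ∀ (φ : ℕ → ℤ) m → sumℤ (applyUpTo φ m) ≡ sumTo m φ
sum-applyUpTo φ zero = refl
sum-applyUpTo φ (suc m) = trans (cong (φ 0 +ᶻ_) (sum-applyUpTo (φ ∘ suc) m)) (sym (sumTo-step m φ))

monomial₂-shift : ∀ q k m c a b → k < m →
  monomial₂ (q + k) (q + suc m ∸ 1 ∸ k) c a b ≡ y· (monomial₂ (q + k) (q + m ∸ 1 ∸ k) c) a b
monomial₂-shift q k (suc m) c a b (s≤s k≤m) =
  trans (cong (λ t → monomial₂ (q + k) t c a b) exponent) (lower b)
  where
  exponent : q + suc (suc m) ∸ 1 ∸ k ≡ suc (q + suc m ∸ 1 ∸ k)
  exponent rewrite ℕₚ.+-suc q (suc m) | ℕₚ.+-suc q m = ℕₚ.+-∸-assoc 1 (ℕₚ.≤-trans k≤m (ℕₚ.m≤n+m m q))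
  lower : ∀ b → monomial₂ (q + k) (suc (q + suc m ∸ 1 ∸ k)) c a b ≡ y· (monomial₂ (q + k) (q + suc m ∸ 1 ∸ k) c) a b
  lower (suc b) = refl
  lower zero with (q + k) ℕ.≡ᵇ a
  ... | true = refl
  ... | false = refl

-- Induction on the difference m of the exponents: by `δ-x·`, one more factor x multiplies all
-- earlier summands by y and adds one new summand at the end.
δ-monomial₂ : ∀ q m c a b →
  sumTo m (λ k → monomial₂ (q + k) (q + m ∸ 1 ∸ k) c a b) ≡ δ (monomial₂ (q + m) q c) a b
δ-monomial₂ q zero c a b rewrite ℕₚ.+-identityʳ q =
  sym (δ-symmetric≡0 symmetric a b)
  where
  symmetric : ∀ x y → monomial₂ q q c x y ≡ monomial₂ q q c y x
  symmetric x y with q ℕ.≡ᵇ x | q ℕ.≡ᵇ y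
  ... | true | true = refl
  ... | true | false = refl
  ... | false | true = refl
  ... | false | false = refl
δ-monomial₂ q (suc m) c a b = begin
  sumTo m (λ k → monomial₂ (q + k) (q + suc m ∸ 1 ∸ k) c a b) +ᶻ monomial₂ (q + m) (q + suc m ∸ 1 ∸ m) c a b
    ≡⟨ cong₂ _+ᶻ_ (sumTo-cong m (λ k k<m → monomial₂-shift q k m c a b k<m)) (cong (λ t → monomial₂ (q + m) t c a b) last) ⟩
  sumTo m (λ k → y· (monomial₂ (q + k) (q + m ∸ 1 ∸ k) c) a b) +ᶻ monomial₂ (q + m) q c a b
    ≡⟨ cong (_+ᶻ monomial₂ (q + m) q c a b) (lower b) ⟩
  y· (δ (monomial₂ (q + m) q c)) a b +ᶻ monomial₂ (q + m) q c a b
    ≡⟨ δ-x· (monomial₂ (q + m) q c) a b ⟨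
  δ (x· (monomial₂ (q + m) q c)) a b
    ≡⟨ δ-cong raise a b ⟩
  δ (monomial₂ (q + suc m) q c) a b ∎
  where
  open ≡-Reasoning
  raise : ∀ x y → x· (monomial₂ (q + m) q c) x y ≡ monomial₂ (q + suc m) q c x y
  raise x y rewrite ℕₚ.+-suc q m with x
  ... | zero = refl
  ... | suc x′ = refl
  last : q + suc m ∸ 1 ∸ m ≡ q
  last rewrite ℕₚ.+-suc q m = ℕₚ.m+n∸n≡m q m
  lower : ∀ b → sumTo m (λ k → y· (monomial₂ (q + k) (q + m ∸ 1 ∸ k) c) a b) ≡ y· (δ (monomial₂ (q + m) q c)) a b
  lower zero = sumTo-zero m
  lower (suc b) = δ-monomial₂ q m c a b

term-∷∷ : ∀ c p q r a b α →
  term c (p ∷ q ∷ r) (a ∷ b ∷ α) ≡ monomial₂ p q (term c r α) a b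
term-∷∷ c p q r a b α with p ℕ.≡ᵇ a | q ℕ.≡ᵇ b
... | true | true = refl
... | true | false = refl
... | false | true = refl
... | false | false = refl

neg-term : ∀ c r α → term (-ᶻ c) r α ≡ -ᶻ term c r α
neg-term c r α with eqE r α
... | true = refl
... | false = refl

neg-monomial₂ : ∀ p q c a b → -ᶻ monomial₂ q p c a b ≡ monomial₂ q p (-ᶻ c) a b
neg-monomial₂ p q c a b with (q ℕ.≡ᵇ a) ∧ (p ℕ.≡ᵇ b)
... | true = refl
... | false = refl

transpose-monomial₂ : ∀ p q c a b → monomial₂ p q c a b ≡ monomial₂ q p c b a
transpose-monomial₂ p q c a b with p ℕ.≡ᵇ a | q ℕ.≡ᵇ b
... | true | true = refl
... | true | false = refl
... | false | true = refl
... | false | false = refl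

coeff-upTo : ∀ c (F : ℕ → Exp) m α → coeff (map (λ k → (c , F k)) (upTo m)) α ≡ sumTo m (λ k → term c (F k) α)
coeff-upTo c F m α = trans (cong sumℤ (trans (sym (Listₚ.map-∘ (upTo m))) (Listₚ.map-upTo _ m)))
  (sum-applyUpTo (λ k → term c (F k) α) m)

coeff-vanish : ∀ c (F : ℕ → Exp) ks α → (∀ k → eqE (F k) α ≡ false) → coeff (map (λ k → (c , F k)) ks) α ≡ 0ℤ
coeff-vanish c F [] α h = refl
coeff-vanish c F (k ∷ ks) α h rewrite h k = trans (ℤₚ.+-identityˡ _) (coeff-vanish c F ks α h)

-- For p < q the list holds the quotient for the exchanged exponents with the opposite sign, and
-- `δ-transpose` accounts for both changes.
coeff-ddTerm₀ : ∀ c p q r → coeff (ddTerm 0 (c , p ∷ q ∷ r)) ≗ ∂ 0 (term c (p ∷ q ∷ r))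
coeff-ddTerm₀ c p q r α with q ℕ.≤ᵇ p in eq
coeff-ddTerm₀ c p q r [] | true = coeff-vanish c _ (upTo (p ∸ q)) [] (λ _ → refl)
coeff-ddTerm₀ c p q r [] | false = coeff-vanish (-ᶻ c) _ (upTo (q ∸ p)) [] (λ _ → refl)
coeff-ddTerm₀ c p q r (a ∷ []) | true = coeff-vanish c _ (upTo (p ∸ q)) (a ∷ []) (λ k → false-∧ ((q + k) ℕ.≡ᵇ a))
  where
  false-∧ : ∀ b → b ∧ false ≡ false
  false-∧ true = refl
  false-∧ false = refl
coeff-ddTerm₀ c p q r (a ∷ []) | false = coeff-vanish (-ᶻ c) _ (upTo (q ∸ p)) (a ∷ []) (λ k → false-∧ ((p + k) ℕ.≡ᵇ a))
  where
  false-∧ : ∀ b → b ∧ false ≡ false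
  false-∧ true = refl
  false-∧ false = refl
coeff-ddTerm₀ c p q r (a ∷ b ∷ α) | true = begin
  coeff (map (λ k → (c , (q + k) ∷ (p ∸ 1 ∸ k) ∷ r)) (upTo (p ∸ q))) (a ∷ b ∷ α)
    ≡⟨ coeff-upTo c _ (p ∸ q) (a ∷ b ∷ α) ⟩
  sumTo (p ∸ q) (λ k → term c ((q + k) ∷ (p ∸ 1 ∸ k) ∷ r) (a ∷ b ∷ α))
    ≡⟨ sumTo-cong (p ∸ q) (λ k _ → term-∷∷ c (q + k) (p ∸ 1 ∸ k) r a b α) ⟩
  sumTo (p ∸ q) (λ k → monomial₂ (q + k) (p ∸ 1 ∸ k) (term c r α) a b)
    ≡⟨ subst (λ t → sumTo (p ∸ q) (λ k → monomial₂ (q + k) (t ∸ 1 ∸ k) (term c r α) a b) ≡ δ (monomial₂ t q (term c r α)) a b)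
         (ℕₚ.m+[n∸m]≡n (ℕₚ.≤ᵇ⇒≤ q p (subst T (sym eq) _))) (δ-monomial₂ q (p ∸ q) (term c r α) a b) ⟩
  δ (monomial₂ p q (term c r α)) a b
    ≡⟨ δ-cong (λ x y → sym (term-∷∷ c p q r x y α)) a b ⟩
  δ (λ x y → term c (p ∷ q ∷ r) (x ∷ y ∷ α)) a b ∎
  where open ≡-Reasoning
coeff-ddTerm₀ c p q r (a ∷ b ∷ α) | false = begin
  coeff (map (λ k → (-ᶻ c , (p + k) ∷ (q ∸ 1 ∸ k) ∷ r)) (upTo (q ∸ p))) (a ∷ b ∷ α)
    ≡⟨ coeff-upTo (-ᶻ c) _ (q ∸ p) (a ∷ b ∷ α) ⟩
  sumTo (q ∸ p) (λ k → term (-ᶻ c) ((p + k) ∷ (q ∸ 1 ∸ k) ∷ r) (a ∷ b ∷ α))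
    ≡⟨ sumTo-cong (q ∸ p) (λ k _ → term-∷∷ (-ᶻ c) (p + k) (q ∸ 1 ∸ k) r a b α) ⟩
  sumTo (q ∸ p) (λ k → monomial₂ (p + k) (q ∸ 1 ∸ k) c′ a b)
    ≡⟨ subst (λ t → sumTo (q ∸ p) (λ k → monomial₂ (p + k) (t ∸ 1 ∸ k) c′ a b) ≡ δ (monomial₂ t p c′) a b)
         (ℕₚ.m+[n∸m]≡n p≤q) (δ-monomial₂ p (q ∸ p) c′ a b) ⟩
  δ (monomial₂ q p c′) a b
    ≡⟨ δ-cong (λ x y → transpose-monomial₂ q p c′ x y) a b ⟩
  δ (λ x y → monomial₂ p q c′ y x) a b
    ≡⟨ δ-transpose (monomial₂ p q c′) a b ⟩
  -ᶻ δ (monomial₂ p q c′) a b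
    ≡⟨ cong -ᶻ_ (δ-cong (λ x y → trans (cong (λ t → monomial₂ p q t x y) (neg-term c r α))
         (sym (neg-monomial₂ q p (term c r α) x y))) a b) ⟩
  -ᶻ δ (λ x y → -ᶻ monomial₂ p q (term c r α) x y) a b
    ≡⟨ cong -ᶻ_ (trans (δ-cong (λ x y → sym (ℤₚ.+-identityˡ _)) a b)
         (trans (δ-minus (λ _ _ → 0ℤ) (monomial₂ p q (term c r α)) a b) (cong (_-ᶻ δ (monomial₂ p q (term c r α)) a b) (δ-zero a b)))) ⟩
  -ᶻ (0ℤ -ᶻ δ (monomial₂ p q (term c r α)) a b)
    ≡⟨ cancel (δ (monomial₂ p q (term c r α)) a b) ⟩
  δ (monomial₂ p q (term c r α)) a b
    ≡⟨ δ-cong (λ x y → sym (term-∷∷ c p q r x y α)) a b ⟩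
  δ (λ x y → term c (p ∷ q ∷ r) (x ∷ y ∷ α)) a b ∎
  where
  open ≡-Reasoning
  c′ = term (-ᶻ c) r α
  cancel : ∀ u → -ᶻ (0ℤ -ᶻ u) ≡ u
  cancel = solve-∀
  p≤q : p ≤ q
  p≤q with ℕₚ.≤-total p q
  ... | inj₁ h = h
  ... | inj₂ h = ⊥-elim (subst T eq (ℕₚ.≤⇒≤ᵇ h))

prepend : ℕ → ℤ × Exp → ℤ × Exp
prepend x (c , e) = (c , x ∷ e)

ddTerm-∷ : ∀ i c x e → ddTerm (suc i) (c , x ∷ e) ≡ map (prepend x) (ddTerm i (c , e))
ddTerm-∷ i c x e with at e i | at e (suc i)
... | p | q with q ℕ.≤ᵇ p
...   | true = Listₚ.map-∘ (upTo (p ∸ q))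
...   | false = Listₚ.map-∘ (upTo (q ∸ p))

coeff-prepend : ∀ x p a α → coeff (map (prepend x) p) (a ∷ α) ≡ (if x ℕ.≡ᵇ a then coeff p α else 0ℤ)
coeff-prepend x [] a α with x ℕ.≡ᵇ a
... | true = refl
... | false = refl
coeff-prepend x ((c , e) ∷ p) a α with x ℕ.≡ᵇ a | coeff-prepend x p a α
... | true | ih = cong (term c e α +ᶻ_) ih
... | false | ih = cong (0ℤ +ᶻ_) ih

coeff-prepend-[] : ∀ x p → coeff (map (prepend x) p) [] ≡ 0ℤ
coeff-prepend-[] x [] = refl
coeff-prepend-[] x (t ∷ p) = trans (ℤₚ.+-identityˡ _) (coeff-prepend-[] x p)

coeff-ddTerm : ∀ i c e → suc i < length e → coeff (ddTerm i (c , e)) ≗ ∂ i (term c e)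
coeff-ddTerm zero c (p ∷ []) (s≤s ()) α
coeff-ddTerm zero c (p ∷ q ∷ r) _ α = coeff-ddTerm₀ c p q r α
coeff-ddTerm (suc i) c (x ∷ e) (s≤s h) [] = trans (cong (λ p → coeff p []) (ddTerm-∷ i c x e)) (coeff-prepend-[] x (ddTerm i (c , e)))
coeff-ddTerm (suc i) c (x ∷ e) (s≤s h) (a ∷ α) =
  trans (cong (λ p → coeff p (a ∷ α)) (ddTerm-∷ i c x e)) (trans (coeff-prepend x (ddTerm i (c , e)) a α) head)
  where
  head : (if x ℕ.≡ᵇ a then coeff (ddTerm i (c , e)) α else 0ℤ) ≡ ∂ i (λ e′ → term c (x ∷ e) (a ∷ e′)) α
  head with x ℕ.≡ᵇ a
  ... | true = coeff-ddTerm i c e h α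
  ... | false = sym (null (∂-additive i α))

coeff-dd : ∀ {n} i p → HasLength n p → suc i < n → coeff (dd i p) ≗ ∂ i (coeff p)
coeff-dd i [] _ _ α = sym (null (∂-additive i α))
coeff-dd i ((c , e) ∷ p) (refl ∷ hs) i<n α =
  trans (coeff-++ (ddTerm i (c , e)) (dd i p) α)
  (trans (cong₂ _+ᶻ_ (coeff-ddTerm i c e i<n α) (coeff-dd i p hs i<n α))
         (sym (add (∂-additive i α) (term c e) (coeff p))))

length-setAt : ∀ k v e → length (setAt k v e) ≡ length e
length-setAt k v [] = refl
length-setAt zero v (a ∷ e) = refl
length-setAt (suc k) v (a ∷ e) = cong suc (length-setAt k v e)

HasLength-ddTerm : ∀ i c e → HasLength (length e) (ddTerm i (c , e))
HasLength-ddTerm i c e with at e i | at e (suc i)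
... | p | q with q ℕ.≤ᵇ p
...   | true = Allₚ.map⁺ (All.universal (λ k → trans (length-setAt (suc i) (p ∸ 1 ∸ k) (setAt i (q + k) e)) (length-setAt i _ e)) (upTo (p ∸ q)))
...   | false = Allₚ.map⁺ (All.universal (λ k → trans (length-setAt (suc i) (q ∸ 1 ∸ k) (setAt i (p + k) e)) (length-setAt i _ e)) (upTo (q ∸ p)))

HasLength-dd : ∀ {n} i p → HasLength n p → HasLength n (dd i p)
HasLength-dd i [] _ = []
HasLength-dd i ((c , e) ∷ p) (refl ∷ hs) = Allₚ.++⁺ (HasLength-ddTerm i c e) (HasLength-dd i p hs)

HasLength-oneMinusX : ∀ {n} k p → HasLength n p → HasLength n (oneMinusX k p)
HasLength-oneMinusX k p hs = Allₚ.++⁺ hs (Allₚ.map⁺ (Allₚ.map⁺ (All.map (λ {t} → trans (length-setAt k (suc (at (proj₂ t) k)) (proj₂ t))) hs)))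

-- Schubert and Grothendieck series of a word, for all sufficient fuel

countAbove : ℕ → List ℕ → ℕ
countAbove x [] = 0
countAbove x (y ∷ l) = (if x ℕ.<ᵇ y then 1 else 0) + countAbove x l

-- Counts all increasing pairs, not only adjacent ones. For distinct entries this is the colength of
-- the word, which each step of the recursion lowers.
ascents : List ℕ → ℕ
ascents [] = 0
ascents (x ∷ l) = countAbove x l + ascents l

data Asc : ℕ → List ℕ → Set where
  here  : ∀ {a b l} → a < b → Asc 0 (a ∷ b ∷ l)
  there : ∀ {k x l} → Asc k l → Asc (suc k) (x ∷ l)

data Desc : ℕ → List ℕ → Set where
  here  : ∀ {a b l} → b < a → Desc 0 (a ∷ b ∷ l)
  there : ∀ {k x l} → Desc k l → Desc (suc k) (x ∷ l)

<ᵇ-true : ∀ {a b} → a < b → (a ℕ.<ᵇ b) ≡ true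
<ᵇ-true {a} {b} h with a ℕ.<ᵇ b | ℕₚ.<⇒<ᵇ h
... | true | _ = refl

<ᵇ-false : ∀ {a b} → ¬ a < b → (a ℕ.<ᵇ b) ≡ false
<ᵇ-false {a} {b} h with a ℕ.<ᵇ b in eq
... | true = ⊥-elim (h (ℕₚ.<ᵇ⇒< a b (subst T (sym eq) _)))
... | false = refl

<ᵇ-sound : ∀ {a b} → (a ℕ.<ᵇ b) ≡ true → a < b
<ᵇ-sound {a} {b} eq = ℕₚ.<ᵇ⇒< a b (subst T (sym eq) _)

≤ᵇ-true : ∀ {a b} → a ≤ b → (a ℕ.≤ᵇ b) ≡ true
≤ᵇ-true {a} {b} h with a ℕ.≤ᵇ b | ℕₚ.≤⇒≤ᵇ h
... | true | _ = refl

≤ᵇ-false : ∀ {a b} → ¬ a ≤ b → (a ℕ.≤ᵇ b) ≡ false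
≤ᵇ-false {a} {b} h with a ℕ.≤ᵇ b in eq
... | true = ⊥-elim (h (ℕₚ.≤ᵇ⇒≤ a b (subst T (sym eq) _)))
... | false = refl

countAbove-swapAt : ∀ x k l → countAbove x (swapAt k l) ≡ countAbove x l
countAbove-swapAt x zero [] = refl
countAbove-swapAt x zero (a ∷ []) = refl
countAbove-swapAt x zero (a ∷ b ∷ l) = begin
  B + (A + C) ≡⟨ ℕₚ.+-assoc B A C ⟨
  B + A + C   ≡⟨ cong (_+ C) (ℕₚ.+-comm B A) ⟩
  A + B + C   ≡⟨ ℕₚ.+-assoc A B C ⟩
  A + (B + C) ∎
  where
  open ≡-Reasoning
  A = if x ℕ.<ᵇ a then 1 else 0
  B = if x ℕ.<ᵇ b then 1 else 0
  C = countAbove x l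
countAbove-swapAt x (suc k) [] = refl
countAbove-swapAt x (suc k) (a ∷ l) = cong (_ +_) (countAbove-swapAt x k l)

ascents-swapAt : ∀ {k l} → Asc k l → ascents (swapAt k l) < ascents l
ascents-swapAt (here {a} {b} {l} a<b) rewrite <ᵇ-true a<b | <ᵇ-false (ℕₚ.<-asym a<b) =
  ℕₚ.≤-reflexive (cong suc (begin
    countAbove b l + (countAbove a l + ascents l) ≡⟨ ℕₚ.+-assoc (countAbove b l) _ _ ⟨
    countAbove b l + countAbove a l + ascents l ≡⟨ cong (_+ ascents l) (ℕₚ.+-comm (countAbove b l) _) ⟩
    countAbove a l + countAbove b l + ascents l ≡⟨ ℕₚ.+-assoc (countAbove a l) _ _ ⟩
    countAbove a l + (countAbove b l + ascents l) ∎))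
  where open ≡-Reasoning
ascents-swapAt (there {k} {x} {l} p) rewrite countAbove-swapAt x k l = ℕₚ.+-monoʳ-< (countAbove x l) (ascents-swapAt p)

length-swapAt : ∀ k l → length (swapAt k l) ≡ length l
length-swapAt zero [] = refl
length-swapAt zero (a ∷ []) = refl
length-swapAt zero (a ∷ b ∷ l) = refl
length-swapAt (suc k) [] = refl
length-swapAt (suc k) (a ∷ l) = cong suc (length-swapAt k l)

swapAt-involutive : ∀ k l → swapAt k (swapAt k l) ≡ l
swapAt-involutive zero [] = refl
swapAt-involutive zero (a ∷ []) = refl
swapAt-involutive zero (a ∷ b ∷ l) = refl
swapAt-involutive (suc k) [] = refl
swapAt-involutive (suc k) (a ∷ l) = cong (a ∷_) (swapAt-involutive k l)

Asc-length : ∀ {k l} → Asc k l → suc k < length l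
Asc-length (here _) = s≤s (s≤s z≤n)
Asc-length (there p) = s≤s (Asc-length p)

Desc⇒Asc-swapAt : ∀ {k l} → Desc k l → Asc k (swapAt k l)
Desc⇒Asc-swapAt (here p) = here p
Desc⇒Asc-swapAt (there p) = there (Desc⇒Asc-swapAt p)

firstAscent-Asc : ∀ w {i} → firstAscent w ≡ just i → Asc i w
firstAscent-Asc (a ∷ b ∷ l) h with a ℕ.<ᵇ b in eq | firstAscent (b ∷ l) in eq′
firstAscent-Asc (a ∷ b ∷ l) refl | true | _ = here (<ᵇ-sound eq)
firstAscent-Asc (a ∷ b ∷ l) refl | false | just j = there (firstAscent-Asc (b ∷ l) eq′)

firstAscent-minimal : ∀ w {i k} → firstAscent w ≡ just i → Asc k w → i ≤ k
firstAscent-minimal (a ∷ b ∷ l) h p with a ℕ.<ᵇ b in eq | firstAscent (b ∷ l) in eq′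
firstAscent-minimal (a ∷ b ∷ l) refl p | true | _ = z≤n
firstAscent-minimal (a ∷ b ∷ l) refl (here q) | false | just j with trans (sym eq) (<ᵇ-true q)
... | ()
firstAscent-minimal (a ∷ b ∷ l) refl (there p) | false | just j = s≤s (firstAscent-minimal (b ∷ l) eq′ p)

firstAscent-nothing : ∀ w {k} → firstAscent w ≡ nothing → ¬ Asc k w
firstAscent-nothing (a ∷ []) h (there ())
firstAscent-nothing (a ∷ b ∷ l) h p with a ℕ.<ᵇ b in eq | firstAscent (b ∷ l) in eq′
firstAscent-nothing (a ∷ b ∷ l) h (here q) | false | nothing with trans (sym eq) (<ᵇ-true q)
... | ()
firstAscent-nothing (a ∷ b ∷ l) h (there p) | false | nothing = firstAscent-nothing (b ∷ l) eq′ p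

firstAscent-cases : ∀ w → firstAscent w ≡ nothing ⊎ ∃ λ i → firstAscent w ≡ just i
firstAscent-cases w with firstAscent w
... | nothing = inj₁ refl
... | just i = inj₂ (i , refl)

topPoly-downFrom : ∀ n → topPoly n ≡ [ (1ℤ , downFrom n) ]
topPoly-downFrom n = cong (λ e → [ (1ℤ , e) ]) (trans (Listₚ.map-upTo _ n) (descending n))
  where
  applyUpTo-cong : ∀ {f g : ℕ → ℕ} → (∀ k → f k ≡ g k) → ∀ n → applyUpTo f n ≡ applyUpTo g n
  applyUpTo-cong h zero = refl
  applyUpTo-cong h (suc n) = cong₂ _∷_ (h 0) (applyUpTo-cong (h ∘ suc) n)
  descending : ∀ n → applyUpTo (λ k → n ∸ 1 ∸ k) n ≡ downFrom n
  descending zero = refl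
  descending (suc n) = cong (n ∷_) (trans (applyUpTo-cong (λ k → sym (ℕₚ.∸-+-assoc n 1 k)) n) (descending n))

-- The two recursions of Defs differ only in the operator applied at each step.
module Recursion
  (step : ℕ → Poly → Poly)
  (step-length : ∀ {n} i p → HasLength n p → HasLength n (step i p))
  (run : ℕ → ℕ → List ℕ → Poly)
  (run-zero : ∀ n w → run n 0 w ≡ [])
  (run-nothing : ∀ n f w → firstAscent w ≡ nothing → run n (suc f) w ≡ topPoly n)
  (run-just : ∀ n f w {i} → firstAscent w ≡ just i → run n (suc f) w ≡ step i (run n f (swapAt i w)))
  where

  fuel-irrelevant : ∀ n f g w → ascents w < f → ascents w < g → run n f w ≡ run n g w
  fuel-irrelevant n (suc f) (suc g) w (s≤s p) (s≤s q) with firstAscent w in eq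
  ... | nothing = trans (run-nothing n f w eq) (sym (run-nothing n g w eq))
  ... | just i = trans (run-just n f w eq) (trans
    (cong (step i) (fuel-irrelevant n f g (swapAt i w) (ℕₚ.<-≤-trans smaller p) (ℕₚ.<-≤-trans smaller q)))
    (sym (run-just n g w eq)))
    where smaller = ascents-swapAt (firstAscent-Asc w eq)

  run-length : ∀ n f w → HasLength n (run n f w)
  run-length n zero w rewrite run-zero n w = []
  run-length n (suc f) w with firstAscent w in eq
  ... | nothing rewrite run-nothing n f w eq | topPoly-downFrom n = Listₚ.length-downFrom n ∷ []
  ... | just i rewrite run-just n f w eq = step-length i _ (run-length n f (swapAt i w))

  -- The number of variables and a sufficient amount of fuel are both read off the word, so that the
  -- recursion can be stated on words alone.
  value : List ℕ → Poly
  value w = run (length w) (suc (ascents w)) w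

  value-just : ∀ w {i} → firstAscent w ≡ just i → value w ≡ step i (value (swapAt i w))
  value-just w {i} eq = trans (run-just _ _ w eq) (cong (step i) (trans
    (fuel-irrelevant (length w) _ _ (swapAt i w) (ascents-swapAt (firstAscent-Asc w eq)) ℕₚ.≤-refl)
    (cong (λ n → run n (suc (ascents (swapAt i w))) (swapAt i w)) (sym (length-swapAt i w)))))

  value-nothing : ∀ w → firstAscent w ≡ nothing → coeff (value w) ≗ term 1ℤ (downFrom (length w))
  value-nothing w eq α =
    trans (cong (λ p → coeff p α) (trans (run-nothing (length w) (ascents w) w eq) (topPoly-downFrom (length w)))) (ℤₚ.+-identityʳ _)

  value-length : ∀ w → HasLength (length w) (value w)
  value-length w = run-length (length w) _ w

private
  schub-just : ∀ n f w {i} → firstAscent w ≡ just i → schubF n (suc f) w ≡ dd i (schubF n f (swapAt i w))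
  schub-just n f w eq rewrite eq = refl

  schub-nothing : ∀ n f w → firstAscent w ≡ nothing → schubF n (suc f) w ≡ topPoly n
  schub-nothing n f w eq rewrite eq = refl

  groth-just : ∀ n f w {i} → firstAscent w ≡ just i →
    grothF n (suc f) w ≡ dd i (oneMinusX (suc i) (grothF n f (swapAt i w)))
  groth-just n f w eq rewrite eq = refl

  groth-nothing : ∀ n f w → firstAscent w ≡ nothing → grothF n (suc f) w ≡ topPoly n
  groth-nothing n f w eq rewrite eq = refl

module Schub = Recursion dd HasLength-dd schubF (λ _ _ → refl) schub-nothing schub-just

module Groth = Recursion (λ i p → dd i (oneMinusX (suc i) p))
  (λ i p h → HasLength-dd i _ (HasLength-oneMinusX (suc i) p h)) grothF (λ _ _ → refl) groth-nothing groth-just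

𝔖 𝔊 : List ℕ → Series
𝔖 w = coeff (Schub.value w)
𝔊 w = coeff (Groth.value w)

length-firstAscent : ∀ w {i} → firstAscent w ≡ just i → suc i < length (swapAt i w)
length-firstAscent w {i} eq = subst (suc i <_) (sym (length-swapAt i w)) (Asc-length (firstAscent-Asc w eq))

𝔖-firstAscent : ∀ w {i} → firstAscent w ≡ just i → 𝔖 w ≗ ∂ i (𝔖 (swapAt i w))
𝔖-firstAscent w {i} eq α = trans (cong (λ p → coeff p α) (Schub.value-just w eq))
  (coeff-dd i (Schub.value (swapAt i w)) (Schub.value-length (swapAt i w)) (length-firstAscent w eq) α)

1-X : ℕ → Series → Series
1-X i f e = f e -ᶻ X i f e

𝔊-firstAscent : ∀ w {i} → firstAscent w ≡ just i → 𝔊 w ≗ ∂ i (1-X (suc i) (𝔊 (swapAt i w)))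
𝔊-firstAscent w {i} eq α = trans (cong (λ p → coeff p α) (Groth.value-just w eq))
  (trans (coeff-dd i (oneMinusX (suc i) G) (HasLength-oneMinusX (suc i) G hl) i<n α)
    (∂-cong i (λ β → trans (coeff-++ G _ β) (cong (coeff G β +ᶻ_)
      (trans (coeff-neg (mulX (suc i) G) β) (cong -ᶻ_ (coeff-mulX (suc i) G hl i<n β))))) α))
  where
  G = Groth.value (swapAt i w)
  hl = Groth.value-length (swapAt i w)
  i<n = length-firstAscent w eq

𝔖-length : ∀ w e → length e ≢ length w → 𝔖 w e ≡ 0ℤ
𝔖-length w e h = coeff-length (Schub.value-length w) e h

𝔊-length : ∀ w e → length e ≢ length w → 𝔊 w e ≡ 0ℤ
𝔊-length w e h = coeff-length (Groth.value-length w) e h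

-- Independence of the chosen ascent

private
  far-ascents : ∀ {i k w} → Asc i w → Asc k w → suc i < k →
    Asc k (swapAt i w) × Asc i (swapAt k w) × swapAt k (swapAt i w) ≡ swapAt i (swapAt k w)
  far-ascents (here p) (there (there q)) _ = there (there q) , here p , refl
  far-ascents (here p) (there (here q)) (s≤s ())
  far-ascents (there {x = x} p) (there q) (s≤s h) with far-ascents p q h
  ... | a , b , c = there a , there b , cong (x ∷_) c

  adjacent-ascents : ∀ {i w} → Asc i w → Asc (suc i) w →
    Asc (suc i) (swapAt i w) × Asc i (swapAt (suc i) (swapAt i w)) ×
    Asc i (swapAt (suc i) w) × Asc (suc i) (swapAt i (swapAt (suc i) w)) ×
    swapAt i (swapAt (suc i) (swapAt i w)) ≡ swapAt (suc i) (swapAt i (swapAt (suc i) w))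
  adjacent-ascents (here p) (there (here q)) =
    there (here (ℕₚ.<-trans p q)) , here q , here (ℕₚ.<-trans p q) , there (here p) , refl
  adjacent-ascents (there {x = x} p) (there q) with adjacent-ascents p q
  ... | a , b , c , d , e = there a , there b , there c , there d , cong (x ∷_) e

  -- The definition grants the recursion only at the first ascent i, and every other ascent k lies
  -- to its right. Induction on `ascents` handles the smaller words: for k > i + 1 the operators at
  -- i and k commute, and for k = i + 1 both routes reach the same word after three swaps, where the
  -- braid relation compares them.
  Asc-below : ∀ w m → ascents w < m → ∀ {k} → Asc k w → 𝔖 w ≗ ∂ k (𝔖 (swapAt k w))
  Asc-below w (suc m) (s≤s w≤m) {k} q e with firstAscent-cases w
  ... | inj₁ eq = ⊥-elim (firstAscent-nothing w eq q)
  ... | inj₂ (i , eq) with firstAscent-Asc w eq | ℕₚ.<-cmp (suc i) k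
  ... | p | tri< h _ _ with far-ascents p q h
  ...   | a , b , c = trans (𝔖-firstAscent w eq e) (trans (∂-cong i ih₁ e)
          (trans (∂-far h _ e) (∂-cong k (λ e′ → trans (∂-cong i (λ e″ → cong (λ v → 𝔖 v e″) c) e′) (sym (ih₂ e′))) e)))
    where
    ih₁ = Asc-below (swapAt i w) m (ℕₚ.<-≤-trans (ascents-swapAt p) w≤m) a
    ih₂ = Asc-below (swapAt k w) m (ℕₚ.<-≤-trans (ascents-swapAt q) w≤m) b
  Asc-below w (suc m) (s≤s w≤m) q e | inj₂ (i , eq) | p | tri≈ _ refl _ with adjacent-ascents p q
  ...   | a , b , c , d , f = trans (𝔖-firstAscent w eq e) (trans (∂-cong i (λ e′ → trans (ih₁ e′) (∂-cong (suc i) ih₂ e′)) e)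
          (trans (∂-braid i _ e) (sym (∂-cong (suc i) (λ e′ → trans (ih₃ e′) (∂-cong i (λ e″ →
            trans (ih₄ e″) (∂-cong (suc i) (λ e‴ → cong (λ v → 𝔖 v e‴) (sym f)) e″)) e′)) e))))
    where
    <₁ = ℕₚ.<-≤-trans (ascents-swapAt p) w≤m
    <₂ = ℕₚ.<-≤-trans (ascents-swapAt q) w≤m
    ih₁ = Asc-below (swapAt i w) m <₁ a
    ih₂ = Asc-below (swapAt (suc i) (swapAt i w)) m (ℕₚ.<-trans (ascents-swapAt a) <₁) b
    ih₃ = Asc-below (swapAt (suc i) w) m <₂ c
    ih₄ = Asc-below (swapAt i (swapAt (suc i) w)) m (ℕₚ.<-trans (ascents-swapAt c) <₂) d
  Asc-below w (suc m) (s≤s w≤m) {k} q e | inj₂ (i , eq) | p | tri> _ _ h with ℕₚ.≤-antisym (firstAscent-minimal w eq q) (ℕ.s≤s⁻¹ h)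
  ...   | refl = 𝔖-firstAscent w eq e

𝔖-Asc : ∀ {k} w → Asc k w → 𝔖 w ≗ ∂ k (𝔖 (swapAt k w))
𝔖-Asc w = Asc-below w _ ℕₚ.≤-refl

∂-𝔖-Desc : ∀ {k} w → Desc k w → ∂ k (𝔖 w) ≗ 𝔖 (swapAt k w)
∂-𝔖-Desc {k} w d e = sym (trans (𝔖-Asc (swapAt k w) (Desc⇒Asc-swapAt d) e)
  (cong (λ v → ∂ k (𝔖 v) e) (swapAt-involutive k w)))

∂-𝔖-Asc : ∀ {k} w → Asc k w → ∀ e → ∂ k (𝔖 w) e ≡ 0ℤ
∂-𝔖-Asc {k} w p e = trans (∂-cong k (𝔖-Asc w p) e) (∂∂≡0 k _ e)

-- The co-transition formula

∂-short : ∀ r f e → length e ≤ suc r → ∂ r f e ≡ 0ℤ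
∂-short zero f [] _ = refl
∂-short zero f (a ∷ []) _ = refl
∂-short zero f (a ∷ b ∷ e) (s≤s ())
∂-short (suc r) f [] _ = refl
∂-short (suc r) f (a ∷ e) (s≤s h) = ∂-short r _ e h

X-vanishing : ∀ r f e → (∀ e′ → length e′ ≡ length e → f e′ ≡ 0ℤ) → X r f e ≡ 0ℤ
X-vanishing zero f [] h = refl
X-vanishing (suc r) f [] h = refl
X-vanishing zero f (zero ∷ e) h = refl
X-vanishing zero f (suc a ∷ e) h = h (a ∷ e) refl
X-vanishing (suc r) f (a ∷ e) h = X-vanishing r _ e (λ e′ eq → h (a ∷ e′) (cong suc eq))

X-∂ : ∀ r f → (∀ e → length e ≤ suc r → f e ≡ 0ℤ) → ∀ e → X r (∂ r f) e ≡ ∂ r (X (suc r) f) e +ᶻ f e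
X-∂ r f h e with ℕₚ.<-≤-connex (suc r) (length e)
... | inj₁ long = Leibniz r f e long
... | inj₂ short = trans
  (X-vanishing r (∂ r f) e (λ e′ eq → ∂-short r f e′ (subst (_≤ suc r) (sym eq) short)))
  (sym (cong₂ _+ᶻ_ (∂-short r _ e short) (h e short)))

-- The sum of Φ y v[y ≔ c] over the entries y of v with c < y < ub that no earlier
-- entry of v separates from c: the swaps of c with y that cover in Bruhat order.
Cov : ℕ → ℕ → List ℕ → (ℕ → List ℕ → Series) → Series
Cov c ub []      Φ e = 0ℤ
Cov c ub (y ∷ v) Φ e =
  if (c ℕ.<ᵇ y) ∧ (y ℕ.<ᵇ ub)
  then Φ y (c ∷ v) e +ᶻ Cov c y v (λ z l → Φ z (y ∷ l)) e
  else Cov c ub v (λ z l → Φ z (y ∷ l)) e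

Cov-take : ∀ c ub y v Φ e → c < y → y < ub →
  Cov c ub (y ∷ v) Φ e ≡ Φ y (c ∷ v) e +ᶻ Cov c y v (λ z l → Φ z (y ∷ l)) e
Cov-take c ub y v Φ e p q rewrite <ᵇ-true p | <ᵇ-true q = refl

Cov-skip-low : ∀ c ub y v Φ e → ¬ c < y → Cov c ub (y ∷ v) Φ e ≡ Cov c ub v (λ z l → Φ z (y ∷ l)) e
Cov-skip-low c ub y v Φ e p rewrite <ᵇ-false p = refl

Cov-skip-high : ∀ c ub y v Φ e → ¬ y < ub → Cov c ub (y ∷ v) Φ e ≡ Cov c ub v (λ z l → Φ z (y ∷ l)) e
Cov-skip-high c ub y v Φ e p rewrite <ᵇ-false p with c ℕ.<ᵇ y
... | true = refl
... | false = refl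

data Step? (c ub y : ℕ) : Set where
  take : c < y → y < ub → Step? c ub y
  low  : ¬ c < y → Step? c ub y
  high : ¬ y < ub → Step? c ub y

step? : ∀ c ub y → Step? c ub y
step? c ub y with c ℕ.<? y | y ℕ.<? ub
... | yes p | yes q = take p q
... | no p  | _     = low p
... | _     | no q  = high q

Cov-cong : ∀ {ub Φ Ψ c} v e → (∀ z l → z < ub → Φ z l e ≡ Ψ z l e) → Cov c ub v Φ e ≡ Cov c ub v Ψ e
Cov-cong [] e h = refl
Cov-cong {ub} {Φ} {Ψ} {c} (y ∷ v) e h with step? c ub y
... | take p q = trans (Cov-take c _ y v Φ e p q) (trans
  (cong₂ _+ᶻ_ (h y _ q) (Cov-cong v e (λ z l z<y → h z _ (ℕₚ.<-trans z<y q)))) (sym (Cov-take c _ y v Ψ e p q)))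
... | low p = trans (Cov-skip-low c _ y v Φ e p) (trans (Cov-cong v e (λ z l → h z (y ∷ l))) (sym (Cov-skip-low c _ y v Ψ e p)))
... | high p = trans (Cov-skip-high c _ y v Φ e p) (trans (Cov-cong v e (λ z l → h z (y ∷ l))) (sym (Cov-skip-high c _ y v Ψ e p)))

∂-Cov : ∀ k c ub v Φ e → ∂ k (Cov c ub v Φ) e ≡ Cov c ub v (λ z l → ∂ k (Φ z l)) e
∂-Cov k c ub [] Φ e = null (∂-additive k e)
∂-Cov k c ub (y ∷ v) Φ e with (c ℕ.<ᵇ y) ∧ (y ℕ.<ᵇ ub)
... | true = trans (add (∂-additive k e) _ _) (cong (∂ k (Φ y (c ∷ v)) e +ᶻ_) (∂-Cov k c y v _ e))
... | false = ∂-Cov k c ub v _ e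

Cov-none : ∀ {c ub Φ} v e → All (λ y → ¬ c < y) v → Cov c ub v Φ e ≡ 0ℤ
Cov-none [] e [] = refl
Cov-none {c} {ub} {Φ} (y ∷ v) e (p ∷ ps) = trans (Cov-skip-low c _ y v Φ e p) (Cov-none v e ps)

-- An entry above b that is selected contributes 0 and lowers the bound only to itself, which is
-- still above b. So starting from the bound b loses no nonzero term.
Cov-restrict : ∀ {ub Φ c b} v e → b ≤ ub → All (b ≢_) v → (∀ z l → b < z → Φ z l e ≡ 0ℤ) →
  Cov c ub v Φ e ≡ Cov c b v Φ e
Cov-restrict [] e _ _ _ = refl
Cov-restrict {ub} {Φ} {c} {b} (y ∷ v) e b≤ub (b≢y ∷ ne) h with step? c b y
... | take p q = trans (Cov-take c _ y v Φ e p (ℕₚ.<-≤-trans q b≤ub)) (sym (Cov-take c _ y v Φ e p q))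
... | low p = trans (Cov-skip-low c _ y v Φ e p) (trans (Cov-restrict v e b≤ub ne (λ z l → h z (y ∷ l))) (sym (Cov-skip-low c _ y v Φ e p)))
... | high p with ℕₚ.≤∧≢⇒< (ℕₚ.≮⇒≥ p) b≢y | step? c ub y
...   | b<y | take r s = trans (Cov-take c _ y v Φ e r s) (trans
        (cong₂ _+ᶻ_ (h y _ b<y) (Cov-restrict v e (ℕₚ.<⇒≤ b<y) ne (λ z l → h z (y ∷ l))))
        (trans (ℤₚ.+-identityˡ _) (sym (Cov-skip-high c _ y v Φ e p))))
...   | b<y | low r = trans (Cov-skip-low c _ y v Φ e r) (trans (Cov-restrict v e b≤ub ne (λ z l → h z (y ∷ l))) (sym (Cov-skip-high c _ y v Φ e p)))
...   | b<y | high r = trans (Cov-skip-high c _ y v Φ e r) (trans (Cov-restrict v e b≤ub ne (λ z l → h z (y ∷ l))) (sym (Cov-skip-high c _ y v Φ e p)))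

-- For a swapped pair a < b, every term of the sum has a descent at that place and is carried to the
-- corresponding term for the original order, with one exception. If c < a and b < ub, then b is
-- selected only when it precedes a; its term has c before a there, an ascent, and ∂ kills it.
Cov-swapAt : ∀ {k v c K Φ ub} → Asc k v → All (c ≢_) v →
  (∀ z l → Desc k l → ∂ K (Φ z l) ≗ Φ z (swapAt k l)) →
  (∀ z l → Asc k l → ∀ e → ∂ K (Φ z l) e ≡ 0ℤ) →
  ∀ e → ∂ K (Cov c ub (swapAt k v) Φ) e ≡ Cov c ub v Φ e
Cov-swapAt {suc k} {y ∷ v} {c} {K} {Φ} {ub} (there p) (_ ∷ nes) hD hA e with step? c ub y
... | take r s = begin
  ∂ K (Cov c ub (y ∷ swapAt k v) Φ) e
    ≡⟨ ∂-cong K (λ e′ → Cov-take c ub y (swapAt k v) Φ e′ r s) e ⟩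
  ∂ K (λ e′ → Φ y (c ∷ swapAt k v) e′ +ᶻ Cov c y (swapAt k v) Φ′ e′) e
    ≡⟨ add (∂-additive K e) _ _ ⟩
  ∂ K (Φ y (c ∷ swapAt k v)) e +ᶻ ∂ K (Cov c y (swapAt k v) Φ′) e
    ≡⟨ cong₂ _+ᶻ_
         (trans (hD y (c ∷ swapAt k v) (there (swapAt-Desc p)) e) (cong (λ l → Φ y (c ∷ l) e) (swapAt-involutive k v)))
         (Cov-swapAt {K = K} {Φ = Φ′} p nes (λ z l d → hD z (y ∷ l) (there d)) (λ z l a → hA z (y ∷ l) (there a)) e) ⟩
  Φ y (c ∷ v) e +ᶻ Cov c y v Φ′ e
    ≡⟨ Cov-take c ub y v Φ e r s ⟨
  Cov c ub (y ∷ v) Φ e ∎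
  where
  open ≡-Reasoning
  Φ′ = λ z l → Φ z (y ∷ l)
  swapAt-Desc : ∀ {k v} → Asc k v → Desc k (swapAt k v)
  swapAt-Desc (here p) = here p
  swapAt-Desc (there p) = there (swapAt-Desc p)
... | low r = trans (∂-cong K (λ e′ → Cov-skip-low c ub y (swapAt k v) Φ e′ r) e)
  (trans (Cov-swapAt {K = K} {Φ = λ z l → Φ z (y ∷ l)} p nes (λ z l d → hD z (y ∷ l) (there d)) (λ z l a → hA z (y ∷ l) (there a)) e)
    (sym (Cov-skip-low c ub y v Φ e r)))
... | high r = trans (∂-cong K (λ e′ → Cov-skip-high c ub y (swapAt k v) Φ e′ r) e)
  (trans (Cov-swapAt {K = K} {Φ = λ z l → Φ z (y ∷ l)} p nes (λ z l d → hD z (y ∷ l) (there d)) (λ z l a → hA z (y ∷ l) (there a)) e)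
    (sym (Cov-skip-high c ub y v Φ e r)))
Cov-swapAt {zero} {a ∷ b ∷ t} {c} {K} {Φ} {ub} (here a<b) (c≢a ∷ c≢b ∷ _) hD hA e = swapped (step? c ub b) (step? c ub a)
  where
  open ≡-Reasoning
  Φa Φb : ℕ → List ℕ → Series
  Φa z l = Φ z (a ∷ l)
  Φb z l = Φ z (b ∷ l)
  rest : ∀ ub → ∂ K (Cov c ub t (λ z l → Φ z (b ∷ a ∷ l))) e ≡ Cov c ub t (λ z l → Φ z (a ∷ b ∷ l)) e
  rest ub = trans (∂-Cov K c ub t (λ z l → Φ z (b ∷ a ∷ l)) e) (Cov-cong t e (λ z l _ → hD z (b ∷ a ∷ l) (here a<b) e))
  swapped : Step? c ub b → Step? c ub a → ∂ K (Cov c ub (b ∷ a ∷ t) Φ) e ≡ Cov c ub (a ∷ b ∷ t) Φ e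
  swapped (low c≮b) _ = trans
    (∂-cong K (λ e′ → trans (Cov-skip-low c ub b (a ∷ t) Φ e′ c≮b) (Cov-skip-low c ub a t Φb e′ c≮a)) e)
    (trans (rest ub) (sym (trans (Cov-skip-low c ub a (b ∷ t) Φ e c≮a) (Cov-skip-low c ub b t Φa e c≮b))))
    where c≮a = λ h → c≮b (ℕₚ.<-trans h a<b)
  swapped (high b≮ub) (low c≮a) = trans
    (∂-cong K (λ e′ → trans (Cov-skip-high c ub b (a ∷ t) Φ e′ b≮ub) (Cov-skip-low c ub a t Φb e′ c≮a)) e)
    (trans (rest ub) (sym (trans (Cov-skip-low c ub a (b ∷ t) Φ e c≮a) (Cov-skip-high c ub b t Φa e b≮ub))))
  swapped (high b≮ub) (high a≮ub) = trans
    (∂-cong K (λ e′ → trans (Cov-skip-high c ub b (a ∷ t) Φ e′ b≮ub) (Cov-skip-high c ub a t Φb e′ a≮ub)) e)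
    (trans (rest ub) (sym (trans (Cov-skip-high c ub a (b ∷ t) Φ e a≮ub) (Cov-skip-high c ub b t Φa e b≮ub))))
  swapped (high b≮ub) (take c<a a<ub) = begin
    ∂ K (Cov c ub (b ∷ a ∷ t) Φ) e
      ≡⟨ ∂-cong K (λ e′ → trans (Cov-skip-high c ub b (a ∷ t) Φ e′ b≮ub) (Cov-take c ub a t Φb e′ c<a a<ub)) e ⟩
    ∂ K (λ e′ → Φ a (b ∷ c ∷ t) e′ +ᶻ Cov c a t (λ z l → Φ z (b ∷ a ∷ l)) e′) e
      ≡⟨ add (∂-additive K e) _ _ ⟩
    ∂ K (Φ a (b ∷ c ∷ t)) e +ᶻ ∂ K (Cov c a t (λ z l → Φ z (b ∷ a ∷ l))) e
      ≡⟨ cong₂ _+ᶻ_ (hD a (b ∷ c ∷ t) (here (ℕₚ.<-trans c<a a<b)) e) (rest a) ⟩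
    Φ a (c ∷ b ∷ t) e +ᶻ Cov c a t (λ z l → Φ z (a ∷ b ∷ l)) e
      ≡⟨ cong (Φ a (c ∷ b ∷ t) e +ᶻ_) (Cov-skip-high c a b t Φa e (ℕₚ.<-asym a<b)) ⟨
    Φ a (c ∷ b ∷ t) e +ᶻ Cov c a (b ∷ t) Φa e
      ≡⟨ Cov-take c ub a (b ∷ t) Φ e c<a a<ub ⟨
    Cov c ub (a ∷ b ∷ t) Φ e ∎
  swapped (take c<b b<ub) (high a≮ub) = ⊥-elim (a≮ub (ℕₚ.<-trans a<b b<ub))
  swapped (take c<b b<ub) (take c<a a<ub) = begin
    ∂ K (Cov c ub (b ∷ a ∷ t) Φ) e
      ≡⟨ ∂-cong K (λ e′ → trans (Cov-take c ub b (a ∷ t) Φ e′ c<b b<ub)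
           (cong (Φ b (c ∷ a ∷ t) e′ +ᶻ_) (Cov-take c b a t Φb e′ c<a a<b))) e ⟩
    ∂ K (λ e′ → Φ b (c ∷ a ∷ t) e′ +ᶻ (Φ a (b ∷ c ∷ t) e′ +ᶻ Cov c a t (λ z l → Φ z (b ∷ a ∷ l)) e′)) e
      ≡⟨ trans (add (∂-additive K e) _ _) (cong₂ _+ᶻ_ (hA b (c ∷ a ∷ t) (here c<a) e) (add (∂-additive K e) _ _)) ⟩
    0ℤ +ᶻ (∂ K (Φ a (b ∷ c ∷ t)) e +ᶻ ∂ K (Cov c a t (λ z l → Φ z (b ∷ a ∷ l))) e)
      ≡⟨ ℤₚ.+-identityˡ _ ⟩
    ∂ K (Φ a (b ∷ c ∷ t)) e +ᶻ ∂ K (Cov c a t (λ z l → Φ z (b ∷ a ∷ l))) e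
      ≡⟨ cong₂ _+ᶻ_ (hD a (b ∷ c ∷ t) (here c<b) e) (rest a) ⟩
    Φ a (c ∷ b ∷ t) e +ᶻ Cov c a t (λ z l → Φ z (a ∷ b ∷ l)) e
      ≡⟨ cong (Φ a (c ∷ b ∷ t) e +ᶻ_) (Cov-skip-high c a b t Φa e (ℕₚ.<-asym a<b)) ⟨
    Φ a (c ∷ b ∷ t) e +ᶻ Cov c a (b ∷ t) Φa e
      ≡⟨ Cov-take c ub a (b ∷ t) Φ e c<a a<ub ⟨
    Cov c ub (a ∷ b ∷ t) Φ e ∎
  swapped (take c<b b<ub) (low c≮a) = begin
    ∂ K (Cov c ub (b ∷ a ∷ t) Φ) e
      ≡⟨ ∂-cong K (λ e′ → trans (Cov-take c ub b (a ∷ t) Φ e′ c<b b<ub)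
           (cong (Φ b (c ∷ a ∷ t) e′ +ᶻ_) (Cov-skip-low c b a t Φb e′ c≮a))) e ⟩
    ∂ K (λ e′ → Φ b (c ∷ a ∷ t) e′ +ᶻ Cov c b t (λ z l → Φ z (b ∷ a ∷ l)) e′) e
      ≡⟨ add (∂-additive K e) _ _ ⟩
    ∂ K (Φ b (c ∷ a ∷ t)) e +ᶻ ∂ K (Cov c b t (λ z l → Φ z (b ∷ a ∷ l))) e
      ≡⟨ cong₂ _+ᶻ_ (hD b (c ∷ a ∷ t) (here (ℕₚ.≤∧≢⇒< (ℕₚ.≮⇒≥ c≮a) (λ eq → c≢a (sym eq)))) e) (rest b) ⟩
    Φ b (a ∷ c ∷ t) e +ᶻ Cov c b t (λ z l → Φ z (a ∷ b ∷ l)) e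
      ≡⟨ Cov-take c ub b t Φa e c<b b<ub ⟨
    Cov c ub (b ∷ t) Φa e
      ≡⟨ Cov-skip-low c ub a (b ∷ t) Φ e c≮a ⟨
    Cov c ub (a ∷ b ∷ t) Φ e ∎

-- Decreasing and dominant words

Decreasing : List ℕ → Set
Decreasing = AllPairs ℕ._>_

ascent-or-decreasing : ∀ l → Unique l → (∃ λ k → Asc k l) ⊎ Decreasing l
ascent-or-decreasing [] _ = inj₂ []
ascent-or-decreasing (a ∷ l) (ne ∷ un) with ascent-or-decreasing l un
... | inj₁ (k , p) = inj₁ (suc k , there p)
... | inj₂ dec with l | ne | dec
...   | [] | _ | _ = inj₂ ([] ∷ [])
...   | b ∷ l′ | a≢b ∷ _ | b>l′ ∷ dec′ with ℕₚ.<-cmp a b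
...     | tri< a<b _ _ = inj₁ (0 , here a<b)
...     | tri≈ _ a≡b _ = ⊥-elim (a≢b a≡b)
...     | tri> _ _ b<a = inj₂ ((b<a ∷ All.map (λ h → ℕₚ.<-trans h b<a) b>l′) ∷ b>l′ ∷ dec′)

Decreasing⇒no-Asc : ∀ {l k} → Decreasing l → ¬ Asc k l
Decreasing⇒no-Asc ((b<a ∷ _) ∷ _) (here a<b) = ℕₚ.<-asym a<b b<a
Decreasing⇒no-Asc (_ ∷ d) (there p) = Decreasing⇒no-Asc d p

Decreasing⇒firstAscent : ∀ {l} → Decreasing l → firstAscent l ≡ nothing
Decreasing⇒firstAscent {l} d with firstAscent-cases l
... | inj₁ eq = eq
... | inj₂ (i , eq) = ⊥-elim (Decreasing⇒no-Asc d (firstAscent-Asc l eq))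

𝔖-Decreasing : ∀ {l} → Decreasing l → 𝔖 l ≗ term 1ℤ (downFrom (length l))
𝔖-Decreasing {l} d = Schub.value-nothing l (Decreasing⇒firstAscent d)

Asc-++ : ∀ {k v} u → Asc k v → Asc (length u + k) (u ++ v)
Asc-++ [] p = p
Asc-++ (x ∷ u) p = there (Asc-++ u p)

Desc-++ : ∀ {k v} u → Desc k v → Desc (length u + k) (u ++ v)
Desc-++ [] p = p
Desc-++ (x ∷ u) p = there (Desc-++ u p)

Asc-++ʳ : ∀ {k u} v → Asc k u → Asc k (u ++ v)
Asc-++ʳ v (here p) = here p
Asc-++ʳ v (there p) = there (Asc-++ʳ v p)

swapAt-++ : ∀ u k v → swapAt (length u + k) (u ++ v) ≡ u ++ swapAt k v
swapAt-++ [] k v = refl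
swapAt-++ (x ∷ u) k v = cong (x ∷_) (swapAt-++ u k v)

swapAt-++ʳ : ∀ {k u} v → Asc k u → swapAt k (u ++ v) ≡ swapAt k u ++ v
swapAt-++ʳ v (here _) = refl
swapAt-++ʳ v (there {x = x} p) = cong (x ∷_) (swapAt-++ʳ v p)

All-swapAt : ∀ {l} {P : ℕ → Set} k → All P l → All P (swapAt k l)
All-swapAt zero [] = []
All-swapAt zero (p ∷ []) = p ∷ []
All-swapAt zero (p ∷ q ∷ ps) = q ∷ p ∷ ps
All-swapAt (suc k) [] = []
All-swapAt (suc k) (p ∷ ps) = p ∷ All-swapAt k ps

Any-swapAt : ∀ {l} {P : ℕ → Set} k → Any P l → Any P (swapAt k l)
Any-swapAt {a ∷ []} zero p = p
Any-swapAt {a ∷ b ∷ l} zero (here p) = there (here p)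
Any-swapAt {a ∷ b ∷ l} zero (there (here p)) = here p
Any-swapAt {a ∷ b ∷ l} zero (there (there p)) = there (there p)
Any-swapAt (suc k) (here p) = here p
Any-swapAt (suc k) (there p) = there (Any-swapAt k p)

Unique-swapAt : ∀ {l} k → Unique l → Unique (swapAt k l)
Unique-swapAt zero [] = []
Unique-swapAt zero (ps ∷ []) = ps ∷ []
Unique-swapAt zero ((p ∷ ps) ∷ qs ∷ un) = ((λ eq → p (sym eq)) ∷ qs) ∷ ps ∷ un
Unique-swapAt (suc k) [] = []
Unique-swapAt (suc k) (ps ∷ un) = All-swapAt k ps ∷ Unique-swapAt k un

-- The two exponents involved give x (x y)^m. The symmetric factor passes through ∂, and ∂ x = 1.
∂-staircase : ∀ e m f → ∂ (length e) (term 1ℤ (e ++ suc m ∷ m ∷ f)) ≗ term 1ℤ (e ++ m ∷ m ∷ f)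
∂-staircase [] m f [] = refl
∂-staircase [] m f (a ∷ []) with m ℕ.≡ᵇ a
... | true = refl
... | false = refl
∂-staircase [] m f (a ∷ b ∷ α) = begin
  δ (λ x y → term 1ℤ (suc m ∷ m ∷ f) (x ∷ y ∷ α)) a b
    ≡⟨ δ-cong (λ { zero y → refl ; (suc x) y → term-∷∷ 1ℤ m m f x y α }) a b ⟩
  δ (x· (monomial₂ m m t)) a b
    ≡⟨ δ-x· (monomial₂ m m t) a b ⟩
  y· (δ (monomial₂ m m t)) a b +ᶻ monomial₂ m m t a b
    ≡⟨ cong (_+ᶻ monomial₂ m m t a b) (vanish b) ⟩
  0ℤ +ᶻ monomial₂ m m t a b
    ≡⟨ trans (ℤₚ.+-identityˡ _) (sym (term-∷∷ 1ℤ m m f a b α)) ⟩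
  term 1ℤ (m ∷ m ∷ f) (a ∷ b ∷ α) ∎
  where
  open ≡-Reasoning
  t = term 1ℤ f α
  vanish : ∀ b → y· (δ (monomial₂ m m t)) a b ≡ 0ℤ
  vanish zero = refl
  vanish (suc b) = δ-symmetric≡0 (λ x y → transpose-monomial₂ m m t x y) a b
∂-staircase (x ∷ e) m f [] = refl
∂-staircase (x ∷ e) m f (a ∷ α) with x ℕ.≡ᵇ a
... | true = ∂-staircase e m f α
... | false = null (∂-additive (length e) α)

X-term : ∀ e m f → X (length e) (term 1ℤ (e ++ m ∷ f)) ≗ term 1ℤ (e ++ suc m ∷ f)
X-term [] m f [] = refl
X-term [] m f (zero ∷ α) = refl
X-term [] m f (suc a ∷ α) = refl
X-term (x ∷ e) m f [] = refl
X-term (x ∷ e) m f (a ∷ α) with x ℕ.≡ᵇ a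
... | true = X-term e m f α
... | false = null (X-additive (length e) α)

downFrom-split : ∀ j m → ∃ λ e → length e ≡ j × downFrom (j + m) ≡ e ++ downFrom m
downFrom-split zero m = [] , refl , refl
downFrom-split (suc j) m with downFrom-split j m
... | e , eq , eq′ = (j + m) ∷ e , cong suc eq , cong ((j + m) ∷_) eq′

private
  Decreasing-insert : ∀ {l} u {b d} → Decreasing (u ++ d ∷ l) → b < d → All (_< b) l → Decreasing (u ++ d ∷ b ∷ l)
  Decreasing-insert [] (ps ∷ dec) b<d b>l = (b<d ∷ ps) ∷ b>l ∷ dec
  Decreasing-insert {l} (x ∷ u) (ps ∷ dec) b<d b>l = insert u ps ∷ Decreasing-insert u dec b<d b>l
    where
    insert : ∀ u → All (_< x) (u ++ _ ∷ l) → All (_< x) (u ++ _ ∷ _ ∷ l)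
    insert [] (p ∷ ps) = p ∷ ℕₚ.<-trans b<d p ∷ ps
    insert (_ ∷ u) (p ∷ ps) = p ∷ insert u ps

-- The word is dominant, so its Schubert polynomial is a monomial; only the exponents from
-- the position of b onwards matter.
𝔖-dominant : ∀ u b l → Decreasing (u ++ l) → Decreasing (b ∷ l) → All (b ≢_) u →
  ∃ λ e → length e ≡ length u × 𝔖 (u ++ b ∷ l) ≗ term 1ℤ (e ++ downFrom (suc (length l)))
𝔖-dominant u b l = go (reverseView u)
  where
  go : ∀ {u b l} → Reverse u → Decreasing (u ++ l) → Decreasing (b ∷ l) → All (b ≢_) u →
    ∃ λ e → length e ≡ length u × 𝔖 (u ++ b ∷ l) ≗ term 1ℤ (e ++ downFrom (suc (length l)))
  go [] _ dec _ = [] , refl , 𝔖-Decreasing dec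
  go {b = b} {l} (u ∶ r ∶ʳ d) du (b>l ∷ dl) ne
    rewrite Listₚ.++-assoc u [ d ] (b ∷ l) | Listₚ.++-assoc u [ d ] l with ℕₚ.<-cmp b d
  ... | tri≈ _ b≡d _ = ⊥-elim (All.head (Allₚ.++⁻ʳ u ne) b≡d)
  ... | tri< b<d _ _ with downFrom-split (length (u ++ [ d ])) (suc (length l))
  ...   | e , eq , eq′ = e , eq , λ α → trans (𝔖-Decreasing (Decreasing-insert u du b<d b>l) α)
          (cong (λ t → term 1ℤ t α) (trans (cong downFrom (trans (cong length (sym (Listₚ.++-assoc u [ d ] (b ∷ l)))) (Listₚ.length-++ (u ++ [ d ])))) eq′))
  -- Here b first moves left past the smaller entry d. By induction the word so obtained has a
  -- staircase of exponents from that position onwards, and undoing the move flattens only the top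
  -- step of the staircase.
  go {b = b} {l} (u ∶ r ∶ʳ d) du (b>l ∷ dl) ne | tri> _ _ d<b
    with go r du ((d<b ∷ b>l) ∷ tailPairs u du) (Allₚ.++⁻ˡ u ne)
    where
    tailPairs : ∀ u → Decreasing (u ++ d ∷ l) → Decreasing (d ∷ l)
    tailPairs [] p = p
    tailPairs (_ ∷ u) (_ ∷ p) = tailPairs u p
  ... | e , eq , h = e ++ [ length l ] , trans (Listₚ.length-++ e) (trans (cong (_+ 1) eq) (sym (Listₚ.length-++ u))) , λ α →
      trans (𝔖-Asc (u ++ d ∷ b ∷ l) (subst (λ j → Asc j (u ++ d ∷ b ∷ l)) (ℕₚ.+-identityʳ (length u)) (Asc-++ u (here d<b))) α)
      (trans (cong (λ t → ∂ (length u) (𝔖 t) α)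
        (trans (cong (λ j → swapAt j (u ++ d ∷ b ∷ l)) (sym (ℕₚ.+-identityʳ (length u)))) (swapAt-++ u 0 _)))
      (trans (∂-cong (length u) h α)
      (trans (cong (λ j → ∂ j (term 1ℤ (e ++ downFrom (suc (suc (length l))))) α) (sym eq))
      (trans (∂-staircase e (length l) (downFrom (length l)) α)
        (cong (λ t → term 1ℤ t α) (sym (Listₚ.++-assoc e [ length l ] _)))))))

AllPairs-++⁻ : ∀ {R : ℕ → ℕ → Set} u {v} → AllPairs R (u ++ v) →
  AllPairs R u × AllPairs R v × All (λ x → All (R x) v) u
AllPairs-++⁻ [] ps = [] , ps , []
AllPairs-++⁻ (x ∷ u) (p ∷ ps) with AllPairs-++⁻ u ps
... | a , b , c = Allₚ.++⁻ˡ u p ∷ a , b , Allₚ.++⁻ʳ u p ∷ c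

-- The cases of the co-transition formula

private
  𝔖-Asc-++ʳ : ∀ {k u} l → Asc k u → ∂ k (𝔖 (swapAt k u ++ l)) ≗ 𝔖 (u ++ l)
  𝔖-Asc-++ʳ {k} {u} l p e = sym (trans (𝔖-Asc (u ++ l) (Asc-++ʳ l p) e)
    (cong (λ t → ∂ k (𝔖 t) e) (swapAt-++ʳ l p)))

  ∂-𝔖-++-Desc : ∀ {k l} u → Desc k l → ∂ (length u + k) (𝔖 (u ++ l)) ≗ 𝔖 (u ++ swapAt k l)
  ∂-𝔖-++-Desc {k} {l} u d e = trans (∂-𝔖-Desc (u ++ l) (Desc-++ u d) e) (cong (λ t → 𝔖 t e) (swapAt-++ u k l))

  𝔖-++-Asc : ∀ {k l} u → Asc k l → 𝔖 (u ++ l) ≗ ∂ (length u + k) (𝔖 (u ++ swapAt k l))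
  𝔖-++-Asc {k} {l} u p e = trans (𝔖-Asc (u ++ l) (Asc-++ u p) e) (cong (λ t → ∂ (length u + k) (𝔖 t) e) (swapAt-++ u k l))

  CoTransition : List ℕ → ℕ → ℕ → List ℕ → Set
  CoTransition u c ub v = X (length u) (𝔖 (u ++ c ∷ v)) ≗ Cov c ub v (λ y l → 𝔖 (u ++ y ∷ l))

  ascent-in-prefix : ∀ {k} u c ub v → Asc k u → CoTransition (swapAt k u) c ub v → CoTransition u c ub v
  ascent-in-prefix {k} u c ub v p ih e = begin
    X (length u) (𝔖 (u ++ c ∷ v)) e
      ≡⟨ X-cong (length u) (𝔖-Asc-++ʳ (c ∷ v) p) e ⟨
    X (length u) (∂ k (𝔖 (swapAt k u ++ c ∷ v))) e
      ≡⟨ X-∂-above (Asc-length p) _ e ⟩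
    ∂ k (X (length u) (𝔖 (swapAt k u ++ c ∷ v))) e
      ≡⟨ cong (λ r → ∂ k (X r (𝔖 (swapAt k u ++ c ∷ v))) e) (length-swapAt k u) ⟨
    ∂ k (X (length (swapAt k u)) (𝔖 (swapAt k u ++ c ∷ v))) e
      ≡⟨ ∂-cong k ih e ⟩
    ∂ k (Cov c ub v (λ y l → 𝔖 (swapAt k u ++ y ∷ l))) e
      ≡⟨ ∂-Cov k c ub v _ e ⟩
    Cov c ub v (λ y l → ∂ k (𝔖 (swapAt k u ++ y ∷ l))) e
      ≡⟨ Cov-cong v e (λ y l _ → 𝔖-Asc-++ʳ (y ∷ l) p e) ⟩
    Cov c ub v (λ y l → 𝔖 (u ++ y ∷ l)) e ∎
    where open ≡-Reasoning

  ascent-in-suffix : ∀ {k} u c ub v → All (c ≢_) v → Asc k v → CoTransition u c ub (swapAt k v) → CoTransition u c ub v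
  ascent-in-suffix {k} u c ub v ne p ih e = begin
    X r (𝔖 (u ++ c ∷ v)) e
      ≡⟨ X-cong r (𝔖-++-Asc u (there p)) e ⟩
    X r (∂ (r + suc k) (𝔖 (u ++ c ∷ swapAt k v))) e
      ≡⟨ X-∂-below (ℕₚ.m<m+n r (s≤s z≤n)) _ e ⟩
    ∂ (r + suc k) (X r (𝔖 (u ++ c ∷ swapAt k v))) e
      ≡⟨ ∂-cong (r + suc k) ih e ⟩
    ∂ (r + suc k) (Cov c ub (swapAt k v) (λ y l → 𝔖 (u ++ y ∷ l))) e
      ≡⟨ Cov-swapAt {K = r + suc k} {Φ = λ y l → 𝔖 (u ++ y ∷ l)} p ne
           (λ y l d → ∂-𝔖-++-Desc {l = y ∷ l} u (there d))
           (λ y l a → ∂-𝔖-Asc (u ++ y ∷ l) (Asc-++ u (there a))) e ⟩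
    Cov c ub v (λ y l → 𝔖 (u ++ y ∷ l)) e ∎
    where
    open ≡-Reasoning
    r = length u

  -- The Leibniz rule splits the product into the word with b and c exchanged, which is the cover
  -- through b, and ∂ of the formula for that word with b added to the prefix. There ∂ kills the
  -- covers through y > b, since b before y is an ascent, and moves b behind y when y < b; these are
  -- the covers that remain once b lowers the bound.
  ascent-at-pivot : ∀ u c b ub v → c < b → b < ub → All (b ≢_) v →
    CoTransition (u ++ [ b ]) c ub v → CoTransition u c ub (b ∷ v)
  ascent-at-pivot u c b ub v c<b b<ub ne ih e = begin
    X r (𝔖 (u ++ c ∷ b ∷ v)) e
      ≡⟨ X-cong r (λ e′ → trans (𝔖-++-Asc u (here c<b) e′) (cong (λ j → ∂ j (𝔖 w′) e′) (ℕₚ.+-identityʳ r))) e ⟩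
    X r (∂ r (𝔖 w′)) e
      ≡⟨ X-∂ r (𝔖 w′) (λ e′ short → 𝔖-length w′ e′ (λ eq → ℕₚ.<-irrefl eq (ℕₚ.≤-<-trans short long))) e ⟩
    ∂ r (X (suc r) (𝔖 w′)) e +ᶻ 𝔖 w′ e
      ≡⟨ cong (_+ᶻ 𝔖 w′ e) (∂-cong r (λ e′ → trans (cong₂ (λ j w → X j (𝔖 w) e′) (sym |u∷b|) (sym (Listₚ.++-assoc u [ b ] (c ∷ v)))) (ih e′)) e) ⟩
    ∂ r (Cov c ub v (λ y l → 𝔖 ((u ++ [ b ]) ++ y ∷ l))) e +ᶻ 𝔖 w′ e
      ≡⟨ cong (_+ᶻ 𝔖 w′ e) (∂-cong r (λ e′ → Cov-cong v e′ (λ y l _ → cong (λ w → 𝔖 w e′) (Listₚ.++-assoc u [ b ] (y ∷ l)))) e) ⟩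
    ∂ r (Cov c ub v (λ y l → 𝔖 (u ++ b ∷ y ∷ l))) e +ᶻ 𝔖 w′ e
      ≡⟨ cong (_+ᶻ 𝔖 w′ e) (∂-Cov r c ub v _ e) ⟩
    Cov c ub v (λ y l → ∂ r (𝔖 (u ++ b ∷ y ∷ l))) e +ᶻ 𝔖 w′ e
      ≡⟨ cong (_+ᶻ 𝔖 w′ e) (Cov-restrict {Φ = λ y l → ∂ r (𝔖 (u ++ b ∷ y ∷ l))} v e (ℕₚ.<⇒≤ b<ub) ne (λ y l b<y → vanish y l b<y)) ⟩
    Cov c b v (λ y l → ∂ r (𝔖 (u ++ b ∷ y ∷ l))) e +ᶻ 𝔖 w′ e
      ≡⟨ cong (_+ᶻ 𝔖 w′ e) (Cov-cong v e (λ y l y<b → trans (cong (λ j → ∂ j (𝔖 (u ++ b ∷ y ∷ l)) e) (sym (ℕₚ.+-identityʳ r))) (∂-𝔖-++-Desc {l = b ∷ y ∷ l} u (here y<b) e))) ⟩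
    Cov c b v (λ y l → 𝔖 (u ++ y ∷ b ∷ l)) e +ᶻ 𝔖 w′ e
      ≡⟨ ℤₚ.+-comm _ (𝔖 w′ e) ⟩
    𝔖 w′ e +ᶻ Cov c b v (λ y l → 𝔖 (u ++ y ∷ b ∷ l)) e
      ≡⟨ Cov-take c ub b v (λ y l → 𝔖 (u ++ y ∷ l)) e c<b b<ub ⟨
    Cov c ub (b ∷ v) (λ y l → 𝔖 (u ++ y ∷ l)) e ∎
    where
    open ≡-Reasoning
    r = length u
    w′ = u ++ b ∷ c ∷ v
    long : suc r < length w′
    long = subst (suc r <_)
      (sym (trans (Listₚ.length-++ u) (trans (ℕₚ.+-suc r _) (cong suc (ℕₚ.+-suc r (length v))))))
      (s≤s (s≤s (ℕₚ.m≤m+n r (length v))))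
    |u∷b| : length (u ++ [ b ]) ≡ suc r
    |u∷b| = trans (Listₚ.length-++ u) (ℕₚ.+-comm r 1)
    vanish : ∀ y l → b < y → ∂ r (𝔖 (u ++ b ∷ y ∷ l)) e ≡ 0ℤ
    vanish y l b<y = ∂-𝔖-Asc (u ++ b ∷ y ∷ l) (subst (λ j → Asc j (u ++ b ∷ y ∷ l)) (ℕₚ.+-identityʳ r) (Asc-++ u (here b<y))) e

  -- The word with b and c exchanged is dominant, with exponents m + 1 and m at the pivot. Passing
  -- back to the given word lowers the first of them by one, and multiplication by the pivot
  -- variable restores it.
  only-cover : ∀ u c b ub v → c < b → b < ub → Decreasing u → Decreasing (b ∷ v) → All (c <_) u → All (b ≢_) u →
    All (c ≢_) v → ¬ Any (c <_) v → CoTransition u c ub (b ∷ v)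
  only-cover u c b ub v c<b b<ub du (b>v ∷ dv) c<u ne c≢v none e
    with 𝔖-dominant u b (c ∷ v)
      (AllPairsₚ.++⁺ du (c>v ∷ dv) (All.map (λ c<x → c<x ∷ All.map (λ y<c → ℕₚ.<-trans y<c c<x) c>v) c<u))
      ((c<b ∷ b>v) ∷ c>v ∷ dv) ne
    where
    c>v : All (ℕ._< c) v
    c>v = All.zipWith (λ (p , q) → ℕₚ.≤∧≢⇒< (ℕₚ.≮⇒≥ p) (λ eq → q (sym eq))) (Allₚ.¬Any⇒All¬ v none , c≢v)
  ... | e₀ , eq , h = begin
    X r (𝔖 (u ++ c ∷ b ∷ v)) e
      ≡⟨ X-cong r (λ e′ → trans (𝔖-++-Asc u (here c<b) e′) (trans (cong (λ j → ∂ j (𝔖 w′) e′) (trans (ℕₚ.+-identityʳ r) (sym eq)))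
           (trans (∂-cong (length e₀) h e′) (∂-staircase e₀ m (downFrom m) e′)))) e ⟩
    X r (term 1ℤ (e₀ ++ m ∷ m ∷ downFrom m)) e
      ≡⟨ cong (λ j → X j (term 1ℤ (e₀ ++ m ∷ m ∷ downFrom m)) e) eq ⟨
    X (length e₀) (term 1ℤ (e₀ ++ m ∷ m ∷ downFrom m)) e
      ≡⟨ X-term e₀ m _ e ⟩
    term 1ℤ (e₀ ++ suc m ∷ m ∷ downFrom m) e
      ≡⟨ h e ⟨
    𝔖 w′ e
      ≡⟨ trans (cong (𝔖 w′ e +ᶻ_) (Cov-none v e (Allₚ.¬Any⇒All¬ v none))) (ℤₚ.+-identityʳ _) ⟨
    𝔖 w′ e +ᶻ Cov c b v (λ y l → 𝔖 (u ++ y ∷ b ∷ l)) e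
      ≡⟨ Cov-take c ub b v (λ y l → 𝔖 (u ++ y ∷ l)) e c<b b<ub ⟨
    Cov c ub (b ∷ v) (λ y l → 𝔖 (u ++ y ∷ l)) e ∎
    where
    open ≡-Reasoning
    r = length u
    m = length v
    w′ = u ++ b ∷ c ∷ v

  -- Induction on the colength. An ascent inside `u` or inside `v` is removed by a divided
  -- difference that leaves the pivot alone. If both are decreasing, the first entry b of `v`
  -- exceeds c, because some entry does. Either a further entry of `v` exceeds c, and b can be moved
  -- into the prefix, or b gives the only cover and both sides are monomials.
  cotransition-below : ∀ m u c ub v → ascents (u ++ c ∷ v) < m → Unique (u ++ c ∷ v) →
    All (c <_) u → All (_< ub) v → Any (c <_) v → CoTransition u c ub v
  cotransition-below (suc m) u c ub v (s≤s w≤m) un c<u v<ub some with AllPairs-++⁻ u un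
  ... | un-u , (c≢v ∷ un-v) , u≢ with ascent-or-decreasing u un-u | ascent-or-decreasing v un-v
  ...   | inj₁ (k , p) | _ = ascent-in-prefix u c ub v p
          (cotransition-below m (swapAt k u) c ub v
            (subst (λ t → ascents t < m) (swapAt-++ʳ (c ∷ v) p) (ℕₚ.<-≤-trans (ascents-swapAt (Asc-++ʳ (c ∷ v) p)) w≤m))
            (subst Unique (swapAt-++ʳ (c ∷ v) p) (Unique-swapAt k un)) (All-swapAt k c<u) v<ub some)
  ...   | inj₂ _ | inj₁ (k , p) = ascent-in-suffix u c ub v c≢v p
          (cotransition-below m u c ub (swapAt k v)
            (subst (λ t → ascents t < m) (swapAt-++ u (suc k) (c ∷ v)) (ℕₚ.<-≤-trans (ascents-swapAt (Asc-++ u (there p))) w≤m))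
            (subst Unique (swapAt-++ u (suc k) (c ∷ v)) (Unique-swapAt (length u + suc k) un)) c<u
            (All-swapAt k v<ub) (Any-swapAt k some))
  cotransition-below (suc m) u c ub (b ∷ v) (s≤s w≤m) un c<u (b<ub ∷ v<ub) some
    | un-u , ((c≢b ∷ c≢v) ∷ b≢v ∷ un-v) , u≢ | inj₂ du | inj₂ (b>v ∷ dv) with any? (c ℕ.<?_) v
  ...     | no none = only-cover u c b ub v c<b b<ub du (b>v ∷ dv) c<u
              (All.map (λ { (_ ∷ x≢b ∷ _) eq → x≢b (sym eq) }) u≢) c≢v none
    where
    c<b : c < b
    c<b = Any.head none some
  ...     | yes some′ = ascent-at-pivot u c b ub v c<b b<ub b≢v
              (cotransition-below m (u ++ [ b ]) c ub v
                (subst (λ t → ascents t < m) w′≡ (ℕₚ.<-≤-trans (ascents-swapAt (Asc-++ u (here c<b))) w≤m))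
                (subst Unique w′≡ (Unique-swapAt (length u + 0) un)) (Allₚ.++⁺ c<u (c<b ∷ [])) v<ub some′)
    where
    c<b : c < b
    c<b = All.lookupAny b>v some′ |> λ (y<b , c<y) → ℕₚ.<-trans c<y y<b
    w′≡ : swapAt (length u + 0) (u ++ c ∷ b ∷ v) ≡ (u ++ [ b ]) ++ c ∷ v
    w′≡ = trans (swapAt-++ u 0 (c ∷ b ∷ v)) (sym (Listₚ.++-assoc u [ b ] (c ∷ v)))

cotransition : ∀ u c ub v → Unique (u ++ c ∷ v) → All (c <_) u → All (_< ub) v → Any (c <_) v →
  X (length u) (𝔖 (u ++ c ∷ v)) ≗ Cov c ub v (λ y l → 𝔖 (u ++ y ∷ l))
cotransition u c ub v = cotransition-below _ u c ub v ℕₚ.≤-refl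

-- Positivity

Unique-resp-↭ : ∀ {l m : List ℕ} → l ↭ m → Unique l → Unique m
Unique-resp-↭ p = Permutationₚ.Unique-resp-↭ (setoid ℕ) (↭⇒↭ₛ p)

-- Forgets the covering condition of `Cov`: for positivity it matters only that a larger entry y and
-- c have changed places.
data Swapped (c : ℕ) : List ℕ → ℕ → List ℕ → Set where
  here  : ∀ {y v} → c < y → Swapped c (y ∷ v) y (c ∷ v)
  there : ∀ {x v y l} → Swapped c v y l → Swapped c (x ∷ v) y (x ∷ l)

Cov-nonneg : ∀ c ub v Φ e → (∀ y l → Swapped c v y l → 0ℤ ≤ᶻ Φ y l e) → 0ℤ ≤ᶻ Cov c ub v Φ e
Cov-nonneg c ub [] Φ e h = ℤₚ.≤-refl
Cov-nonneg c ub (y ∷ v) Φ e h with step? c ub y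
... | take p q rewrite Cov-take c ub y v Φ e p q =
  ℤₚ.+-mono-≤ (h y (c ∷ v) (here p)) (Cov-nonneg c y v _ e (λ z l s → h z (y ∷ l) (there s)))
... | low p rewrite Cov-skip-low c ub y v Φ e p = Cov-nonneg c ub v _ e (λ z l s → h z (y ∷ l) (there s))
... | high p rewrite Cov-skip-high c ub y v Φ e p = Cov-nonneg c ub v _ e (λ z l s → h z (y ∷ l) (there s))

-- Σ k · w(k), positions counted from 0: decreases along the co-transition formula.
moment : List ℕ → ℕ
moment [] = 0
moment (x ∷ l) = sum l + moment l

Swapped-↭ : ∀ {c v y l} → Swapped c v y l → y ∷ l ↭ c ∷ v
Swapped-↭ {c} {y = y} (here _) = ↭-swap y c ↭-refl
Swapped-↭ {c} {y = y} (there {x} {v} s) = ↭-trans (↭-swap y x ↭-refl) (↭-trans (↭-prep x (Swapped-↭ s)) (↭-swap x c ↭-refl))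

Swapped-< : ∀ {c v y l} → Swapped c v y l → c < y
Swapped-< (here p) = p
Swapped-< (there s) = Swapped-< s

Swapped-moment : ∀ {c v y l} → Swapped c v y l → moment (y ∷ l) < moment (c ∷ v)
Swapped-moment (here {v = v} p) = ℕₚ.+-monoˡ-< (sum v + moment v) (ℕₚ.+-monoˡ-< (sum v) p)
Swapped-moment {c} {y = y} (there {x} {v} {l = l} s) = ℕₚ.+-mono-<-≤
  (ℕₚ.+-monoʳ-< x (sum-< s)) (ℕₚ.<⇒≤ (Swapped-moment s))
  where
  sum-< : ∀ {v l} → Swapped c v y l → sum l < sum v
  sum-< {v} {l} s = ℕₚ.+-cancelˡ-< c (sum l) (sum v)
    (ℕₚ.<-≤-trans (ℕₚ.+-monoˡ-< (sum l) (Swapped-< s)) (ℕₚ.≤-reflexive (sum-↭ (Swapped-↭ s))))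

moment-++ : ∀ u {v l} → sum v ≡ sum l → moment v < moment l → moment (u ++ v) < moment (u ++ l)
moment-++ [] _ h = h
moment-++ (x ∷ u) {v} {l} eq h = ℕₚ.+-mono-≤-<
  (ℕₚ.≤-reflexive (trans (sum-++ u v) (trans (cong (sum u +_) eq) (sym (sum-++ u l))))) (moment-++ u eq h)

-- The prefix up to the first ascent decreases, so all entries before c exceed c. That is the
-- hypothesis of `cotransition` and the reason why column c is an initial segment of rows.
data View (w : List ℕ) : Set where
  decreasing : Decreasing w → View w
  first : ∀ u c b v → w ≡ u ++ c ∷ b ∷ v → Decreasing (u ++ [ c ]) → c < b → firstAscent w ≡ just (length u) → View w

view : ∀ w → Unique w → View w
view [] _ = decreasing []
view (a ∷ []) _ = decreasing ([] ∷ [])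
view (a ∷ b ∷ l) ((a≢b ∷ _) ∷ un) with a ℕ.<? b
... | yes a<b = first [] a b l refl ([] ∷ []) a<b (cong (λ t → if t then just 0 else Data.Maybe.map suc (firstAscent (b ∷ l))) (<ᵇ-true a<b))
... | no a≮b with view (b ∷ l) un
...   | decreasing (b>l ∷ dl) = decreasing ((b<a ∷ All.map (λ h → ℕₚ.<-trans h b<a) b>l) ∷ b>l ∷ dl)
  where b<a = ℕₚ.≤∧≢⇒< (ℕₚ.≮⇒≥ a≮b) (λ eq → a≢b (sym eq))
...   | first u c d v eq dec c<d fa = first (a ∷ u) c d v (cong (a ∷_) eq) (above u eq dec ∷ dec) c<d
  (trans (cong (λ t → if t then just 0 else Data.Maybe.map suc (firstAscent (b ∷ l))) (<ᵇ-false a≮b)) (cong (Data.Maybe.map suc) fa))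
  where
  b<a = ℕₚ.≤∧≢⇒< (ℕₚ.≮⇒≥ a≮b) (λ eq → a≢b (sym eq))
  above : ∀ u → b ∷ l ≡ u ++ c ∷ d ∷ v → Decreasing (u ++ [ c ]) → All (_< a) (u ++ [ c ])
  above [] refl _ = b<a ∷ []
  above (_ ∷ u) refl (ps ∷ _) = b<a ∷ All.map (λ h → ℕₚ.<-trans h b<a) ps

Decreasing-∷ʳ⁻ : ∀ u {c} → Decreasing (u ++ [ c ]) → All (c <_) u
Decreasing-∷ʳ⁻ u dec = All.map All.head (proj₂ (proj₂ (AllPairs-++⁻ u dec)))

bump : ℕ → Exp → Exp
bump k [] = []
bump zero (a ∷ e) = suc a ∷ e
bump (suc k) (a ∷ e) = a ∷ bump k e

X-bump : ∀ r f e → r < length e → X r f (bump r e) ≡ f e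
X-bump zero f (a ∷ e) _ = refl
X-bump (suc r) f (a ∷ e) (s≤s h) = X-bump r _ e h

X-at-0 : ∀ r f e → at e r ≡ 0 → X r f e ≡ 0ℤ
X-at-0 r f [] _ = refl
X-at-0 zero f (zero ∷ e) _ = refl
X-at-0 (suc r) f (a ∷ e) h = X-at-0 r _ e h

term-nonneg : ∀ e α → 0ℤ ≤ᶻ term 1ℤ e α
term-nonneg e α with eqE e α
... | true = ℤ.+≤+ z≤n
... | false = ℤₚ.≤-refl

upper-bound : ∀ l → ∃ λ ub → All (_< ub) l
upper-bound [] = 0 , []
upper-bound (x ∷ l) with upper-bound l
... | ub , h = suc x + ub , ℕₚ.m≤m+n (suc x) ub ∷ All.map (λ p → ℕₚ.<-≤-trans p (ℕₚ.m≤n+m ub (suc x))) h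

private
  -- A coefficient of `𝔖 w` reappears after multiplication by a variable, at the bumped exponent.
  -- There it is a sum of coefficients for covers, whose words have smaller moment.
  nonneg-below : ∀ m w → Unique w → moment w < m → ∀ e → 0ℤ ≤ᶻ 𝔖 w e

  covers-nonneg : ∀ m u c v → Unique (u ++ c ∷ v) → moment (u ++ c ∷ v) ≤ m →
    ∀ e y l → Swapped c v y l → 0ℤ ≤ᶻ 𝔖 (u ++ y ∷ l) e
  covers-nonneg m u c v un w≤m e y l s = nonneg-below m (u ++ y ∷ l)
    (Unique-resp-↭ (↭-sym (++⁺ˡ u (Swapped-↭ s))) un)
    (ℕₚ.<-≤-trans (moment-++ u (sum-↭ (Swapped-↭ s)) (Swapped-moment s)) w≤m) e

  nonneg-below (suc m) w un (s≤s w≤m) e with view w un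
  ... | decreasing dec rewrite 𝔖-Decreasing dec e = term-nonneg (downFrom (length w)) e
  ... | first u c b v refl dec c<b _ with length e ℕ.≟ length w
  ...   | no ≢ rewrite 𝔖-length w e ≢ = ℤₚ.≤-refl
  ...   | yes eq with upper-bound (b ∷ v)
  ...     | ub , lt = subst (0ℤ ≤ᶻ_)
    (trans (sym (cotransition u c ub (b ∷ v) un (Decreasing-∷ʳ⁻ u dec) lt (here c<b) (bump (length u) e)))
           (X-bump (length u) (𝔖 w) e (subst (length u <_) (sym (trans eq (Listₚ.length-++ u))) (ℕₚ.m<m+n (length u) (s≤s z≤n)))))
    (Cov-nonneg c ub (b ∷ v) (λ y l → 𝔖 (u ++ y ∷ l)) (bump (length u) e) (covers-nonneg m u c (b ∷ v) un w≤m (bump (length u) e)))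

𝔖-nonneg : ∀ w → Unique w → ∀ e → 0ℤ ≤ᶻ 𝔖 w e
𝔖-nonneg w un = nonneg-below _ w un ℕₚ.≤-refl

𝔖-covered : ∀ u c b v → Unique (u ++ c ∷ b ∷ v) → Decreasing (u ++ [ c ]) → c < b →
  ∀ e → 𝔖 (u ++ b ∷ c ∷ v) e ≤ᶻ X (length u) (𝔖 (u ++ c ∷ b ∷ v)) e
𝔖-covered u c b v un dec c<b e with upper-bound (b ∷ v)
... | ub , lt@(b<ub ∷ _)
  rewrite cotransition u c ub (b ∷ v) un (Decreasing-∷ʳ⁻ u dec) lt (here c<b) e
        | Cov-take c ub b v (λ y l → 𝔖 (u ++ y ∷ l)) e c<b b<ub =
  ℤₚ.≤-trans (ℤₚ.≤-reflexive (sym (ℤₚ.+-identityʳ _))) (ℤₚ.+-monoʳ-≤ (𝔖 (u ++ b ∷ c ∷ v) e)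
    (Cov-nonneg c b v (λ y l → 𝔖 (u ++ y ∷ b ∷ l)) e (λ y l s → covers-nonneg _ u c (b ∷ v) un ℕₚ.≤-refl e y (b ∷ l) (there s))))

-- Sums of 0/1 vectors dominating given columns

Column : Set
Column = List Bool

-- Dom s C B: on every prefix B has at least as many boxes as C, given a surplus of s, and
-- the surplus is used up at the end.
data Dom : ℕ → Column → Column → Set where
  []   : Dom 0 [] []
  keep : ∀ {s C B} b → Dom s C B → Dom s (b ∷ C) (b ∷ B)
  up   : ∀ {s C B} → Dom (suc s) C B → Dom s (false ∷ C) (true ∷ B)
  down : ∀ {s C B} → Dom s C B → Dom (suc s) (true ∷ C) (false ∷ B)

bit : Bool → ℕ
bit true  = 1
bit false = 0

val : Column → Exp
val = map bit

infixl 6 _⊕_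
_⊕_ : Exp → Exp → Exp
_⊕_ = zipWith _+_

total : ℕ → List Column → Exp
total n []       = replicate n 0
total n (B ∷ Bs) = val B ⊕ total n Bs

-- For a fixed column the dominating 0/1 vectors are the bases of a Schubert matroid. Sums of bases
-- of several matroids form an M-convex set, whose exchange property is `M-exchange`.
M : ℕ → List Column → Exp → Set
M n cs e = ∃ λ Bs → Pointwise (Dom 0) cs Bs × e ≡ total n Bs

HasLengths : ℕ → List Column → Set
HasLengths n = All (λ C → length C ≡ n)

Dom-length : ∀ {s C B} → Dom s C B → length B ≡ length C
Dom-length [] = refl
Dom-length (keep b d) = cong suc (Dom-length d)
Dom-length (up d) = cong suc (Dom-length d)
Dom-length (down d) = cong suc (Dom-length d)

Doms-lengths : ∀ {n cs Bs} → HasLengths n cs → Pointwise (Dom 0) cs Bs → HasLengths n Bs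
Doms-lengths [] [] = []
Doms-lengths (h ∷ hs) (d ∷ ds) = trans (Dom-length d) h ∷ Doms-lengths hs ds

⊕-length : ∀ {n} u v → length u ≡ n → length v ≡ n → length (u ⊕ v) ≡ n
⊕-length u v p q = trans (Listₚ.length-zipWith _+_ u v)
  (trans (cong₂ ℕ._⊓_ p q) (ℕₚ.⊓-idem _))

val-length : ∀ B → length (val B) ≡ length B
val-length = Listₚ.length-map bit

total-length : ∀ {n} Bs → HasLengths n Bs → length (total n Bs) ≡ n
total-length {n} [] _ = Listₚ.length-replicate n
total-length (B ∷ Bs) (h ∷ hs) = ⊕-length (val B) _ (trans (val-length B) h) (total-length Bs hs)

at-replicate : ∀ n k → at (replicate n 0) k ≡ 0
at-replicate zero k = refl
at-replicate (suc n) zero = refl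
at-replicate (suc n) (suc k) = at-replicate n k

at-⊕ : ∀ u v k → length u ≡ length v → at (u ⊕ v) k ≡ at u k + at v k
at-⊕ [] [] k _ = refl
at-⊕ (a ∷ u) (b ∷ v) zero _ = refl
at-⊕ (a ∷ u) (b ∷ v) (suc k) h = at-⊕ u v k (ℕₚ.suc-injective h)

at-total : ∀ {n B Bs} k → length B ≡ n → HasLengths n Bs → at (total n (B ∷ Bs)) k ≡ at (val B) k + at (total n Bs) k
at-total {B = B} {Bs} k h hs = at-⊕ (val B) (total _ Bs) k (trans (trans (val-length B) h) (sym (total-length Bs hs)))

bump-⊕ˡ : ∀ k u v → bump k (u ⊕ v) ≡ bump k u ⊕ v
bump-⊕ˡ k [] v = refl
bump-⊕ˡ zero (a ∷ u) [] = refl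
bump-⊕ˡ (suc k) (a ∷ u) [] = refl
bump-⊕ˡ zero (a ∷ u) (b ∷ v) = refl
bump-⊕ˡ (suc k) (a ∷ u) (b ∷ v) = cong (a + b ∷_) (bump-⊕ˡ k u v)

bump-⊕ʳ : ∀ k u v → bump k (u ⊕ v) ≡ u ⊕ bump k v
bump-⊕ʳ k [] v = refl
bump-⊕ʳ k (a ∷ u) [] = refl
bump-⊕ʳ zero (a ∷ u) (b ∷ v) = cong (_∷ (u ⊕ v)) (sym (ℕₚ.+-suc a b))
bump-⊕ʳ (suc k) (a ∷ u) (b ∷ v) = cong (a + b ∷_) (bump-⊕ʳ k u v)

bump-injective : ∀ k e f → bump k e ≡ bump k f → e ≡ f
bump-injective k [] [] _ = refl
bump-injective zero (a ∷ e) (.a ∷ .e) refl = refl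
bump-injective (suc k) (a ∷ e) (b ∷ f) h = cong₂ _∷_ (Listₚ.∷-injectiveˡ h) (bump-injective k e f (Listₚ.∷-injectiveʳ h))
bump-injective zero [] (b ∷ f) ()
bump-injective (suc k) [] (b ∷ f) ()

bump-comm : ∀ i j e → bump i (bump j e) ≡ bump j (bump i e)
bump-comm i j [] = refl
bump-comm zero zero (a ∷ e) = refl
bump-comm zero (suc j) (a ∷ e) = refl
bump-comm (suc i) zero (a ∷ e) = refl
bump-comm (suc i) (suc j) (a ∷ e) = cong (a ∷_) (bump-comm i j e)

bump-length : ∀ k e → length (bump k e) ≡ length e
bump-length k [] = refl
bump-length zero (a ∷ e) = refl
bump-length (suc k) (a ∷ e) = cong suc (bump-length k e)

at-bump : ∀ k e → k < length e → at (bump k e) k ≡ suc (at e k)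
at-bump zero (a ∷ e) _ = refl
at-bump (suc k) (a ∷ e) (s≤s h) = at-bump k e h

at-bump-≢ : ∀ k j e → k ≢ j → at (bump k e) j ≡ at e j
at-bump-≢ k j [] _ = refl
at-bump-≢ zero zero (a ∷ e) ne = ⊥-elim (ne refl)
at-bump-≢ zero (suc j) (a ∷ e) _ = refl
at-bump-≢ (suc k) zero (a ∷ e) _ = refl
at-bump-≢ (suc k) (suc j) (a ∷ e) ne = at-bump-≢ k j e (λ eq → ne (cong suc eq))

-- Exchange in one column and in sums of columns

data Exceeds : ℕ → Column → Column → Set where
  here  : ∀ {B B′} → Exceeds 0 (true ∷ B) (false ∷ B′)
  there : ∀ {k b b′ B B′} → Exceeds k B B′ → Exceeds (suc k) (b ∷ B) (b′ ∷ B′)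

exceeds : ∀ k B B′ → length B ≡ length B′ → at (val B′) k < at (val B) k → Exceeds k B B′
exceeds k [] [] _ ()
exceeds zero (true ∷ B) (false ∷ B′) _ _ = here
exceeds zero (true ∷ B) (true ∷ B′) _ (s≤s ())
exceeds (suc k) (b ∷ B) (b′ ∷ B′) h lt = there (exceeds k B B′ (ℕₚ.suc-injective h) lt)

Exceeds-length : ∀ {k B B′} → Exceeds k B B′ → k < length B
Exceeds-length here = s≤s z≤n
Exceeds-length (there x) = s≤s (Exceeds-length x)

excess : Column → Column → ℕ
excess (true  ∷ B) (false ∷ B′) = suc (excess B B′)
excess (_     ∷ B) (_     ∷ B′) = excess B B′
excess _           _            = 0

excess-∷ : ∀ b {B Z B′} b′ → suc (excess Z B′) ≡ excess B B′ → suc (excess (b ∷ Z) (b′ ∷ B′)) ≡ excess (b ∷ B) (b′ ∷ B′)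
excess-∷ true true h = h
excess-∷ true false h = cong suc h
excess-∷ false _ h = h

private
  remove : ∀ {s C B B′ i} → Dom s C B → Exceeds i B B′ →
    ∃ λ Z → Dom (suc s) C Z × bump i (val Z) ≡ val B × suc (excess Z B′) ≡ excess B B′
  remove (keep {B = B} true d) here = false ∷ B , down d , refl , refl
  remove (up {B = B} d) here = false ∷ B , keep false d , refl , refl
  remove (keep b d) (there {b′ = b′} x) with remove d x
  ... | Z , d′ , eq , ex = b ∷ Z , keep b d′ , cong (bit b ∷_) eq , excess-∷ b b′ ex
  remove (up d) (there {b′ = b′} x) with remove d x
  ... | Z , d′ , eq , ex = true ∷ Z , up d′ , cong (1 ∷_) eq , excess-∷ true b′ ex
  remove (down d) (there {b′ = b′} {B} {B′} x) with remove d x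
  ... | Z , d′ , eq , ex = false ∷ Z , down d′ , cong (0 ∷_) eq , excess-∷ false {B} {Z} {B′} b′ ex

  Insertion : ℕ → Column → Column → Column → Set
  Insertion t C B B′ = ∃ λ j → ∃ λ Z →
    Exceeds j B′ B × Dom t C Z × val Z ≡ bump j (val B) × excess Z B′ ≡ excess B B′

  cons-insertion : ∀ {t t′ c C b B b′ B′} → (∀ {Z} → Dom t C Z → Dom t′ (c ∷ C) (b ∷ Z)) →
    Insertion t C B B′ → Insertion t′ (c ∷ C) (b ∷ B) (b′ ∷ B′)
  cons-insertion {b = b} {b′ = b′} k (j , Z , x , d , eq , ex) =
    suc j , b ∷ Z , there x , k d , cong (bit b ∷_) eq , lift b {_} {Z} b′ ex
    where
    lift : ∀ b {B Z B′} b′ → excess Z B′ ≡ excess B B′ → excess (b ∷ Z) (b′ ∷ B′) ≡ excess (b ∷ B) (b′ ∷ B′)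
    lift true true h = h
    lift true false h = cong suc h
    lift false _ h = h

  -- The surplus required by `B` stays strictly above that of `B′` until a row in which only `B′`
  -- has a box. Such a row must come, since both surpluses end at 0. The new box goes into the first
  -- one.
  insert : ∀ {t s′ C B B′} → Dom (suc t) C B → Dom s′ C B′ → s′ ≤ t → Insertion t C B B′
  insert (keep {B = B} false d) (up d′) _ = 0 , true ∷ B , here , up d , refl , refl
  insert (down {B = B} d) (keep true d′) _ = 0 , true ∷ B , here , keep true d , refl , refl
  insert (keep b d) (keep b d′) h = cons-insertion (keep b) (insert d d′ h)
  insert (keep true d) (down d′) h = cons-insertion (keep true) (insert d d′ (ℕₚ.≤-trans (ℕₚ.n≤1+n _) h))
  insert (up d) (keep false d′) h = cons-insertion up (insert d d′ (ℕₚ.m≤n⇒m≤1+n h))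
  insert (up d) (up d′) h = cons-insertion up (insert d d′ (s≤s h))
  insert (down d) (down d′) (s≤s h) = cons-insertion down (insert d d′ h)

  Exchange : ℕ → Column → Column → Column → ℕ → Set
  Exchange s C B B′ i = ∃ λ j → ∃ λ Z →
    Exceeds j B′ B × Dom s C Z × bump i (val Z) ≡ bump j (val B) × suc (excess Z B′) ≡ excess B B′

  cons-exchange : ∀ {s s₁ c C b B B′ i} b′ → (∀ {Z} → Dom s₁ C Z → Dom s (c ∷ C) (b ∷ Z)) →
    Exchange s₁ C B B′ i → Exchange s (c ∷ C) (b ∷ B) (b′ ∷ B′) (suc i)
  cons-exchange {b = b} b′ k (j , Z , x , d , eq , ex) =
    suc j , b ∷ Z , there x , k d , cong (bit b ∷_) eq , excess-∷ b {Z = Z} b′ ex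

  -- The row j is the first in which only `B′` has a box. If it comes before i, it is filled in
  -- passing and `remove` later deletes the box in row i; otherwise that box is deleted first and
  -- `insert` finds j. Up to that point `B′` has gained nothing on `B`, which keeps s′ ≤ s.
  exchange : ∀ {s s′ C B B′ i} → Dom s C B → Dom s′ C B′ → s′ ≤ s → Exceeds i B B′ → Exchange s C B B′ i
  exchange (up d) (keep false d′) h here with insert d d′ h
  ... | j , Z , x , dz , eq , ex = suc j , false ∷ Z , there x , keep false dz , cong (1 ∷_) eq , cong suc ex
  exchange (keep true d) (down d′) (s≤s h) here with insert d d′ h
  ... | j , Z , x , dz , eq , ex = suc j , false ∷ Z , there x , down dz , cong (1 ∷_) eq , cong suc ex
  exchange (keep false d) (up d′) h (there x) with remove d x
  ... | Z , dz , eq , ex = 0 , true ∷ Z , here , up dz , cong (1 ∷_) eq , ex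
  exchange (down d) (keep true d′) h (there x) with remove d x
  ... | Z , dz , eq , ex = 0 , true ∷ Z , here , keep true dz , cong (1 ∷_) eq , ex
  exchange (keep b d) (keep b d′) h (there x) = cons-exchange b (keep b) (exchange d d′ h x)
  exchange (keep true d) (down d′) h (there x) = cons-exchange false (keep true) (exchange d d′ (ℕₚ.≤-trans (ℕₚ.n≤1+n _) h) x)
  exchange (up d) (keep false d′) h (there x) = cons-exchange false up (exchange d d′ (ℕₚ.m≤n⇒m≤1+n h) x)
  exchange (up d) (up d′) h (there x) = cons-exchange true up (exchange d d′ (s≤s h) x)
  exchange (down d) (down d′) (s≤s h) (there x) = cons-exchange false down (exchange d d′ h x)

excesses : List Column → List Column → ℕ
excesses (B ∷ Bs) (B′ ∷ Bs′) = excess B B′ + excesses Bs Bs′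
excesses _        _          = 0

private
  exchange-step : ∀ {n cs Bs Bs′} → HasLengths n cs → Pointwise (Dom 0) cs Bs → Pointwise (Dom 0) cs Bs′ →
    ∀ k → at (total n Bs′) k < at (total n Bs) k →
    ∃ λ j → ∃ λ Zs → j < n × Pointwise (Dom 0) cs Zs ×
      bump k (total n Zs) ≡ bump j (total n Bs) × excesses Zs Bs′ < excesses Bs Bs′
  exchange-step [] [] [] k lt = ⊥-elim (ℕₚ.<-irrefl refl lt)
  exchange-step {n} {C ∷ cs} {B ∷ Bs} {B′ ∷ Bs′} (h ∷ hs) (d ∷ ds) (d′ ∷ ds′) k lt
    with at (val B′) k ℕ.<? at (val B) k
  ... | yes p with exchange d d′ ℕₚ.≤-refl (exceeds k B B′ (trans (Dom-length d) (sym (Dom-length d′))) p)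
  ...   | j , Z , x , dz , eq , ex =
    j , Z ∷ Bs , subst (j <_) (trans (Dom-length d′) h) (Exceeds-length x) , dz ∷ ds ,
    trans (bump-⊕ˡ k (val Z) (total n Bs)) (trans (cong (_⊕ total n Bs) eq) (sym (bump-⊕ˡ j (val B) (total n Bs)))) ,
    ℕₚ.≤-reflexive (cong (_+ excesses Bs Bs′) ex)
  exchange-step {n} {C ∷ cs} {B ∷ Bs} {B′ ∷ Bs′} (h ∷ hs) (d ∷ ds) (d′ ∷ ds′) k lt | no p
    with exchange-step hs ds ds′ k
      (ℕₚ.≰⇒> λ q → ℕₚ.<⇒≱ lt (ℕₚ.≤-trans (ℕₚ.≤-reflexive (at-total {B = B} k (trans (Dom-length d) h) (Doms-lengths hs ds)))
        (ℕₚ.≤-trans (ℕₚ.+-mono-≤ (ℕₚ.≮⇒≥ p) q)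
          (ℕₚ.≤-reflexive (sym (at-total {B = B′} k (trans (Dom-length d′) h) (Doms-lengths hs ds′)))))))
  ... | j , Zs , j<n , dzs , eq , ex =
    j , B ∷ Zs , j<n , d ∷ dzs ,
    trans (bump-⊕ʳ k (val B) (total n Zs)) (trans (cong (val B ⊕_) eq) (sym (bump-⊕ʳ j (val B) (total n Bs)))) ,
    ℕₚ.+-monoʳ-< (excess B B′) ex

  -- A unit removed from coordinate i is carried by exchanges in single columns from k to j
  -- until it lands where y exceeds x; the total excess over y decreases at every step.
  carry : ∀ {n cs x Bs Bs′ i} m → HasLengths n cs → length x ≡ n → at (total n Bs′) i < at x i →
    Pointwise (Dom 0) cs Bs → Pointwise (Dom 0) cs Bs′ →
    ∀ k → bump i (total n Bs) ≡ bump k x → at (total n Bs′) k < at (total n Bs) k → excesses Bs Bs′ < m →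
    ∃ λ j → ∃ λ z → at x j < at (total n Bs′) j × M n cs z × bump i z ≡ bump j x
  carry {n} {x = x} {Bs} {Bs′} {i} (suc m) hs hx lt₀ ds ds′ k eq lt (s≤s ≤m) with exchange-step hs ds ds′ k lt
  ... | j , Zs , j<n , dzs , eq′ , ex = next (at x j ℕ.<? at (total n Bs′) j)
    where
    eq″ : bump i (total n Zs) ≡ bump j x
    eq″ = bump-injective k _ _ (trans (bump-comm k i _) (trans (cong (bump i) eq′)
      (trans (bump-comm i j _) (trans (cong (bump j) eq) (bump-comm j k x)))))
    lt′ : ¬ at x j < at (total n Bs′) j → at (total n Bs′) j < at (total n Zs) j
    lt′ ≮ with i ℕ.≟ j
    ... | yes refl = subst (λ z → at (total n Bs′) i < at z i) (sym (bump-injective i _ _ eq″)) lt₀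
    ... | no i≢j = ℕₚ.<-≤-trans (s≤s (ℕₚ.≮⇒≥ ≮)) (ℕₚ.≤-reflexive (sym
      (trans (sym (at-bump-≢ i j (total n Zs) i≢j)) (trans (cong (λ z → at z j) eq″) (at-bump j x (subst (j <_) (sym hx) j<n))))))
    next : Dec (at x j < at (total n Bs′) j) → _
    next (yes p) = j , total n Zs , p , (Zs , dzs , refl) , eq″
    next (no p) = carry m hs hx lt₀ dzs ds′ j eq″ (lt′ p) (ℕₚ.<-≤-trans ex ≤m)

M-length : ∀ {n cs e} → HasLengths n cs → M n cs e → length e ≡ n
M-length hs (Bs , ds , refl) = total-length Bs (Doms-lengths hs ds)

M-exchange : ∀ {n cs x y} → HasLengths n cs → M n cs x → M n cs y → ∀ i → at y i < at x i →
  ∃ λ j → ∃ λ z → at x j < at y j × M n cs z × bump i z ≡ bump j x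
M-exchange hs (Bs , ds , refl) (Bs′ , ds′ , refl) i lt =
  carry _ hs (total-length Bs (Doms-lengths hs ds)) lt ds ds′ i refl lt ℕₚ.≤-refl

boxes : Column → ℕ
boxes B = entrySum (val B)

degree : List Column → ℕ
degree []       = 0
degree (C ∷ cs) = boxes C + degree cs

entrySum-⊕ : ∀ u v → length u ≡ length v → entrySum (u ⊕ v) ≡ entrySum u + entrySum v
entrySum-⊕ [] [] _ = refl
entrySum-⊕ (a ∷ u) (b ∷ v) h = trans (cong (a + b +_) (entrySum-⊕ u v (ℕₚ.suc-injective h)))
  (interchange a b (entrySum u) (entrySum v))

Dom-boxes : ∀ {s C B} → Dom s C B → boxes C ≡ s + boxes B
Dom-boxes [] = refl
Dom-boxes {s} (keep true d) = trans (cong suc (Dom-boxes d)) (sym (ℕₚ.+-suc s _))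
Dom-boxes (keep false d) = Dom-boxes d
Dom-boxes {s} (up d) = trans (Dom-boxes d) (sym (ℕₚ.+-suc s _))
Dom-boxes (down d) = cong suc (Dom-boxes d)

M-degree : ∀ {n cs e} → HasLengths n cs → M n cs e → entrySum e ≡ degree cs
M-degree {n} [] ([] , [] , refl) = zeros n
  where
  zeros : ∀ n → entrySum (replicate n 0) ≡ 0
  zeros zero = refl
  zeros (suc n) = zeros n
M-degree {n} (h ∷ hs) (B ∷ Bs , d ∷ ds , refl) = trans
  (entrySum-⊕ (val B) (total n Bs) (trans (val-length B) (trans (trans (Dom-length d) h) (sym (total-length Bs (Doms-lengths hs ds))))))
  (cong₂ _+_ (sym (Dom-boxes d)) (M-degree hs (Bs , ds , refl)))

-- How the columns change along a swap

data SwapColumn : ℕ → Column → Column → Set where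
  fix   : ∀ {C} b → SwapColumn 0 (b ∷ b ∷ C) (b ∷ b ∷ C)
  move  : ∀ {C} → SwapColumn 0 (true ∷ false ∷ C) (false ∷ true ∷ C)
  there : ∀ {i C′ C} b → SwapColumn i C′ C → SwapColumn (suc i) (b ∷ C′) (b ∷ C)

data Ones : ℕ → Column → Set where
  []   : Ones 0 []
  zero : ∀ {C} → Ones 0 C → Ones 0 (false ∷ C)
  one  : ∀ {k C} → Ones k C → Ones (suc k) (true ∷ C)

-- Describes how the Rothe diagram changes from w′ = w sᵢ to w at the first ascent i. Column w(i) is
-- an initial segment of rows for both and loses its box in row i. Every other column is unchanged
-- or has one box moved from row i to row i + 1.
data Step (i : ℕ) : List Column → List Column → Set where
  pivot : ∀ {S′ S cs′ cs} → Ones (suc i) S′ → Ones i S → Pointwise (SwapColumn i) cs′ cs → Step i (S′ ∷ cs′) (S ∷ cs)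
  _∷_   : ∀ {C′ C cs′ cs} → SwapColumn i C′ C → Step i cs′ cs → Step i (C′ ∷ cs′) (C ∷ cs)

data Off : ℕ → Exp → Exp → Set where
  here  : ∀ {a b a′ b′ e} → Off 0 (a ∷ b ∷ e) (a′ ∷ b′ ∷ e)
  there : ∀ {i x e e′} → Off i e e′ → Off (suc i) (x ∷ e) (x ∷ e′)

Off-⊕ : ∀ {i u u′ v v′} → Off i u u′ → Off i v v′ → Off i (u ⊕ v) (u′ ⊕ v′)
Off-⊕ here here = here
Off-⊕ (there p) (there q) = there (Off-⊕ p q)

Off-refl : ∀ i e → suc i < length e → Off i e e
Off-refl zero (a ∷ b ∷ e) _ = here
Off-refl zero (a ∷ []) (s≤s ())
Off-refl (suc i) (a ∷ e) (s≤s h) = there (Off-refl i e h)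

private
  Ones-unique′ : ∀ {C B} s → Ones 0 C → Dom s C B → s ≡ 0 × B ≡ C
  Ones-unique′ .0 [] [] = refl , refl
  Ones-unique′ s (zero o) (keep false d) with Ones-unique′ s o d
  ... | s≡0 , refl = s≡0 , refl
  Ones-unique′ s (zero o) (up d) with Ones-unique′ (suc s) o d
  ... | () , _

Ones-unique : ∀ {k C B} → Ones k C → Dom 0 C B → B ≡ C
Ones-unique [] d = proj₂ (Ones-unique′ 0 [] d)
Ones-unique (zero o) d = proj₂ (Ones-unique′ 0 (zero o) d)
Ones-unique (one o) (keep true d) = cong (true ∷_) (Ones-unique o d)

Dom-refl : ∀ C → Dom 0 C C
Dom-refl [] = []
Dom-refl (b ∷ C) = keep b (Dom-refl C)

val-Ones : ∀ {i S′ S} → length S ≡ length S′ → Ones (suc i) S′ → Ones i S → val S′ ≡ bump i (val S)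
val-Ones {zero} {true ∷ S′} {false ∷ S} h (one o) (zero o′) = cong (1 ∷_) (cong val (zeros (ℕₚ.suc-injective h) o o′))
  where
  zeros : ∀ {C D} → length D ≡ length C → Ones 0 C → Ones 0 D → C ≡ D
  zeros _ [] [] = refl
  zeros h (zero p) (zero q) = cong (false ∷_) (zeros (ℕₚ.suc-injective h) p q)
val-Ones {suc i} h (one o) (one o′) = cong (1 ∷_) (val-Ones (ℕₚ.suc-injective h) o o′)

Ones-tail : ∀ {i S} → Ones i S → suc i < length S → at (val S) i ≡ 0 × at (val S) (suc i) ≡ 0
Ones-tail (zero (zero o)) _ = refl , refl
Ones-tail (zero []) (s≤s ())
Ones-tail (one o) (s≤s h) = Ones-tail o h

SwapColumn-Dom : ∀ {i C′ C} → SwapColumn i C′ C → ∀ {s B} → Dom s C′ B → Dom s C B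
SwapColumn-Dom (fix b) d = d
SwapColumn-Dom move (keep true (keep false d)) = up (down d)
SwapColumn-Dom move (keep true (up d)) = up (keep true d)
SwapColumn-Dom move (down (keep false d)) = keep false (down d)
SwapColumn-Dom move (down (up d)) = keep false (keep true d)
SwapColumn-Dom (there b sw) (keep .b d) = keep b (SwapColumn-Dom sw d)
SwapColumn-Dom (there .false sw) (up d) = up (SwapColumn-Dom sw d)
SwapColumn-Dom (there .true sw) (down d) = down (SwapColumn-Dom sw d)

-- The inequalities are chosen for the slices: if the second entry of `e′` is at least m, then both
-- entries of `e` are, while the sum of the two is unchanged. This places elements of M(w) in the
-- symmetric region that the operator produces.
record Raised (i : ℕ) (e e′ : Exp) : Set where
  constructor raised
  field
    off  : Off i e e′
    same : at e′ i + at e′ (suc i) ≡ at e i + at e (suc i)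
    ≤₁   : at e′ (suc i) ≤ at e i
    ≤₂   : at e′ (suc i) ≤ at e (suc i)

Raised-∷ : ∀ {i x e e′} → Raised i e e′ → Raised (suc i) (x ∷ e) (x ∷ e′)
Raised-∷ (raised o s p q) = raised (there o) s p q

raise : ∀ {i C′ C s B} → SwapColumn i C′ C → Dom s C B → ∃ λ B′ → Dom s C′ B′ × Raised i (val B) (val B′)
raise (fix b) d@(keep _ (keep true _)) = _ , d , diagonal b
  where
  diagonal : ∀ b {e} → Raised 0 (bit b ∷ bit b ∷ e) (bit b ∷ bit b ∷ e)
  diagonal b = raised here refl ℕₚ.≤-refl ℕₚ.≤-refl
raise (fix false) d@(keep _ (keep false _)) = _ , d , raised here refl z≤n z≤n
raise (fix false) (keep _ (up d)) = _ , up (keep false d) , raised here refl z≤n z≤n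
raise (fix false) d@(up (keep false _)) = _ , d , raised here refl z≤n z≤n
raise (fix false) d@(up (up _)) = _ , d , raised here refl ℕₚ.≤-refl ℕₚ.≤-refl
raise (fix true) d@(keep _ (down _)) = _ , d , raised here refl z≤n z≤n
raise (fix true) (down (keep .true d)) = _ , keep true (down d) , raised here refl z≤n z≤n
raise (fix true) d@(down (down _)) = _ , d , raised here refl z≤n z≤n
raise move (up (keep .true d)) = _ , keep true (up d) , raised here refl ℕₚ.≤-refl ℕₚ.≤-refl
raise move (up (down d)) = _ , keep true (keep false d) , raised here refl z≤n z≤n
raise move (keep .false (keep .true d)) = _ , keep true (keep false d) , raised here refl z≤n z≤n
raise move (keep .false (down d)) = _ , down (keep false d) , raised here refl z≤n z≤n
raise (there b sw) (keep .b d) with raise sw d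
... | B′ , d′ , r = b ∷ B′ , keep b d′ , Raised-∷ r
raise (there .false sw) (up d) with raise sw d
... | B′ , d′ , r = true ∷ B′ , up d′ , Raised-∷ r
raise (there .true sw) (down d) with raise sw d
... | B′ , d′ , r = false ∷ B′ , down d′ , Raised-∷ r

Raised-⊕ : ∀ {i u u′ v v′} → length u ≡ length v → length u′ ≡ length v′ →
  Raised i u u′ → Raised i v v′ → Raised i (u ⊕ v) (u′ ⊕ v′)
Raised-⊕ {i} {u} {u′} {v} {v′} h h′ r q = raised (Off-⊕ (Raised.off r) (Raised.off q))
  (begin
    at (u′ ⊕ v′) i + at (u′ ⊕ v′) (suc i) ≡⟨ cong₂ _+_ (at-⊕ u′ v′ i h′) (at-⊕ u′ v′ (suc i) h′) ⟩
    at u′ i + at v′ i + (at u′ (suc i) + at v′ (suc i)) ≡⟨ interchange (at u′ i) _ _ _ ⟩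
    at u′ i + at u′ (suc i) + (at v′ i + at v′ (suc i)) ≡⟨ cong₂ _+_ (Raised.same r) (Raised.same q) ⟩
    at u i + at u (suc i) + (at v i + at v (suc i)) ≡⟨ interchange (at u i) _ _ _ ⟩
    at u i + at v i + (at u (suc i) + at v (suc i)) ≡⟨ cong₂ _+_ (at-⊕ u v i h) (at-⊕ u v (suc i) h) ⟨
    at (u ⊕ v) i + at (u ⊕ v) (suc i) ∎)
  (ℕₚ.≤-trans (ℕₚ.≤-reflexive (at-⊕ u′ v′ (suc i) h′)) (ℕₚ.≤-trans (ℕₚ.+-mono-≤ (Raised.≤₁ r) (Raised.≤₁ q)) (ℕₚ.≤-reflexive (sym (at-⊕ u v i h)))))
  (ℕₚ.≤-trans (ℕₚ.≤-reflexive (at-⊕ u′ v′ (suc i) h′)) (ℕₚ.≤-trans (ℕₚ.+-mono-≤ (Raised.≤₂ r) (Raised.≤₂ q)) (ℕₚ.≤-reflexive (sym (at-⊕ u v (suc i) h)))))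
  where open ≡-Reasoning

private
  col-total-length : ∀ {n C B} Bs cs → length C ≡ n → HasLengths n cs → Dom 0 C B → Pointwise (Dom 0) cs Bs →
    length (val B) ≡ length (total n Bs)
  col-total-length {B = B} Bs cs h hs d ds = trans (val-length B) (trans (trans (Dom-length d) h) (sym (total-length Bs (Doms-lengths hs ds))))

  raise-all : ∀ {n i cs′ cs Bs} → suc i < n → HasLengths n cs′ → HasLengths n cs → Pointwise (SwapColumn i) cs′ cs → Pointwise (Dom 0) cs Bs →
    ∃ λ Bs′ → Pointwise (Dom 0) cs′ Bs′ × Raised i (total n Bs) (total n Bs′)
  raise-all {n} {i} i<n [] [] [] [] = [] , [] ,
    raised (Off-refl i (replicate n 0) (subst (suc i <_) (sym (Listₚ.length-replicate n)) i<n)) refl (ℕₚ.≤-reflexive (trans (at-replicate n (suc i)) (sym (at-replicate n i)))) ℕₚ.≤-refl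
  raise-all {Bs = _ ∷ Bs} i<n (h′ ∷ hs′) (h ∷ hs) (sw ∷ sws) (d ∷ ds) with raise sw d | raise-all i<n hs′ hs sws ds
  ... | B′ , d′ , r | Bs′ , ds′ , q = B′ ∷ Bs′ , d′ ∷ ds′ ,
    Raised-⊕ (col-total-length Bs _ h hs d ds) (col-total-length Bs′ _ h′ hs′ d′ ds′) r q

Step-raise : ∀ {n i cs′ cs e} → suc i < n → HasLengths n cs′ → HasLengths n cs → Step i cs′ cs → M n cs e →
  ∃ λ e′ → M n cs′ (bump i e′) × Raised i e e′
Step-raise {n} {i} i<n (h′ ∷ hs′) (h ∷ hs) (pivot {S′} {S} o′ o sws) (B ∷ Bs , d ∷ ds , refl)
  with Ones-unique o d | raise-all i<n hs′ hs sws ds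
... | refl | Bs′ , ds′ , r = val S ⊕ total n Bs′ ,
  (S′ ∷ Bs′ , Dom-refl S′ ∷ ds′ ,
    trans (bump-⊕ˡ i (val S) _) (cong (_⊕ total n Bs′) (sym (val-Ones (trans h (sym h′)) o′ o)))) ,
  Raised-⊕ (col-total-length Bs _ h hs d ds) (trans (trans (val-length S) h) (sym (total-length Bs′ (Doms-lengths hs′ ds′))))
    (raised (Off-refl i (val S) i<S) refl (ℕₚ.≤-reflexive (trans (proj₂ tails) (sym (proj₁ tails)))) ℕₚ.≤-refl) r
  where
  i<S = subst (suc i <_) (sym (trans (val-length S) h)) i<n
  tails = Ones-tail o (subst (suc i <_) (sym h) i<n)
Step-raise {n} {i} i<n (h′ ∷ hs′) (h ∷ hs) (sw ∷ st) (B ∷ Bs , d ∷ ds , refl)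
  with raise sw d | Step-raise i<n hs′ hs st (Bs , ds , refl)
... | B′ , d′ , r | e′ , (Bs′ , ds′ , eq) , q = val B′ ⊕ e′ ,
  (B′ ∷ Bs′ , d′ ∷ ds′ , trans (bump-⊕ʳ i (val B′) e′) (cong (val B′ ⊕_) eq)) ,
  Raised-⊕ (col-total-length Bs _ h hs d ds) (trans (trans (val-length B′) (trans (Dom-length d′) h′))
    (sym (trans (sym (bump-length i e′)) (trans (cong length eq) (total-length Bs′ (Doms-lengths hs′ ds′)))))) r q

record Lowered (i t : ℕ) (e e′ : Exp) : Set where
  constructor lowered
  field
    off   : Off i e e′
    fst≡ : at e′ i + t ≡ at e i
    snd≡ : at e′ (suc i) ≡ at e (suc i) + t

Lowered-refl : ∀ i e → suc i < length e → Lowered i 0 e e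
Lowered-refl i e h = lowered (Off-refl i e h) (ℕₚ.+-identityʳ _) (sym (ℕₚ.+-identityʳ _))

Lowered-∷ : ∀ {i t x e e′} → Lowered i t e e′ → Lowered (suc i) t (x ∷ e) (x ∷ e′)
Lowered-∷ (lowered o p q) = lowered (there o) p q

Lowered-⊕ : ∀ {i t t′ u u′ v v′} → length u ≡ length v → length u′ ≡ length v′ →
  Lowered i t u u′ → Lowered i t′ v v′ → Lowered i (t + t′) (u ⊕ v) (u′ ⊕ v′)
Lowered-⊕ {i} {t} {t′} {u} {u′} {v} {v′} h h′ (lowered o p q) (lowered o′ p′ q′) = lowered (Off-⊕ o o′)
  (begin
    at (u′ ⊕ v′) i + (t + t′) ≡⟨ cong (_+ (t + t′)) (at-⊕ u′ v′ i h′) ⟩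
    at u′ i + at v′ i + (t + t′) ≡⟨ interchange (at u′ i) _ _ _ ⟩
    at u′ i + t + (at v′ i + t′) ≡⟨ cong₂ _+_ p p′ ⟩
    at u i + at v i ≡⟨ at-⊕ u v i h ⟨
    at (u ⊕ v) i ∎)
  (begin
    at (u′ ⊕ v′) (suc i) ≡⟨ at-⊕ u′ v′ (suc i) h′ ⟩
    at u′ (suc i) + at v′ (suc i) ≡⟨ cong₂ _+_ q q′ ⟩
    at u (suc i) + t + (at v (suc i) + t′) ≡⟨ interchange (at u (suc i)) _ _ _ ⟩
    at u (suc i) + at v (suc i) + (t + t′) ≡⟨ cong (_+ (t + t′)) (at-⊕ u v (suc i) h) ⟨
    at (u ⊕ v) (suc i) + (t + t′) ∎)
  where open ≡-Reasoning

private
  LowerColumn : ℕ → Column → Column → ℕ → Set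
  LowerColumn i C B s = at (val B) i ≤ at (val B) (suc i) ⊎ ∃ λ B′ → Dom s C B′ × Lowered i 1 (val B) (val B′) × at (val B) i ≤ 1

  -- No column `C` of the lower diagram has, among rows i and i + 1, a box in row i alone. A box
  -- that `B` has only in row i can therefore move down one row without breaking domination.
  lower : ∀ {i C′ C s B} → SwapColumn i C′ C → Dom s C B → LowerColumn i C B s
  lower (fix b) (keep .b (keep .b d)) = inj₁ ℕₚ.≤-refl
  lower (fix false) (keep .false (up d)) = inj₁ z≤n
  lower (fix true) (keep .true (down d)) = inj₂ (_ , down (keep true d) , lowered here refl refl , ℕₚ.≤-refl)
  lower (fix false) (up (keep .false d)) = inj₂ (_ , keep false (up d) , lowered here refl refl , ℕₚ.≤-refl)
  lower (fix false) (up (up d)) = inj₁ ℕₚ.≤-refl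
  lower (fix true) (down (keep .true d)) = inj₁ z≤n
  lower (fix true) (down (down d)) = inj₁ ℕₚ.≤-refl
  lower move (keep .false (keep .true d)) = inj₁ z≤n
  lower move (keep .false (down d)) = inj₁ ℕₚ.≤-refl
  lower move (up (keep .true d)) = inj₁ ℕₚ.≤-refl
  lower move (up (down d)) = inj₂ (_ , keep false (keep true d) , lowered here refl refl , ℕₚ.≤-refl)
  lower (there b sw) (keep .b d) with lower sw d
  ... | inj₁ h = inj₁ h
  ... | inj₂ (B′ , d′ , l , h) = inj₂ (_ , keep b d′ , Lowered-∷ l , h)
  lower (there .false sw) (up d) with lower sw d
  ... | inj₁ h = inj₁ h
  ... | inj₂ (B′ , d′ , l , h) = inj₂ (_ , up d′ , Lowered-∷ l , h)
  lower (there .true sw) (down d) with lower sw d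
  ... | inj₁ h = inj₁ h
  ... | inj₂ (B′ , d′ , l , h) = inj₂ (_ , down d′ , Lowered-∷ l , h)

-- Up to the difference of the two entries, each unit can be moved in a column of its own.
Lowering : ℕ → ℕ → List Column → Exp → Set
Lowering n i cs e = ∀ t → t + at e (suc i) ≤ at e i → ∃ λ e′ → M n cs e′ × Lowered i t e e′

private
  -- A column of the first kind adds nothing to the surplus of entry i over entry i + 1, so the
  -- other columns can supply all t units. A column of the second kind supplies one unit itself; as
  -- its entry i is at most 1, the others can supply the remaining t - 1.
  ⊕-Lowering : ∀ {n i C cs B e} → suc i < n → length C ≡ n → HasLengths n cs → Dom 0 C B → LowerColumn i C B 0 →
    M n cs e → Lowering n i cs e → Lowering n i (C ∷ cs) (val B ⊕ e)
  ⊕-Lowering {n} {i} {C} {cs} {B} {e} i<n h hs d lc (Bs , ds , refl) lows t le = move′ lc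
    where
    |B| = trans (val-length B) (trans (Dom-length d) h)
    i<B = subst (suc i <_) (sym |B|) i<n
    |e| = total-length Bs (Doms-lengths hs ds)
    |Be| = trans |B| (sym |e|)
    le′ : t + (at (val B) (suc i) + at e (suc i)) ≤ at (val B) i + at e i
    le′ = ℕₚ.≤-trans (ℕₚ.≤-reflexive (cong (t +_) (sym (at-⊕ (val B) e (suc i) |Be|)))) (ℕₚ.≤-trans le (ℕₚ.≤-reflexive (at-⊕ (val B) e i |Be|)))
    swap-sum : ∀ a b c → a + (b + c) ≡ b + (a + c)
    swap-sum = ℕsolve-∀
    keep-B : t + at e (suc i) ≤ at e i → ∃ λ e′ → M n (C ∷ cs) e′ × Lowered i t (val B ⊕ e) e′
    keep-B le″ with lows t le″
    ... | e′ , (Bs′ , ds′ , refl) , l = val B ⊕ e′ , (B ∷ Bs′ , d ∷ ds′ , refl) ,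
      Lowered-⊕ {t = 0} |Be| (trans |B| (sym (total-length Bs′ (Doms-lengths hs ds′)))) (Lowered-refl i (val B) i<B) l
    move′ : LowerColumn i C B 0 → ∃ λ e′ → M n (C ∷ cs) e′ × Lowered i t (val B ⊕ e) e′
    move′ (inj₁ B≤) = keep-B (ℕₚ.+-cancelˡ-≤ (at (val B) i) _ _
      (ℕₚ.≤-trans (ℕₚ.+-monoˡ-≤ _ B≤) (ℕₚ.≤-trans (ℕₚ.≤-reflexive (swap-sum (at (val B) (suc i)) t (at e (suc i)))) le′)))
    move′ (inj₂ (B′ , d′ , l , B≤1)) = shift t le′
      where
      shift : ∀ t → t + (at (val B) (suc i) + at e (suc i)) ≤ at (val B) i + at e i →
        ∃ λ e′ → M n (C ∷ cs) e′ × Lowered i t (val B ⊕ e) e′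
      shift zero _ = val B ⊕ e , (B ∷ Bs , d ∷ ds , refl) ,
        Lowered-refl i (val B ⊕ e) (subst (suc i <_) (sym (⊕-length (val B) e |B| |e|)) i<n)
      shift (suc t) le″ with lows t (ℕₚ.+-cancelˡ-≤ 1 _ _
        (ℕₚ.≤-trans (ℕₚ.+-monoʳ-≤ (suc t) (ℕₚ.m≤n+m _ _)) (ℕₚ.≤-trans le″ (ℕₚ.+-monoˡ-≤ _ B≤1))))
      ... | e′ , (Bs′ , ds′ , refl) , l′ = val B′ ⊕ e′ , (B′ ∷ Bs′ , d′ ∷ ds′ , refl) ,
        Lowered-⊕ {t = 1} |Be| (trans (trans (val-length B′) (trans (Dom-length d′) h)) (sym (total-length Bs′ (Doms-lengths hs ds′)))) l l′

  lower-all : ∀ {n i cs′ cs} Bs → suc i < n → HasLengths n cs → Pointwise (SwapColumn i) cs′ cs → Pointwise (Dom 0) cs Bs →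
    Lowering n i cs (total n Bs)
  lower-all {n} {i} [] i<n [] [] [] t le = replicate n 0 , ([] , [] , refl) , subst (λ t → Lowered i t (replicate n 0) (replicate n 0)) (sym t≡0)
    (Lowered-refl i (replicate n 0) (subst (suc i <_) (sym (Listₚ.length-replicate n)) i<n))
    where
    t≡0 : t ≡ 0
    t≡0 = ℕₚ.n≤0⇒n≡0 (ℕₚ.≤-trans (ℕₚ.m≤m+n t _) (ℕₚ.≤-trans le (ℕₚ.≤-reflexive (at-replicate n i))))
  lower-all (B ∷ Bs) i<n (h ∷ hs) (sw ∷ sws) (d ∷ ds) =
    ⊕-Lowering i<n h hs d (lower sw d) (Bs , ds , refl) (lower-all Bs i<n hs sws ds)

  SwapColumn-Doms : ∀ {i cs′ cs Bs} → Pointwise (SwapColumn i) cs′ cs → Pointwise (Dom 0) cs′ Bs → Pointwise (Dom 0) cs Bs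
  SwapColumn-Doms [] [] = []
  SwapColumn-Doms (sw ∷ sws) (d ∷ ds) = SwapColumn-Dom sw d ∷ SwapColumn-Doms sws ds

-- An initial segment dominates only itself as a summand, so the pivot column contributes a box in
-- row i to every element of M for w′; this box is the bump. In the other columns, whatever
-- dominates `C′` also dominates `C`.
Step-lower : ∀ {n i cs′ cs e′} → suc i < n → HasLengths n cs′ → HasLengths n cs → Step i cs′ cs → M n cs′ e′ →
  ∃ λ e → bump i e ≡ e′ × M n cs e × Lowering n i cs e
Step-lower {n} {i} i<n (h′ ∷ hs′) (h ∷ hs) (pivot {S′} {S} o′ o sws) (B ∷ Bs , d ∷ ds , refl) with Ones-unique o′ d
... | refl = val S ⊕ total n Bs ,
  trans (bump-⊕ˡ i (val S) _) (cong (_⊕ total n Bs) (sym (val-Ones (trans h (sym h′)) o′ o))) ,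
  (S ∷ Bs , Dom-refl S ∷ ds′ , refl) ,
  ⊕-Lowering i<n h hs (Dom-refl S) (inj₁ (ℕₚ.≤-reflexive (trans (proj₁ tails) (sym (proj₂ tails))))) (Bs , ds′ , refl) (lower-all Bs i<n hs sws ds′)
  where
  ds′ = SwapColumn-Doms sws ds
  tails = Ones-tail o (subst (suc i <_) (sym h) i<n)
Step-lower {n} {i} i<n (h′ ∷ hs′) (h ∷ hs) (sw ∷ st) (B ∷ Bs , d ∷ ds , refl) with Step-lower i<n hs′ hs st (Bs , ds , refl)
... | e , eq , (Bs₀ , ds₀ , eq₀) , lows = val B ⊕ e , trans (bump-⊕ʳ i (val B) e) (cong (val B ⊕_) eq) ,
  (B ∷ Bs₀ , d₀ ∷ ds₀ , cong (val B ⊕_) eq₀) ,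
  ⊕-Lowering i<n h hs d₀ (lower sw d₀) (Bs₀ , ds₀ , eq₀) lows
  where d₀ = SwapColumn-Dom sw d

-- Two-variable slices of the operator f ↦ ∂ᵢ((1 − xᵢ₊₁) f)

δ-cong-diagonal : ∀ {f g} a b → (∀ x y → x + y ≡ suc (a + b) → f x y ≡ g x y) → δ f a b ≡ δ g a b
δ-cong-diagonal zero b h = cong₂ _-ᶻ_ (h (suc b) 0 (ℕₚ.+-identityʳ _)) (h 0 (suc b) refl)
δ-cong-diagonal (suc a) b h = cong₂ _+ᶻ_
  (δ-cong-diagonal a (suc b) (λ x y eq → h x y (trans eq (cong suc (ℕₚ.+-suc a b)))))
  (cong₂ _-ᶻ_ (h (suc b) (suc a) (cong suc (ℕₚ.+-comm b (suc a)))) (h (suc a) (suc b) (cong suc (ℕₚ.+-suc a b))))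

τ : (ℕ → ℕ → ℤ) → ℕ → ℕ → ℤ
τ f = δ (λ x y → f x y -ᶻ y· f x y)

corner : ℕ → ℕ → ℕ → ℕ → ℕ → ℤ
corner l m d x y with l ℕ.≤? x | m ℕ.≤? y | d ℕ.≤? x + y
... | yes _ | yes _ | yes _ = 1ℤ
... | _     | _     | _     = 0ℤ

corner-in : ∀ {l m d x y} → l ≤ x → m ≤ y → d ≤ x + y → corner l m d x y ≡ 1ℤ
corner-in {l} {m} {d} {x} {y} p q r with l ℕ.≤? x | m ℕ.≤? y | d ℕ.≤? x + y
... | yes _ | yes _ | yes _ = refl
... | no ¬p | _     | _     = ⊥-elim (¬p p)
... | yes _ | no ¬q | _     = ⊥-elim (¬q q)
... | yes _ | yes _ | no ¬r = ⊥-elim (¬r r)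

corner-out : ∀ {l m d x y} → ¬ (l ≤ x × m ≤ y × d ≤ x + y) → corner l m d x y ≡ 0ℤ
corner-out {l} {m} {d} {x} {y} h with l ℕ.≤? x | m ℕ.≤? y | d ℕ.≤? x + y
... | yes p | yes q | yes r = ⊥-elim (h (p , q , r))
... | no _  | _     | _     = refl
... | yes _ | no _  | _     = refl
... | yes _ | yes _ | no _  = refl

corner-⇔ : ∀ {l m d x y l′ m′ d′ x′ y′} →
  (l ≤ x × m ≤ y × d ≤ x + y → l′ ≤ x′ × m′ ≤ y′ × d′ ≤ x′ + y′) →
  (l′ ≤ x′ × m′ ≤ y′ × d′ ≤ x′ + y′ → l ≤ x × m ≤ y × d ≤ x + y) →
  corner l m d x y ≡ corner l′ m′ d′ x′ y′
corner-⇔ {l} {m} {d} {x} {y} f g with l ℕ.≤? x | m ℕ.≤? y | d ℕ.≤? x + y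
... | yes p | yes q | yes r = let (p′ , q′ , r′) = f (p , q , r) in sym (corner-in p′ q′ r′)
... | no ¬p | _     | _     = sym (corner-out (λ t → ¬p (proj₁ (g t))))
... | yes _ | no ¬q | _     = sym (corner-out (λ t → ¬q (proj₁ (proj₂ (g t)))))
... | yes _ | yes _ | no ¬r = sym (corner-out (λ t → ¬r (proj₂ (proj₂ (g t)))))

τ-cong : ∀ {f g} → (∀ x y → f x y ≡ g x y) → ∀ a b → τ f a b ≡ τ g a b
τ-cong {f} {g} h = δ-cong (λ { x zero → cong (_-ᶻ 0ℤ) (h x 0) ; x (suc y) → cong₂ _-ᶻ_ (h x (suc y)) (h x y) })

τ-x· : ∀ f a b → τ (x· f) a b ≡ y· (τ f) a b +ᶻ (f a b -ᶻ y· f a b)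
τ-x· f a b = trans (δ-cong commute a b) (δ-x· _ a b)
  where
  commute : ∀ x y → x· f x y -ᶻ y· (x· f) x y ≡ x· (λ x y → f x y -ᶻ y· f x y) x y
  commute zero zero = refl
  commute zero (suc y) = refl
  commute (suc x) zero = refl
  commute (suc x) (suc y) = refl

-- A symmetric series passes through ∂, and ∂(x (1 - y)) = ∂ x - ∂(x y) = 1, as x y is symmetric
-- too.
τ-symmetric : ∀ f → (∀ x y → f x y ≡ f y x) → ∀ a b → τ (x· f) a b ≡ f a b
τ-symmetric f h a b = begin
  δ (λ x y → x· f x y -ᶻ y· (x· f) x y) a b ≡⟨ δ-minus (x· f) (y· (x· f)) a b ⟩
  δ (x· f) a b -ᶻ δ (y· (x· f)) a b          ≡⟨ cong₂ _-ᶻ_ (δ-x· f a b) (δ-symmetric≡0 sym-xy a b) ⟩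
  (y· (δ f) a b +ᶻ f a b) -ᶻ 0ℤ              ≡⟨ cong (λ t → (t +ᶻ f a b) -ᶻ 0ℤ) (vanish b) ⟩
  (0ℤ +ᶻ f a b) -ᶻ 0ℤ                        ≡⟨ trans (ℤₚ.+-identityʳ _) (ℤₚ.+-identityˡ _) ⟩
  f a b ∎
  where
  open ≡-Reasoning
  sym-xy : ∀ x y → y· (x· f) x y ≡ y· (x· f) y x
  sym-xy zero zero = refl
  sym-xy zero (suc y) = refl
  sym-xy (suc x) zero = refl
  sym-xy (suc x) (suc y) = h x y
  vanish : ∀ b → y· (δ f) a b ≡ 0ℤ
  vanish zero = refl
  vanish (suc b) = δ-symmetric≡0 h a b

τ-near-diagonal : ∀ l d a b → τ (corner (suc l) l (suc d)) a b ≡ corner l l d a b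
τ-near-diagonal l d a b = trans (τ-cong shift a b) (τ-symmetric (corner l l d) symmetric a b)
  where
  shift : ∀ x y → corner (suc l) l (suc d) x y ≡ x· (corner l l d) x y
  shift zero y = corner-out {suc l} {l} {suc d} {0} {y} λ { (() , _) }
  shift (suc x) y = corner-⇔ (λ { (s≤s p , q , s≤s r) → p , q , r }) (λ { (p , q , r) → s≤s p , q , s≤s r })
  symmetric : ∀ x y → corner l l d x y ≡ corner l l d y x
  symmetric x y = corner-⇔ (λ (p , q , r) → q , p , subst (d ≤_) (ℕₚ.+-comm x y) r)
                           (λ (p , q , r) → q , p , subst (d ≤_) (ℕₚ.+-comm y x) r)

-- With d = l + m the condition on x + y is redundant and the slice is a quadrant. Induction on l -
-- m: by `τ-x·`, one more factor x shifts the resulting region up by one row and adds (1 - y) f,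
-- which is exactly the bottom row y = m that the shift leaves open.
τ-point : ∀ l m a b → m ≤ l → τ (corner (suc l) m (suc (l + m))) a b ≡ corner m m (l + m) a b
τ-point l m a b m≤l = subst (λ l → ∀ a b → τ (corner (suc l) m (suc (l + m))) a b ≡ corner m m (l + m) a b)
  (ℕₚ.m∸n+n≡m m≤l) (go (l ∸ m)) a b
  where
  go : ∀ t a b → τ (corner (suc (t + m)) m (suc (t + m + m))) a b ≡ corner m m (t + m + m) a b
  go zero a b = τ-near-diagonal m (m + m) a b
  go (suc t) a b = trans (τ-cong shift a b) (trans (τ-x· _ a b) (combine b))
    where
    L = suc (t + m)
    f = corner L m (suc (t + m + m))
    shift : ∀ x y → corner (suc L) m (suc (L + m)) x y ≡ x· f x y
    shift zero y = corner-out {suc L} {m} {suc (L + m)} {0} {y} λ { (() , _) }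
    shift (suc x) y = corner-⇔ (λ { (s≤s p , q , s≤s r) → p , q , r }) (λ { (p , q , r) → s≤s p , q , s≤s r })
    m≤L : m ≤ L
    m≤L = ℕₚ.≤-trans (ℕₚ.m≤n+m m t) (ℕₚ.n≤1+n _)
    redundant : ∀ {x y} → L ≤ x → m ≤ y → L + m ≤ x + y
    redundant p q = ℕₚ.+-mono-≤ p q
    bottom : ∀ y → ¬ suc m ≤ y → corner L m (L + m) a y ≡ corner m m (L + m) a y
    bottom y ≮ = corner-⇔ (λ (p , q , r) → ℕₚ.≤-trans m≤L p , q , r)
      (λ (p , q , r) → ℕₚ.+-cancelʳ-≤ m L a (ℕₚ.≤-trans r (ℕₚ.+-monoʳ-≤ a (ℕ.s≤s⁻¹ (ℕₚ.≰⇒> ≮)))) , q , r)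
    combine : ∀ b → y· (τ f) a b +ᶻ (f a b -ᶻ y· f a b) ≡ corner m m (L + m) a b
    combine zero = trans (ℤₚ.+-identityˡ _) (trans (ℤₚ.+-identityʳ _) (bottom 0 λ ()))
    combine (suc b) = split (m ℕ.≤? b)
      where
      same : m ≤ b → f a (suc b) ≡ f a b
      same m≤b = corner-⇔ (λ (p , q , r) → p , m≤b , redundant p m≤b) (λ (p , q , r) → p , ℕₚ.m≤n⇒m≤1+n q , redundant p (ℕₚ.m≤n⇒m≤1+n q))
      split : Dec (m ≤ b) → y· (τ f) a (suc b) +ᶻ (f a (suc b) -ᶻ y· f a (suc b)) ≡ corner m m (L + m) a (suc b)
      split (yes m≤b) = trans (cong₂ (λ u v → u +ᶻ (v -ᶻ f a b)) (go t a b) (same m≤b))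
        (trans (cong (corner m m (t + m + m) a b +ᶻ_) (ℤₚ.i≡j⇒i-j≡0 {f a b} refl)) (trans (ℤₚ.+-identityʳ _)
        (corner-⇔ (λ (p , q , r) → p , ℕₚ.m≤n⇒m≤1+n m≤b , ℕₚ.≤-trans (s≤s r) (ℕₚ.≤-reflexive (sym (ℕₚ.+-suc a b))))
        (λ (p , q , r) → p , m≤b , ℕ.s≤s⁻¹ (ℕₚ.≤-trans r (ℕₚ.≤-reflexive (ℕₚ.+-suc a b)))))))
      split (no m≰b) = trans (cong₂ (λ u v → u +ᶻ (f a (suc b) -ᶻ v)) (trans (go t a b) (corner-out (λ (_ , q , _) → m≰b q))) (corner-out (λ (_ , q , _) → m≰b q)))
        (trans (ℤₚ.+-identityˡ _) (trans (ℤₚ.+-identityʳ _) (bottom (suc b) (λ { (s≤s q) → m≰b q }))))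

-- The slice condition forced by multiplicity-freeness: an interval on an antidiagonal
-- has a divided difference bounded by 1 only if it is a point or reaches next to the diagonal.
interval-condition : ∀ (f g : ℕ → ℕ → ℤ) l m d → suc l + m ≤ suc d →
  (∀ a b → a + b ≡ d → g a b ≡ δ f a b) →
  (∀ a b → a + b ≡ d → 0ℤ ≤ᶻ g a b) → (∀ a b → a + b ≡ d → g a b ≤ᶻ 1ℤ) →
  (∀ a b → a + b ≡ d → f (suc a) b ≤ᶻ g a b) →
  (∀ x y → x + y ≡ suc d → suc l ≤ x → m ≤ y → f x y ≡ 1ℤ) →
  (∀ x y → ¬ (suc l ≤ x × m ≤ y) → f x y ≡ 0ℤ) →
  m ≤ l × (l ≡ m ⊎ d ≡ l + m)
interval-condition f g l m d (s≤s l+m≤d) g≡δ g≥0 g≤1 f≤g f-in f-out = m≤l , cases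
  where
  absurd : ¬ (1ℤ ≤ᶻ 0ℤ)
  absurd (ℤ.+≤+ ())
  m≤l : m ≤ l
  m≤l with m ℕ.≤? l
  ... | yes p = p
  -- If l < m, no point with a coordinate at most l lies in the region, so the divided difference
  -- vanishes at (l, d - l). Yet it is bounded below there by the coefficient of `f` at (l + 1, d -
  -- l), which is 1.
  ... | no m≰l = ⊥-elim (absurd (ℤₚ.≤-trans (ℤₚ.≤-reflexive (sym f≡1)) (ℤₚ.≤-trans (f≤g l (d ∸ l) l+) (ℤₚ.≤-reflexive (trans (g≡δ l (d ∸ l) l+) (below l (d ∸ l) ℕₚ.≤-refl))))))
    where
    l+ : l + (d ∸ l) ≡ d
    l+ = ℕₚ.m+[n∸m]≡n (ℕₚ.≤-trans (ℕₚ.m≤m+n l m) l+m≤d)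
    f≡1 : f (suc l) (d ∸ l) ≡ 1ℤ
    f≡1 = f-in (suc l) (d ∸ l) (cong suc l+) ℕₚ.≤-refl (ℕₚ.m+n≤o⇒m≤o∸n m (subst (_≤ d) (ℕₚ.+-comm l m) l+m≤d))
    below : ∀ a b → a ≤ l → δ f a b ≡ 0ℤ
    below zero b a≤l = cong₂ _-ᶻ_ (f-out (suc b) 0 (λ (_ , q) → m≰l (ℕₚ.≤-trans q z≤n))) (f-out 0 (suc b) (λ { (() , _) }))
    below (suc a) b a≤l = cong₂ _+ᶻ_ (below a (suc b) (ℕₚ.<⇒≤ a≤l)) (cong₂ _-ᶻ_
      (f-out (suc b) (suc a) (λ (_ , q) → m≰l (ℕₚ.≤-trans q a≤l)))
      (f-out (suc a) (suc b) (λ { (s≤s p , _) → ℕₚ.<⇒≱ a≤l p })))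
  -- The points (k + 2, m) and (k + 1, m + 1) both lie in the interval and their mirror images do
  -- not, so each adds 1 to the coefficient at (m + 1, k). What is accumulated before them is itself
  -- a coefficient of `g`, or empty, hence nonnegative.
  twice : ∀ k → suc m ≤ l → l + suc m ≤ d → k + suc m ≡ d → ⊥
  twice k m<l l+m<d eq = absurd (≤-cancel (ℤₚ.≤-trans two (g≤1 (suc m) k (trans (ℕₚ.+-comm (suc m) k) eq))))
    where
    l≤k : l ≤ k
    l≤k = ℕₚ.+-cancelʳ-≤ (suc m) l k (ℕₚ.≤-trans l+m<d (ℕₚ.≤-reflexive (sym eq)))
    eq₁ : m + suc k ≡ d
    eq₁ = trans (ℕₚ.+-suc m k) (trans (ℕₚ.+-comm (suc m) k) eq)
    ≤-cancel : 1ℤ +ᶻ 1ℤ ≤ᶻ 1ℤ → 1ℤ ≤ᶻ 0ℤ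
    ≤-cancel (ℤ.+≤+ (s≤s ()))
    nonneg-pred : ∀ m′ → suc m′ ≡ m → 0ℤ ≤ᶻ δ f m′ (suc (suc k))
    nonneg-pred m′ refl = subst (0ℤ ≤ᶻ_) (g≡δ m′ (suc (suc k)) (trans (ℕₚ.+-suc m′ (suc k)) eq₁)) (g≥0 m′ (suc (suc k)) (trans (ℕₚ.+-suc m′ (suc k)) eq₁))
    one′ : ∀ m′ → m′ ≡ m → 1ℤ ≤ᶻ δ f m′ (suc k)
    one′ zero eq′ = ℤₚ.≤-reflexive (sym (cong₂ _-ᶻ_
      (f-in (suc (suc k)) 0 (trans (ℕₚ.+-identityʳ _) (cong suc (trans (cong (_+ suc k) eq′) eq₁))) (s≤s (ℕₚ.m≤n⇒m≤1+n l≤k)) (ℕₚ.≤-reflexive (sym eq′)))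
      (f-out 0 (suc (suc k)) (λ { (() , _) }))))
    one′ (suc m′) refl = ℤₚ.≤-trans (ℤₚ.+-mono-≤ (nonneg-pred m′ refl) (ℤₚ.≤-refl {1ℤ}))
      (ℤₚ.≤-reflexive (cong (δ f m′ (suc (suc k)) +ᶻ_) (sym (cong₂ _-ᶻ_
        (f-in (suc (suc k)) (suc m′) (cong suc (trans (ℕₚ.+-comm (suc k) (suc m′)) eq₁)) (s≤s (ℕₚ.m≤n⇒m≤1+n l≤k)) ℕₚ.≤-refl)
        (f-out (suc m′) (suc (suc k)) (λ { (s≤s p , _) → ℕₚ.<⇒≱ m<l (ℕₚ.m≤n⇒m≤1+n p) }))))))
    two : 1ℤ +ᶻ 1ℤ ≤ᶻ g (suc m) k
    two = ℤₚ.≤-trans (ℤₚ.+-monoˡ-≤ 1ℤ (one′ m refl)) (ℤₚ.≤-reflexive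
      (trans (cong (δ f m (suc k) +ᶻ_) (sym (cong₂ _-ᶻ_
        (f-in (suc k) (suc m) (cong suc eq) (s≤s l≤k) (ℕₚ.n≤1+n m))
        (f-out (suc m) (suc k) (λ { (s≤s p , _) → ℕₚ.<⇒≱ m<l p })))))
      (sym (g≡δ (suc m) k (trans (ℕₚ.+-comm (suc m) k) eq)))))
  cases : l ≡ m ⊎ d ≡ l + m
  cases with l ℕ.≟ m | d ℕ.≟ l + m
  ... | yes p | _ = inj₁ p
  ... | no _ | yes q = inj₂ q
  ... | no p | no q = ⊥-elim (twice (d ∸ suc m) m<l l+m<d (ℕₚ.m∸n+n≡m (ℕₚ.≤-trans (ℕₚ.m≤n+m (suc m) l) l+m<d)))
    where
    m<l = ℕₚ.≤∧≢⇒< m≤l (λ eq → p (sym eq))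
    l+m<d = ℕₚ.≤-trans (ℕₚ.≤-reflexive (ℕₚ.+-suc l m)) (ℕₚ.≤∧≢⇒< l+m≤d (λ eq → q (sym eq)))

-- Slices of the upward closure of M

infix 4 _≤ₑ_
_≤ₑ_ : Exp → Exp → Set
_≤ₑ_ = Pointwise ℕ._≤_

Up : ℕ → List Column → Exp → Set
Up n cs e = ∃ λ α → M n cs α × α ≤ₑ e

at₁ : ∀ pre {i x y post} → length pre ≡ i → at (pre ++ x ∷ y ∷ post) i ≡ x
at₁ [] refl = refl
at₁ (_ ∷ pre) refl = at₁ pre refl

at₂ : ∀ pre {i x y post} → length pre ≡ i → at (pre ++ x ∷ y ∷ post) (suc i) ≡ y
at₂ [] refl = refl
at₂ (_ ∷ pre) refl = at₂ pre refl

bump₁ : ∀ pre {i x y post} → length pre ≡ i → bump i (pre ++ x ∷ y ∷ post) ≡ pre ++ suc x ∷ y ∷ post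
bump₁ [] refl = refl
bump₁ (p ∷ pre) refl = cong (p ∷_) (bump₁ pre refl)

bump₂ : ∀ pre {i x y post} → length pre ≡ i → bump (suc i) (pre ++ x ∷ y ∷ post) ≡ pre ++ x ∷ suc y ∷ post
bump₂ [] refl = refl
bump₂ (p ∷ pre) refl = cong (p ∷_) (bump₂ pre refl)

≤ₑ-length : ∀ {e f} → e ≤ₑ f → length e ≡ length f
≤ₑ-length = Pointwise.Pointwise-length

≤ₑ-trans : ∀ {e f g} → e ≤ₑ f → f ≤ₑ g → e ≤ₑ g
≤ₑ-trans = Pointwise.transitive ℕₚ.≤-trans

≤ₑ-refl : ∀ {e} → e ≤ₑ e
≤ₑ-refl = Pointwise.refl ℕₚ.≤-refl

≤ₑ-split : ∀ P {a b Q α} → α ≤ₑ P ++ a ∷ b ∷ Q →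
  ∃ λ pre → ∃ λ x → ∃ λ y → ∃ λ post → α ≡ pre ++ x ∷ y ∷ post × pre ≤ₑ P × x ≤ a × y ≤ b × post ≤ₑ Q
≤ₑ-split [] (p ∷ q ∷ r) = [] , _ , _ , _ , refl , [] , p , q , r
≤ₑ-split (_ ∷ P) (p ∷ r) with ≤ₑ-split P r
... | pre , x , y , post , refl , s , p′ , q′ , t = _ ∷ pre , x , y , post , refl , p ∷ s , p′ , q′ , t

≤ₑ-join : ∀ {P a b Q pre x y post} → pre ≤ₑ P → x ≤ a → y ≤ b → post ≤ₑ Q → pre ++ x ∷ y ∷ post ≤ₑ P ++ a ∷ b ∷ Q
≤ₑ-join p q r s = Pointwise.++⁺ p (q ∷ r ∷ s)

split-at : ∀ i (e : Exp) → suc i < length e → ∃ λ P → ∃ λ a → ∃ λ b → ∃ λ Q → e ≡ P ++ a ∷ b ∷ Q × length P ≡ i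
split-at zero (a ∷ b ∷ e) _ = [] , a , b , e , refl , refl
split-at zero (a ∷ []) (s≤s ())
split-at (suc i) (x ∷ e) (s≤s h) with split-at i e h
... | P , a , b , Q , eq , refl = x ∷ P , a , b , Q , cong (x ∷_) eq , refl

Off-split : ∀ pre {i x y post e} → length pre ≡ i → Off i (pre ++ x ∷ y ∷ post) e →
  ∃ λ p → ∃ λ q → e ≡ pre ++ p ∷ q ∷ post
Off-split [] refl here = _ , _ , refl
Off-split (z ∷ pre) refl (there o) with Off-split pre refl o
... | p , q , refl = p , q , refl

bump-≤ₑ : ∀ j {e f} → e ≤ₑ f → at e j < at f j → bump j e ≤ₑ f
bump-≤ₑ zero (p ∷ r) lt = lt ∷ r
bump-≤ₑ (suc j) (p ∷ r) lt = p ∷ bump-≤ₑ j r lt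
bump-≤ₑ j [] ()

-- Where the unit lands: at the first distinguished position, at the second, or in the context.
locate : ∀ {pre pre′ P post post′ Q x y x′ y′} → pre ≤ₑ P → pre′ ≤ₑ P → post ≤ₑ Q → post′ ≤ₑ Q →
  ∀ j u v → at (pre′ ++ x′ ∷ y′ ∷ post′) j < at (pre ++ x ∷ y ∷ post) j →
  (x′ < x × bump j (pre′ ++ u ∷ v ∷ post′) ≡ pre′ ++ suc u ∷ v ∷ post′) ⊎
  (y′ < y × bump j (pre′ ++ u ∷ v ∷ post′) ≡ pre′ ++ u ∷ suc v ∷ post′) ⊎
  ∃ λ pre″ → ∃ λ post″ → pre″ ≤ₑ P × post″ ≤ₑ Q × bump j (pre′ ++ u ∷ v ∷ post′) ≡ pre″ ++ u ∷ v ∷ post″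
locate [] [] r r′ zero u v lt = inj₁ (lt , refl)
locate [] [] r r′ (suc zero) u v lt = inj₂ (inj₁ (lt , refl))
locate [] [] r r′ (suc (suc j)) u v lt =
  inj₂ (inj₂ ([] , _ , [] , bump-≤ₑ j r′ (ℕₚ.<-≤-trans lt (at-mono j r)) , refl))
  where
  at-mono : ∀ j {e f} → e ≤ₑ f → at e j ≤ at f j
  at-mono j [] = z≤n
  at-mono zero (p ∷ _) = p
  at-mono (suc j) (_ ∷ r) = at-mono j r
locate (p ∷ s) (p′ ∷ s′) r r′ zero u v lt = inj₂ (inj₂ (_ , _ , ℕₚ.<-≤-trans lt p ∷ s′ , r′ , refl))
locate (p ∷ s) (_∷_ {x = c} p′ s′) r r′ (suc j) u v lt with locate s s′ r r′ j u v lt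
... | inj₁ (h , eq) = inj₁ (h , cong (c ∷_) eq)
... | inj₂ (inj₁ (h , eq)) = inj₂ (inj₁ (h , cong (c ∷_) eq))
... | inj₂ (inj₂ (_ , _ , s″ , r″ , eq)) = inj₂ (inj₂ (_ , _ , p′ ∷ s″ , r″ , cong (c ∷_) eq))

-- `R` will quantify over all members of M below a context and is not decided. A least witness under
-- double negation is enough, because the goals it serves are stable.
¬¬-minimum : ∀ {R : ℕ → Set} {k} → R k → ¬ ¬ (∃ λ m → R m × ∀ j → j < m → ¬ R j)
¬¬-minimum {R} {k} rk ¬min = none-below (suc k) k ℕₚ.≤-refl rk
  where
  none-below : ∀ k j → j < k → ¬ R j
  none-below (suc k) j (s≤s j≤k) rj = ¬min (j , rj , λ i i<j → none-below k i (ℕₚ.<-≤-trans i<j j≤k))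

module Slices {n i : ℕ} {cs′ cs : List Column} (i<n : suc i < n) (hs′ : HasLengths n cs′) (hs : HasLengths n cs) (st : Step i cs′ cs) where

  Within : Exp → Exp → ℕ → ℕ → Set
  Within P Q x y = ∃ λ pre → ∃ λ post → pre ≤ₑ P × post ≤ₑ Q × M n cs′ (pre ++ x ∷ y ∷ post)

  -- The slice at the context (P, Q) is {x > l, y ≥ m, x + y > d}, and its minimal elements all
  -- lie in M with one and the same context.
  record Slice (P Q : Exp) : Set where
    field
      l m d : ℕ
      pre post : Exp
      pre≤ : pre ≤ₑ P
      post≤ : post ≤ₑ Q
      bounds : ∀ {x y} → Within P Q x y → suc l ≤ x × m ≤ y × suc d ≤ x + y
      attained : ∀ x y → x + y ≡ suc d → suc l ≤ x → m ≤ y → M n cs′ (pre ++ x ∷ y ∷ post)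
      nonempty : suc l + m ≤ suc d

  positive : ∀ {P Q x y} → length P ≡ i → Within P Q x y → 1 ≤ x
  positive {x = x} h (pre , post , p , q , mem) with Step-lower i<n hs′ hs st mem
  ... | e , eq , mem′ , _ = subst (1 ≤_)
    (trans (sym (at-bump i e (ℕₚ.<-trans (ℕₚ.n<1+n i) (subst (suc i <_) (sym (M-length hs mem′)) i<n))))
      (trans (cong (λ t → at t i) eq) (at₁ pre (trans (≤ₑ-length p) h)))) (s≤s z≤n)

  private
    module _ {P Q : Exp} (hP : length P ≡ i) where

      -- The unit leaves the first entry and cannot return there, where the other vector is smaller.
      -- In the context it lands only where the other vector is larger, so the result stays below
      -- `P` and `Q` while the total of the two entries drops by one.
      exchangeˣ : ∀ {x y x′ y′ pre post} → Within P Q x y → pre ≤ₑ P → post ≤ₑ Q → M n cs′ (pre ++ suc x′ ∷ y′ ∷ post) →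
        x < suc x′ → (y′ < y × M n cs′ (pre ++ x′ ∷ suc y′ ∷ post)) ⊎ Within P Q x′ y′
      exchangeˣ {x} {y} {x′} {y′} {pre} {post} (preA , postA , pA , qA , memA) pB qB memB lt
        with M-exchange hs′ memB memA i (ℕₚ.≤-<-trans (ℕₚ.≤-reflexive (at₁ preA (trans (≤ₑ-length pA) hP)))
               (ℕₚ.<-≤-trans lt (ℕₚ.≤-reflexive (sym (at₁ pre (trans (≤ₑ-length pB) hP))))))
      ... | j , z , ltj , memz , eq with bump-injective i z (bump j (pre ++ x′ ∷ y′ ∷ post))
              (trans eq (trans (cong (bump j) (sym (bump₁ pre (trans (≤ₑ-length pB) hP)))) (bump-comm j i _)))
            | locate pA pB qA qB j x′ y′ ltj
      ...   | z≡ | inj₁ (h , _) = ⊥-elim (ℕₚ.<-asym h lt)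
      ...   | z≡ | inj₂ (inj₁ (h , eq′)) = inj₁ (h , subst (M n cs′) (trans z≡ eq′) memz)
      ...   | z≡ | inj₂ (inj₂ (pre″ , post″ , s , r , eq′)) = inj₂ (pre″ , post″ , s , r , subst (M n cs′) (trans z≡ eq′) memz)

      exchangeʸ : ∀ {x y x′ y′ pre post} → Within P Q x y → pre ≤ₑ P → post ≤ₑ Q → M n cs′ (pre ++ x′ ∷ suc y′ ∷ post) →
        y < suc y′ → (x′ < x × M n cs′ (pre ++ suc x′ ∷ y′ ∷ post)) ⊎ Within P Q x′ y′
      exchangeʸ {x} {y} {x′} {y′} {pre} {post} (preA , postA , pA , qA , memA) pB qB memB lt
        with M-exchange hs′ memB memA (suc i) (ℕₚ.≤-<-trans (ℕₚ.≤-reflexive (at₂ preA (trans (≤ₑ-length pA) hP)))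
               (ℕₚ.<-≤-trans lt (ℕₚ.≤-reflexive (sym (at₂ pre (trans (≤ₑ-length pB) hP))))))
      ... | j , z , ltj , memz , eq with bump-injective (suc i) z (bump j (pre ++ x′ ∷ y′ ∷ post))
              (trans eq (trans (cong (bump j) (sym (bump₂ pre (trans (≤ₑ-length pB) hP)))) (bump-comm j (suc i) _)))
            | locate pA pB qA qB j x′ y′ ltj
      ...   | z≡ | inj₁ (h , eq′) = inj₁ (h , subst (M n cs′) (trans z≡ eq′) memz)
      ...   | z≡ | inj₂ (inj₁ (h , _)) = ⊥-elim (ℕₚ.<-asym h lt)
      ...   | z≡ | inj₂ (inj₂ (pre″ , post″ , s , r , eq′)) = inj₂ (pre″ , post″ , s , r , subst (M n cs′) (trans z≡ eq′) memz)

      -- Among the elements of least total `D`, `B` has the least second entry and `A` the least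
      -- first entry. An exchange whose unit landed in the context would produce a total below `D`,
      -- so units only move between the two entries and the context is kept. Exchanging from `B`
      -- towards `A` thus runs through the whole antidiagonal in the context of `B`.
      build : ∀ {D m xB l yA} →
        (∀ {x y} → Within P Q x y → D ≤ x + y) →
        Within P Q xB m → xB + m ≡ D → (∀ {x y} → Within P Q x y → x + y ≡ D → m ≤ y) →
        Within P Q l yA → l + yA ≡ D → (∀ {x y} → Within P Q x y → x + y ≡ D → l ≤ x) → Slice P Q
      build {l = zero} _ _ _ _ A _ _ = ⊥-elim (ℕₚ.1+n≰n (positive hP A))
      build {D = zero} {l = suc l} _ _ _ _ _ () _
      build {suc d} {m} {xB} {suc l} {yA} minD B@(preB , postB , pB , qB , memB) B≡ minY A@(preA , postA , pA , qA , memA) A≡ minX = record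
        { l = l ; m = m ; d = d ; pre = preB ; post = postB ; pre≤ = pB ; post≤ = qB
        ; bounds = λ w → lower-x w , lower-y w , minD w
        ; attained = λ x y eq l<x m≤y → along (xB ∸ x) x y eq l<x
            (ℕₚ.m+[n∸m]≡n (ℕₚ.+-cancelʳ-≤ m x xB (ℕₚ.≤-trans (ℕₚ.+-monoʳ-≤ x m≤y) (ℕₚ.≤-reflexive (trans eq (sym B≡))))))
        ; nonempty = ℕₚ.≤-trans (ℕₚ.+-monoˡ-≤ m (minX B B≡)) (ℕₚ.≤-reflexive B≡) }
        where
        lower-y : ∀ {x y} → Within P Q x y → m ≤ y
        lower-y {x} {y} w with m ℕ.≤? y
        ... | yes h = h
        ... | no h = ⊥-elim (below m (ℕₚ.≰⇒> h) memB B≡ minY)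
          where
          below : ∀ m → y < m → M n cs′ (preB ++ xB ∷ m ∷ postB) → xB + m ≡ suc d →
            (∀ {x y} → Within P Q x y → x + y ≡ suc d → m ≤ y) → ⊥
          below (suc m) lt mem eq min with exchangeʸ w pB qB mem lt
          ... | inj₁ (_ , mem′) = ℕₚ.1+n≰n (min (preB , postB , pB , qB , mem′) (trans (sym (ℕₚ.+-suc xB m)) eq))
          ... | inj₂ w′ = ℕₚ.1+n≰n (ℕₚ.≤-trans (ℕₚ.≤-reflexive (trans (sym (ℕₚ.+-suc xB m)) eq)) (minD w′))
        lower-x : ∀ {x y} → Within P Q x y → suc l ≤ x
        lower-x {x} {y} w with suc l ℕ.≤? x
        ... | yes h = h
        ... | no h with exchangeˣ w pA qA memA (ℕₚ.≰⇒> h)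
        ...   | inj₁ (_ , mem) = ⊥-elim (ℕₚ.1+n≰n (minX (preA , postA , pA , qA , mem) (trans (ℕₚ.+-suc l yA) A≡)))
        ...   | inj₂ w′ = ⊥-elim (ℕₚ.1+n≰n (ℕₚ.≤-trans (ℕₚ.≤-reflexive A≡) (minD w′)))
        along : ∀ t x y → x + y ≡ suc d → suc l ≤ x → x + t ≡ xB → M n cs′ (preB ++ x ∷ y ∷ postB)
        along zero x y eq l<x x≡ with trans (sym (ℕₚ.+-identityʳ x)) x≡
        ... | refl with ℕₚ.+-cancelˡ-≡ x y m (trans eq (sym B≡))
        ...   | refl = memB
        along (suc t) x zero eq l<x x≡ = ⊥-elim (ℕₚ.1+n≰n (ℕₚ.≤-trans
          (ℕₚ.≤-trans (ℕₚ.≤-trans (s≤s (ℕₚ.≤-reflexive (trans (sym eq) (ℕₚ.+-identityʳ x)))) (ℕₚ.≤-trans (s≤s (ℕₚ.m≤m+n x t))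
            (ℕₚ.≤-reflexive (trans (sym (ℕₚ.+-suc x t)) x≡)))) (ℕₚ.m≤m+n xB m)) (ℕₚ.≤-reflexive B≡)))
        along (suc t) x (suc y) eq l<x x≡
          with exchangeˣ A pB qB (along t (suc x) y (trans (sym (ℕₚ.+-suc x y)) eq) (ℕₚ.m≤n⇒m≤1+n l<x) (trans (sym (ℕₚ.+-suc x t)) x≡)) (s≤s l<x)
        ... | inj₁ (_ , mem) = mem
        ... | inj₂ w′ = ⊥-elim (ℕₚ.1+n≰n (ℕₚ.≤-trans (ℕₚ.≤-reflexive (trans (sym (ℕₚ.+-suc x y)) eq)) (minD w′)))

  slice : ∀ P Q → length P ≡ i → ¬ ¬ ((∀ x y → ¬ Within P Q x y) ⊎ Slice P Q)
  slice P Q hP ¬s = ¬s (inj₁ λ x y w →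
    ¬¬-minimum {R = λ s → ∃ λ x → ∃ λ y → Within P Q x y × x + y ≡ s} (x , y , w , refl) λ (D , (x₀ , y₀ , w₀ , eq₀) , minD) →
    ¬¬-minimum {R = λ y → ∃ λ x → Within P Q x y × x + y ≡ D} (x₀ , w₀ , eq₀) λ (m , (xB , B , B≡) , minY) →
    ¬¬-minimum {R = λ x → ∃ λ y → Within P Q x y × x + y ≡ D} (y₀ , w₀ , eq₀) λ (l , (yA , A , A≡) , minX) →
    ¬s (inj₂ (build hP (λ {x} {y} w → ℕₚ.≮⇒≥ λ lt → minD (x + y) lt (x , y , w , refl))
      B B≡ (λ {x} {y} w eq → ℕₚ.≮⇒≥ λ lt → minY y lt (x , w , eq))
      A A≡ (λ {x} {y} w eq → ℕₚ.≮⇒≥ λ lt → minX x lt (y , w , eq)))))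

-- The invariant of the recursion

∂-at : ∀ P {i a b Q} f → length P ≡ i → ∂ i f (P ++ a ∷ b ∷ Q) ≡ δ (λ x y → f (P ++ x ∷ y ∷ Q)) a b
∂-at [] f refl = refl
∂-at (p ∷ P) f refl = ∂-at P (λ e → f (p ∷ e)) refl

X-at : ∀ P {i x y Q} f → length P ≡ i → X (suc i) f (P ++ x ∷ y ∷ Q) ≡ y· (λ x y → f (P ++ x ∷ y ∷ Q)) x y
X-at [] {y = zero} f refl = refl
X-at [] {y = suc y} f refl = refl
X-at (p ∷ P) f refl = X-at P (λ e → f (p ∷ e)) refl

length-at : ∀ (P Q : Exp) a b x y → length (P ++ x ∷ y ∷ Q) ≡ length (P ++ a ∷ b ∷ Q)
length-at P Q a b x y = trans (Listₚ.length-++ P) (sym (Listₚ.length-++ P))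

entrySum-at : ∀ P {a b x y Q} → x + y ≡ suc (a + b) → entrySum (P ++ x ∷ y ∷ Q) ≡ suc (entrySum (P ++ a ∷ b ∷ Q))
entrySum-at [] {a} {b} {x} {y} {Q} eq = trans (sym (ℕₚ.+-assoc x y (entrySum Q)))
  (trans (cong (_+ entrySum Q) eq) (cong suc (ℕₚ.+-assoc a b (entrySum Q))))
entrySum-at (p ∷ P) eq = trans (cong (p +_) (entrySum-at P eq)) (ℕₚ.+-suc p _)

entrySum-mono : ∀ {α e} → α ≤ₑ e → entrySum α ≤ entrySum e
entrySum-mono [] = z≤n
entrySum-mono (p ∷ q) = ℕₚ.+-mono-≤ p (entrySum-mono q)

≤ₑ-antisym-sum : ∀ {α e} → α ≤ₑ e → entrySum e ≤ entrySum α → α ≡ e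
≤ₑ-antisym-sum [] _ = refl
≤ₑ-antisym-sum {x ∷ α} {y ∷ e} (p ∷ q) h = cong₂ _∷_
  (ℕₚ.≤-antisym p (ℕₚ.+-cancelʳ-≤ (entrySum α) y x (ℕₚ.≤-trans (ℕₚ.+-monoʳ-≤ y (entrySum-mono q)) h)))
  (≤ₑ-antisym-sum q (ℕₚ.+-cancelˡ-≤ y _ _ (ℕₚ.≤-trans h (ℕₚ.+-monoˡ-≤ (entrySum α) p))))

-- Two implications rather than a case distinction, because membership in M or in its closure is not
-- decided.
Indicates : (Exp → Set) → ℕ → Series → Set
Indicates P n f = ∀ e → length e ≡ n → (P e → f e ≡ 1ℤ) × (¬ P e → f e ≡ 0ℤ)

SwapColumn-boxes : ∀ {i C′ C} → SwapColumn i C′ C → boxes C′ ≡ boxes C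
SwapColumn-boxes (fix b) = refl
SwapColumn-boxes move = refl
SwapColumn-boxes (there b sw) = cong (bit b +_) (SwapColumn-boxes sw)

Step-degree : ∀ {i cs′ cs} → Step i cs′ cs → degree cs′ ≡ suc (degree cs)
Step-degree (pivot o′ o sws) = cong₂ _+_ (trans (Ones-boxes o′) (cong suc (sym (Ones-boxes o)))) (swaps sws)
  where
  Ones-boxes : ∀ {k C} → Ones k C → boxes C ≡ k
  Ones-boxes [] = refl
  Ones-boxes (zero o) = Ones-boxes o
  Ones-boxes (one o) = cong suc (Ones-boxes o)
  swaps : ∀ {i cs′ cs} → Pointwise (SwapColumn i) cs′ cs → degree cs′ ≡ degree cs
  swaps [] = refl
  swaps (sw ∷ sws) = cong₂ _+_ (SwapColumn-boxes sw) (swaps sws)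
Step-degree (_∷_ {C′} {C} sw st) = trans (cong₂ _+_ (SwapColumn-boxes sw) (Step-degree st)) (ℕₚ.+-suc (boxes C) _)

module Invariant {n i : ℕ} {cs′ cs : List Column} (i<n : suc i < n) (hs′ : HasLengths n cs′) (hs : HasLengths n cs) (st : Step i cs′ cs)
  (S′ S h′ : Series) (S≗ : S ≗ ∂ i S′)
  (S-nonneg : ∀ e → length e ≡ n → 0ℤ ≤ᶻ S e) (S≤1 : ∀ e → length e ≡ n → S e ≤ᶻ 1ℤ)
  (S′≤S : ∀ e → length e ≡ n → S′ (bump i e) ≤ᶻ S e)
  (indS′ : Indicates (M n cs′) n S′) (indh′ : Indicates (Up n cs′) n h′)
  where

  open Slices i<n hs′ hs st

  h : Series
  h = ∂ i (1-X (suc i) h′)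

  private
    module _ (P : Exp) (hP : length P ≡ i) (Q : Exp) (a b : ℕ) (|e| : length (P ++ a ∷ b ∷ Q) ≡ n) where

      |xy| : ∀ x y → length (P ++ x ∷ y ∷ Q) ≡ n
      |xy| x y = trans (length-at P Q a b x y) |e|

      h-slice : h (P ++ a ∷ b ∷ Q) ≡ τ (λ x y → h′ (P ++ x ∷ y ∷ Q)) a b
      h-slice = trans (∂-at P _ hP) (δ-cong (λ x y → cong (λ u → h′ (P ++ x ∷ y ∷ Q) -ᶻ u) (X-at P h′ hP)) a b)

      Up⇒Within : ∀ {x y} → Up n cs′ (P ++ x ∷ y ∷ Q) → ∃ λ x₀ → ∃ λ y₀ → Within P Q x₀ y₀ × x₀ ≤ x × y₀ ≤ y
      Up⇒Within (α , mem , le) with ≤ₑ-split P le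
      ... | pre , x₀ , y₀ , post , refl , p , q , r , s = x₀ , y₀ , (pre , post , p , s , mem) , q , r

      Up⇒Within′ : Up n cs (P ++ a ∷ b ∷ Q) → ∃ λ p → ∃ λ q → Within P Q (suc p) q × q ≤ a × q ≤ b × p + q ≤ a + b
      Up⇒Within′ (α , mem , le) with ≤ₑ-split P le
      ... | pre , x , y , post , refl , pre≤ , x≤a , y≤b , post≤ with Step-raise i<n hs′ hs st mem
      ...   | e′ , mem′ , r with Off-split pre (trans (≤ₑ-length pre≤) hP) (Raised.off r)
      ...     | p , q , refl = p , q ,
        (pre , post , pre≤ , post≤ , subst (M n cs′) (bump₁ pre hpre) mem′) ,
        ℕₚ.≤-trans (ℕₚ.≤-trans (ℕₚ.≤-reflexive (sym (at₂ pre hpre))) (ℕₚ.≤-trans (Raised.≤₁ r) (ℕₚ.≤-reflexive (at₁ pre hpre)))) x≤a ,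
        ℕₚ.≤-trans (ℕₚ.≤-trans (ℕₚ.≤-reflexive (sym (at₂ pre hpre))) (ℕₚ.≤-trans (Raised.≤₂ r) (ℕₚ.≤-reflexive (at₂ pre hpre)))) y≤b ,
        ℕₚ.≤-trans (ℕₚ.≤-reflexive (trans (sym (cong₂ _+_ (at₁ pre hpre) (at₂ pre hpre)))
          (trans (Raised.same r) (cong₂ _+_ (at₁ pre hpre) (at₂ pre hpre))))) (ℕₚ.+-mono-≤ x≤a y≤b)
        where hpre = trans (≤ₑ-length pre≤) hP

      Indicated : Set
      Indicated = (Up n cs (P ++ a ∷ b ∷ Q) → h (P ++ a ∷ b ∷ Q) ≡ 1ℤ) × (¬ Up n cs (P ++ a ∷ b ∷ Q) → h (P ++ a ∷ b ∷ Q) ≡ 0ℤ)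

      empty-slice : (∀ x y → ¬ Within P Q x y) → Indicated
      empty-slice none = (λ up → let (p , q , w , _) = Up⇒Within′ up in ⊥-elim (none _ _ w)) ,
        λ _ → trans h-slice (trans (τ-cong {g = λ _ _ → 0ℤ} (λ x y → proj₂ (indh′ _ (|xy| x y)) (λ up → let (_ , _ , w , _) = Up⇒Within up in none _ _ w)) a b)
          (trans (δ-cong (λ { x zero → refl ; x (suc y) → refl }) a b) (δ-zero a b)))

      module _ (s : Slice P Q) where
        open Slice s

        hpre : length pre ≡ i
        hpre = trans (≤ₑ-length pre≤) hP

        |pre-post| : ∀ x y → length (pre ++ x ∷ y ∷ post) ≡ n
        |pre-post| x y = trans (≤ₑ-length (≤ₑ-join {a = x} {b = y} pre≤ ℕₚ.≤-refl ℕₚ.≤-refl post≤)) (|xy| x y)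

        condition : m ≤ l × (l ≡ m ⊎ d ≡ l + m)
        condition = interval-condition (λ x y → S′ (pre ++ x ∷ y ∷ post)) (λ x y → S (pre ++ x ∷ y ∷ post)) l m d nonempty
          (λ x y _ → trans (S≗ _) (∂-at pre S′ hpre))
          (λ x y _ → S-nonneg _ (|pre-post| x y))
          (λ x y _ → S≤1 _ (|pre-post| x y))
          (λ x y _ → ℤₚ.≤-trans (ℤₚ.≤-reflexive (cong S′ (sym (bump₁ pre hpre)))) (S′≤S _ (|pre-post| x y)))
          (λ x y eq l<x m≤y → proj₁ (indS′ _ (|pre-post| x y)) (attained x y eq l<x m≤y))
          (λ x y out → proj₂ (indS′ _ (|pre-post| x y)) (λ mem → let (p , q , _) = bounds (pre , post , pre≤ , post≤ , mem) in out (p , q)))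

        -- Lowers the first entry as far as its bound and the total allow, and only then the second.
        choose : ∀ {x y} → suc l ≤ x → m ≤ y → suc d ≤ x + y →
          ∃ λ x₀ → ∃ λ y₀ → suc x₀ + y₀ ≡ suc d × l ≤ x₀ × m ≤ y₀ × suc x₀ ≤ x × y₀ ≤ y
        choose {x} {y} l<x m≤y d<x+y with d ℕ.≤? l + y
        ... | yes h = l , d ∸ l , cong suc (ℕₚ.m+[n∸m]≡n l≤d) , ℕₚ.≤-refl ,
          ℕₚ.m+n≤o⇒m≤o∸n m (subst (_≤ d) (ℕₚ.+-comm l m) (ℕ.s≤s⁻¹ nonempty)) , l<x , ℕₚ.m≤n+o⇒m∸n≤o d l h
          where l≤d = ℕₚ.≤-trans (ℕₚ.m≤m+n l m) (ℕ.s≤s⁻¹ nonempty)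
        ... | no h = d ∸ y , y , cong suc (ℕₚ.m∸n+n≡m y≤d) ,
          ℕₚ.m+n≤o⇒m≤o∸n l (ℕₚ.<⇒≤ (ℕₚ.≰⇒> h)) , m≤y ,
          ℕₚ.≤-trans (ℕₚ.≤-reflexive (sym (ℕₚ.+-∸-assoc 1 y≤d))) (ℕₚ.m≤n+o⇒m∸n≤o (suc d) y (subst (suc d ≤_) (ℕₚ.+-comm x y) d<x+y)) , ℕₚ.≤-refl
          where y≤d = ℕₚ.≤-trans (ℕₚ.m≤n+m y l) (ℕₚ.<⇒≤ (ℕₚ.≰⇒> h))

        h′-slice : ∀ x y → h′ (P ++ x ∷ y ∷ Q) ≡ corner (suc l) m (suc d) x y
        h′-slice x y with suc l ℕ.≤? x | m ℕ.≤? y | suc d ℕ.≤? x + y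
        ... | yes p | yes q | yes r with choose p q r
        ...   | x₀ , y₀ , eq , l≤ , m≤ , ≤x , ≤y = proj₁ (indh′ _ (|xy| x y))
                (_ , attained (suc x₀) y₀ eq (s≤s l≤) m≤ , ≤ₑ-join pre≤ ≤x ≤y post≤)
        h′-slice x y | no ¬p | _ | _ = proj₂ (indh′ _ (|xy| x y))
          (λ up → let (_ , _ , w , ≤x , _) = Up⇒Within up in ¬p (ℕₚ.≤-trans (proj₁ (bounds w)) ≤x))
        h′-slice x y | yes _ | no ¬q | _ = proj₂ (indh′ _ (|xy| x y))
          (λ up → let (_ , _ , w , _ , ≤y) = Up⇒Within up in ¬q (ℕₚ.≤-trans (proj₁ (proj₂ (bounds w))) ≤y))
        h′-slice x y | yes _ | yes _ | no ¬r = proj₂ (indh′ _ (|xy| x y))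
          (λ up → let (_ , _ , w , ≤x , ≤y) = Up⇒Within up in ¬r (ℕₚ.≤-trans (proj₂ (proj₂ (bounds w))) (ℕₚ.+-mono-≤ ≤x ≤y)))

        h-corner : h (P ++ a ∷ b ∷ Q) ≡ corner m m d a b
        h-corner = trans h-slice (trans (τ-cong h′-slice a b) (cases (proj₂ condition)))
          where
          cases : l ≡ m ⊎ d ≡ l + m → τ (corner (suc l) m (suc d)) a b ≡ corner m m d a b
          cases (inj₁ eq) = subst (λ l → τ (corner (suc l) m (suc d)) a b ≡ corner m m d a b) (sym eq) (τ-near-diagonal m d a b)
          cases (inj₂ eq) = subst (λ d → τ (corner (suc l) m (suc d)) a b ≡ corner m m d a b) (sym eq) (τ-point l m a b (proj₁ condition))

        unbump : ∀ {x y} → M n cs′ (pre ++ suc x ∷ y ∷ post) → M n cs (pre ++ x ∷ y ∷ post) × Lowering n i cs (pre ++ x ∷ y ∷ post)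
        unbump {x} {y} mem with Step-lower i<n hs′ hs st mem
        ... | e , eq , mem′ , lows with bump-injective i e (pre ++ x ∷ y ∷ post) (trans eq (sym (bump₁ pre hpre)))
        ...   | refl = mem′ , lows

        -- If l = m, the region is the slice for w′ moved by one unit in x, and the bump of a
        -- minimal element can be undone. If d = l + m, the slice has the single minimal element (l
        -- + 1, m): after undoing the bump, l ∸ a units are moved from the first entry to the
        -- second, which `Lowering` permits since m ≤ a.
        corner⇒Up : m ≤ a → m ≤ b → d ≤ a + b → Up n cs (P ++ a ∷ b ∷ Q)
        corner⇒Up m≤a m≤b d≤ with condition
        ... | m≤l , inj₁ refl with choose (s≤s m≤a) m≤b (s≤s d≤)
        ...   | x₀ , y₀ , eq , l≤ , m≤ , s≤s ≤a , ≤b =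
          _ , proj₁ (unbump (attained (suc x₀) y₀ eq (s≤s l≤) m≤)) , ≤ₑ-join pre≤ ≤a ≤b post≤
        corner⇒Up m≤a m≤b d≤ | m≤l , inj₂ d≡ with proj₂ (unbump (attained (suc l) m (cong suc (sym d≡)) ℕₚ.≤-refl ℕₚ.≤-refl)) (l ∸ a)
            (ℕₚ.≤-trans (ℕₚ.+-monoʳ-≤ (l ∸ a) (ℕₚ.≤-reflexive (at₂ pre hpre))) (ℕₚ.≤-trans t+m≤l (ℕₚ.≤-reflexive (sym (at₁ pre hpre)))))
          where
          t+m≤l : l ∸ a + m ≤ l
          t+m≤l with ℕₚ.≤-total a l
          ... | inj₁ a≤l = ℕₚ.≤-trans (ℕₚ.+-monoʳ-≤ (l ∸ a) m≤a) (ℕₚ.≤-reflexive (ℕₚ.m∸n+n≡m a≤l))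
          ... | inj₂ l≤a rewrite ℕₚ.m≤n⇒m∸n≡0 l≤a = m≤l
        ...   | e″ , mem″ , low′ with Off-split pre hpre (Lowered.off low′)
        ...     | p , q , refl = _ , mem″ , ≤ₑ-join pre≤ p≤a q≤b post≤
          where
          p≤a : p ≤ a
          p≤a = ℕₚ.+-cancelʳ-≤ (l ∸ a) p a (ℕₚ.≤-trans (ℕₚ.≤-reflexive (trans (cong (_+ (l ∸ a)) (sym (at₁ pre hpre)))
            (trans (Lowered.fst≡ low′) (at₁ pre hpre)))) (ℕₚ.m≤n+m∸n l a))
          m+t≤b : m + (l ∸ a) ≤ b
          m+t≤b with ℕₚ.≤-total a l
          ... | inj₁ a≤l = ℕₚ.≤-trans (ℕₚ.≤-reflexive (sym (ℕₚ.+-∸-assoc m a≤l)))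
            (ℕₚ.m≤n+o⇒m∸n≤o (m + l) a (ℕₚ.≤-trans (ℕₚ.≤-reflexive (trans (ℕₚ.+-comm m l) (sym d≡))) d≤))
          ... | inj₂ l≤a rewrite ℕₚ.m≤n⇒m∸n≡0 l≤a = ℕₚ.≤-trans (ℕₚ.≤-reflexive (ℕₚ.+-identityʳ m)) m≤b
          q≤b : q ≤ b
          q≤b = ℕₚ.≤-trans (ℕₚ.≤-reflexive (trans (sym (at₂ pre hpre)) (trans (Lowered.snd≡ low′) (cong (_+ (l ∸ a)) (at₂ pre hpre))))) m+t≤b

        full-slice : Indicated
        full-slice = (λ up → let (p , q , w , q≤a , q≤b , le) = Up⇒Within′ up ; (_ , m≤q , d≤) = bounds w in
            trans h-corner (corner-in (ℕₚ.≤-trans m≤q q≤a) (ℕₚ.≤-trans m≤q q≤b) (ℕₚ.≤-trans (ℕ.s≤s⁻¹ d≤) le))) ,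
          λ ¬up → trans h-corner (corner-out (λ (p , q , r) → ¬up (corner⇒Up p q r)))

      indicated : Indicated
      indicated =
        (λ up → stable λ { (inj₁ none) → proj₁ (empty-slice none) up ; (inj₂ s) → proj₁ (full-slice s) up }) ,
        (λ ¬up → stable λ { (inj₁ none) → proj₂ (empty-slice none) ¬up ; (inj₂ s) → proj₂ (full-slice s) ¬up })
        where
        stable : ∀ {v} → ((∀ x y → ¬ Within P Q x y) ⊎ Slice P Q → h (P ++ a ∷ b ∷ Q) ≡ v) → h (P ++ a ∷ b ∷ Q) ≡ v
        stable k = decidable-stable (h (P ++ a ∷ b ∷ Q) ℤ.≟ _) (λ ≢ → slice P Q hP (λ s → ≢ (k s)))

      S-slice : S (P ++ a ∷ b ∷ Q) ≡ δ (λ x y → S′ (P ++ x ∷ y ∷ Q)) a b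
      S-slice = trans (S≗ _) (∂-at P S′ hP)

      S-inhomogeneous : entrySum (P ++ a ∷ b ∷ Q) ≢ degree cs → S (P ++ a ∷ b ∷ Q) ≡ 0ℤ
      S-inhomogeneous ne = trans S-slice (trans
        (δ-cong-diagonal {g = λ _ _ → 0ℤ} a b (λ x y eq → proj₂ (indS′ _ (|xy| x y)) (λ mem → ne (ℕₚ.suc-injective
          (trans (sym (entrySum-at P eq)) (trans (M-degree hs′ mem) (Step-degree st)))))))
        (δ-zero a b))

      -- In the degree of `cs′`, lying above an element of M means being equal to it, so `S′` and
      -- `h′` agree there. The factor 1 - xᵢ₊₁ brings in only coefficients of `h′` one degree lower,
      -- where `h′` vanishes.
      S≡h : entrySum (P ++ a ∷ b ∷ Q) ≡ degree cs → S (P ++ a ∷ b ∷ Q) ≡ h (P ++ a ∷ b ∷ Q)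
      S≡h deg = trans S-slice (trans (δ-cong-diagonal a b agree) (sym h-slice))
        where
        lower-degree : ∀ {e} → entrySum e < degree cs′ → ¬ Up n cs′ e
        lower-degree lt (α , mem , le) = ℕₚ.<⇒≱ lt (ℕₚ.≤-trans (ℕₚ.≤-reflexive (sym (M-degree hs′ mem))) (entrySum-mono le))
        deg′ : ∀ {x y} → x + y ≡ suc (a + b) → entrySum (P ++ x ∷ y ∷ Q) ≡ degree cs′
        deg′ eq = trans (entrySum-at P eq) (trans (cong suc deg) (sym (Step-degree st)))
        same-degree : ∀ e → length e ≡ n → entrySum e ≡ degree cs′ → S′ e ≡ h′ e
        same-degree e |e| eq = decidable-stable (S′ e ℤ.≟ h′ e) λ ≢ →
          let ¬mem = λ mem → ≢ (trans (proj₁ (indS′ e |e|) mem) (sym (proj₁ (indh′ e |e|) (e , mem , ≤ₑ-refl)))) in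
          ≢ (trans (proj₂ (indS′ e |e|) ¬mem) (sym (proj₂ (indh′ e |e|) (λ (α , mem , le) →
            ¬mem (subst (M n cs′) (≤ₑ-antisym-sum le (ℕₚ.≤-reflexive (trans eq (sym (M-degree hs′ mem))))) mem)))))
        y·-vanishes : ∀ x y → x + y ≡ suc (a + b) → y· (λ x y → h′ (P ++ x ∷ y ∷ Q)) x y ≡ 0ℤ
        y·-vanishes x zero eq = refl
        y·-vanishes x (suc y) eq = proj₂ (indh′ _ (|xy| x y)) (lower-degree
          (ℕₚ.≤-reflexive (trans (sym (entrySum-at P {x} {y} {x} {suc y} {Q} (ℕₚ.+-suc x y))) (deg′ eq))))
        agree : ∀ x y → x + y ≡ suc (a + b) → S′ (P ++ x ∷ y ∷ Q) ≡ h′ (P ++ x ∷ y ∷ Q) -ᶻ y· (λ x y → h′ (P ++ x ∷ y ∷ Q)) x y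
        agree x y eq = trans (same-degree _ (|xy| x y) (deg′ eq)) (trans (sym (ℤₚ.+-identityʳ _))
          (cong (λ u → h′ (P ++ x ∷ y ∷ Q) -ᶻ u) (sym (y·-vanishes x y eq))))

  indh : Indicates (Up n cs) n h
  indh e |e| with split-at i e (subst (suc i <_) (sym |e|) i<n)
  ... | P , a , b , Q , refl , hP = indicated P hP Q a b |e|

  indS : Indicates (M n cs) n S
  indS e |e| with split-at i e (subst (suc i <_) (sym |e|) i<n)
  ... | P , a , b , Q , refl , hP with entrySum (P ++ a ∷ b ∷ Q) ℕ.≟ degree cs
  ...   | no ne = (λ mem → ⊥-elim (ne (M-degree hs mem))) , λ _ → S-inhomogeneous P hP Q a b |e| ne
  ...   | yes deg =
    (λ mem → trans (S≡h P hP Q a b |e| deg) (proj₁ (indicated P hP Q a b |e|) (_ , mem , ≤ₑ-refl))) ,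
    (λ ¬mem → trans (S≡h P hP Q a b |e| deg) (proj₂ (indicated P hP Q a b |e|) (λ (α , mem , le) →
      ¬mem (subst (M n cs) (≤ₑ-antisym-sum le (ℕₚ.≤-reflexive (trans deg (sym (M-degree hs mem))))) mem))))

-- Multiplication by ∏ (1 − xⱼ)

𝔼 : Series → Series
𝔼 f []          = f []
𝔼 f (zero ∷ e)  = 𝔼 (λ e′ → f (0 ∷ e′)) e
𝔼 f (suc a ∷ e) = 𝔼 (λ e′ → f (suc a ∷ e′)) e -ᶻ 𝔼 (λ e′ → f (a ∷ e′)) e

𝔼-additive : ∀ e → Additive (λ f → 𝔼 f e)
𝔼-additive [] = record { ext = λ h → h [] ; add = λ _ _ → refl ; minus = λ _ _ → refl }
𝔼-additive (zero ∷ e) = record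
  { ext = λ h → ext (𝔼-additive e) (λ _ → h _)
  ; add = λ f g → add (𝔼-additive e) _ _
  ; minus = λ f g → minus (𝔼-additive e) _ _ }
𝔼-additive (suc a ∷ e) = record
  { ext = λ h → cong₂ _-ᶻ_ (ext (𝔼-additive e) (λ _ → h _)) (ext (𝔼-additive e) (λ _ → h _))
  ; add = λ f g → trans (cong₂ _-ᶻ_ (add (𝔼-additive e) _ _) (add (𝔼-additive e) _ _))
      (sub-of-sums (𝔼 (λ e′ → f (suc a ∷ e′)) e) _ _ _)
  ; minus = λ f g → trans (cong₂ _-ᶻ_ (minus (𝔼-additive e) _ _) (minus (𝔼-additive e) _ _))
      (sub-of-subs (𝔼 (λ e′ → f (suc a ∷ e′)) e) _ _ _) }

𝔼-X : ∀ k f → 𝔼 (X k f) ≗ X k (𝔼 f)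
𝔼-X zero f [] = refl
𝔼-X (suc k) f [] = refl
𝔼-X zero f (zero ∷ e) = null (𝔼-additive e)
𝔼-X zero f (suc zero ∷ e) = trans (cong (λ u → 𝔼 (λ e′ → f (0 ∷ e′)) e -ᶻ u) (null (𝔼-additive e))) (ℤₚ.+-identityʳ _)
𝔼-X zero f (suc (suc a) ∷ e) = refl
𝔼-X (suc k) f (zero ∷ e) = 𝔼-X k _ e
𝔼-X (suc k) f (suc a ∷ e) = trans (cong₂ _-ᶻ_ (𝔼-X k _ e) (𝔼-X k _ e)) (sym (minus (X-additive k e) _ _))

1-x· : (ℕ → ℕ → ℤ) → ℕ → ℕ → ℤ
1-x· g a b = g a b -ᶻ x· g a b

1-y· : (ℕ → ℕ → ℤ) → ℕ → ℕ → ℤ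
1-y· g a b = g a b -ᶻ y· g a b

𝔼-∷∷ : ∀ F a b e → 𝔼 F (a ∷ b ∷ e) ≡ 1-x· (1-y· (λ x y → 𝔼 (λ e′ → F (x ∷ y ∷ e′)) e)) a b
𝔼-∷∷ F zero zero e = sym (trans (ℤₚ.+-identityʳ _) (ℤₚ.+-identityʳ _))
𝔼-∷∷ F zero (suc b) e = sym (ℤₚ.+-identityʳ _)
𝔼-∷∷ F (suc a) zero e = cong₂ _-ᶻ_
  (sym (ℤₚ.+-identityʳ (𝔼 (λ e′ → F (suc a ∷ 0 ∷ e′)) e))) (sym (ℤₚ.+-identityʳ (𝔼 (λ e′ → F (a ∷ 0 ∷ e′)) e)))
𝔼-∷∷ F (suc a) (suc b) e = refl

-- (1 - x)(1 - y) is symmetric, so it passes through the divided difference. The two Leibniz rules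
-- turn this into an identity of coefficients.
δ-1-x-1-y : ∀ g a b → δ (1-x· (1-y· g)) a b ≡ 1-x· (1-y· (δ g)) a b
δ-1-x-1-y g a b = begin
  δ (1-x· (1-y· g)) a b
    ≡⟨ δ-minus (1-y· g) (x· (1-y· g)) a b ⟩
  δ (1-y· g) a b -ᶻ δ (x· (1-y· g)) a b
    ≡⟨ cong₂ _-ᶻ_ (D a b) (trans (δ-x· (1-y· g) a b) (cong (_+ᶻ 1-y· g a b) (lowerʸ b))) ⟩
  (δ g a b -ᶻ (x· (δ g) a b -ᶻ g a b)) -ᶻ ((y· (δ g) a b -ᶻ (y· (x· (δ g)) a b -ᶻ y· g a b)) +ᶻ (g a b -ᶻ y· g a b))
    ≡⟨ cancel (δ g a b) (x· (δ g) a b) (y· (δ g) a b) (y· (x· (δ g)) a b) (g a b) (y· g a b) ⟩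
  (δ g a b -ᶻ y· (δ g) a b) -ᶻ (x· (δ g) a b -ᶻ y· (x· (δ g)) a b)
    ≡⟨ cong (λ u → (δ g a b -ᶻ y· (δ g) a b) -ᶻ u) (lowerˣ a b) ⟨
  1-x· (1-y· (δ g)) a b ∎
  where
  open ≡-Reasoning
  cancel : ∀ t x y z g w → (t -ᶻ (x -ᶻ g)) -ᶻ ((y -ᶻ (z -ᶻ w)) +ᶻ (g -ᶻ w)) ≡ (t -ᶻ y) -ᶻ (x -ᶻ z)
  cancel = solve-∀
  solve-y : ∀ {p q r} → p ≡ q +ᶻ r → q ≡ p -ᶻ r
  solve-y {q = q} {r} refl = sym (cancel₂ q r)
    where
    cancel₂ : ∀ q r → (q +ᶻ r) -ᶻ r ≡ q
    cancel₂ = solve-∀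
  D : ∀ a b → δ (1-y· g) a b ≡ δ g a b -ᶻ (x· (δ g) a b -ᶻ g a b)
  D a b = trans (δ-minus g (y· g) a b) (cong (λ u → δ g a b -ᶻ u) (solve-y (δ-Leibniz g a b)))
  lowerʸ : ∀ b → y· (δ (1-y· g)) a b ≡ y· (δ g) a b -ᶻ (y· (x· (δ g)) a b -ᶻ y· g a b)
  lowerʸ zero = refl
  lowerʸ (suc b) = D a b
  lowerˣ : ∀ a b → x· (1-y· (δ g)) a b ≡ x· (δ g) a b -ᶻ y· (x· (δ g)) a b
  lowerˣ zero zero = refl
  lowerˣ zero (suc b) = refl
  lowerˣ (suc a) zero = refl
  lowerˣ (suc a) (suc b) = refl

𝔼-∂ : ∀ i f → 𝔼 (∂ i f) ≗ ∂ i (𝔼 f)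
𝔼-∂ zero f [] = refl
𝔼-∂ (suc i) f [] = refl
𝔼-∂ zero f (zero ∷ []) = refl
𝔼-∂ zero f (suc a ∷ []) = refl
𝔼-∂ zero f (a ∷ b ∷ e) = begin
  𝔼 (∂ 0 f) (a ∷ b ∷ e)
    ≡⟨ 𝔼-∷∷ (∂ 0 f) a b e ⟩
  1-x· (1-y· (λ x y → 𝔼 (λ e′ → δ (λ x y → f (x ∷ y ∷ e′)) x y) e)) a b
    ≡⟨ 1-x-1-y-cong (λ x y → commute-δ (𝔼-additive e) (λ x y e′ → f (x ∷ y ∷ e′)) x y) a b ⟩
  1-x· (1-y· (δ G)) a b
    ≡⟨ δ-1-x-1-y G a b ⟨
  δ (1-x· (1-y· G)) a b
    ≡⟨ δ-cong (λ x y → sym (𝔼-∷∷ f x y e)) a b ⟩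
  δ (λ x y → 𝔼 f (x ∷ y ∷ e)) a b ∎
  where
  open ≡-Reasoning
  G : ℕ → ℕ → ℤ
  G x y = 𝔼 (λ e′ → f (x ∷ y ∷ e′)) e
  1-y-cong : ∀ {g g′} → (∀ x y → g x y ≡ g′ x y) → ∀ a b → 1-y· g a b ≡ 1-y· g′ a b
  1-y-cong h a zero = cong (_-ᶻ 0ℤ) (h a 0)
  1-y-cong h a (suc b) = cong₂ _-ᶻ_ (h a (suc b)) (h a b)
  1-x-1-y-cong : ∀ {g g′} → (∀ x y → g x y ≡ g′ x y) → ∀ a b → 1-x· (1-y· g) a b ≡ 1-x· (1-y· g′) a b
  1-x-1-y-cong h zero b = cong (_-ᶻ 0ℤ) (1-y-cong h 0 b)
  1-x-1-y-cong h (suc a) b = cong₂ _-ᶻ_ (1-y-cong h (suc a) b) (1-y-cong h a b)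
𝔼-∂ (suc i) f (zero ∷ e) = 𝔼-∂ i _ e
𝔼-∂ (suc i) f (suc a ∷ e) = trans (cong₂ _-ᶻ_ (𝔼-∂ i _ e) (𝔼-∂ i _ e)) (sym (minus (∂-additive i e) _ _))

𝔼-1-X : ∀ k f → 𝔼 (1-X k f) ≗ 1-X k (𝔼 f)
𝔼-1-X k f e = trans (minus (𝔼-additive e) f (X k f)) (cong (λ u → 𝔼 f e -ᶻ u) (𝔼-X k f e))

above : Exp → Series
above w e = if leqE w e then 1ℤ else 0ℤ

𝔼-above : ∀ w → 𝔼 (above w) ≗ term 1ℤ w
𝔼-above [] [] = refl
𝔼-above [] (zero ∷ e) = null (𝔼-additive e)
𝔼-above [] (suc a ∷ e) = cong₂ _-ᶻ_ (null (𝔼-additive e)) (null (𝔼-additive e))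
𝔼-above (x ∷ w) [] = refl
𝔼-above (zero ∷ w) (zero ∷ e) = 𝔼-above w e
𝔼-above (suc x ∷ w) (zero ∷ e) = null (𝔼-additive e)
𝔼-above (zero ∷ w) (suc a ∷ e) = ℤₚ.i≡j⇒i-j≡0 {𝔼 (above w) e} refl
𝔼-above (suc x ∷ w) (suc a ∷ e) = difference x a
  where
  slab : Bool → ℤ
  slab b = 𝔼 (λ e′ → if b ∧ leqE w e′ then 1ℤ else 0ℤ) e
  difference : ∀ x a → slab (suc x ℕ.≤ᵇ suc a) -ᶻ slab (suc x ℕ.≤ᵇ a) ≡ (if (x ℕ.≡ᵇ a) ∧ eqE w e then 1ℤ else 0ℤ)
  difference zero zero = trans (cong (λ u → slab true -ᶻ u) (null (𝔼-additive e))) (trans (ℤₚ.+-identityʳ _) (𝔼-above w e))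
  difference zero (suc a) = ℤₚ.i≡j⇒i-j≡0 {slab true} refl
  difference (suc x) zero = ℤₚ.i≡j⇒i-j≡0 {slab false} refl
  difference (suc x) (suc a) = difference x a

-- Columns of the Rothe diagram of a word

eqE-sound : ∀ e f → eqE e f ≡ true → e ≡ f
eqE-sound [] [] _ = refl
eqE-sound (a ∷ e) (b ∷ f) h with a ℕ.≡ᵇ b in eq
... | true = cong₂ _∷_ (ℕₚ.≡ᵇ⇒≡ a b (subst T (sym eq) _)) (eqE-sound e f h)

≡ᵇ-refl : ∀ a → (a ℕ.≡ᵇ a) ≡ true
≡ᵇ-refl zero = refl
≡ᵇ-refl (suc a) = ≡ᵇ-refl a

≡ᵇ-false : ∀ {a b} → a ≢ b → (a ℕ.≡ᵇ b) ≡ false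
≡ᵇ-false {a} {b} ne with a ℕ.≡ᵇ b in eq
... | true = ⊥-elim (ne (ℕₚ.≡ᵇ⇒≡ a b (subst T (sym eq) _)))
... | false = refl

eqE-refl : ∀ e → eqE e e ≡ true
eqE-refl [] = refl
eqE-refl (a ∷ e) rewrite ≡ᵇ-refl a = eqE-refl e

leqE-sound : ∀ e f → leqE e f ≡ true → e ≤ₑ f
leqE-sound [] [] _ = []
leqE-sound (a ∷ e) (b ∷ f) h with a ℕ.≤ᵇ b in eq
... | true = ℕₚ.≤ᵇ⇒≤ a b (subst T (sym eq) _) ∷ leqE-sound e f h

leqE-complete : ∀ {e f} → e ≤ₑ f → leqE e f ≡ true
leqE-complete [] = refl
leqE-complete (p ∷ q) rewrite ≤ᵇ-true p = leqE-complete q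

-- The condition i < w⁻¹(j) of the Rothe diagram is expressed by emptying the column from the
-- occurrence of j onwards, so no inverse permutation is needed on words.
col : ℕ → List ℕ → Column
col j [] = []
col j (x ∷ l) = if j ℕ.≡ᵇ x then replicate (suc (length l)) false else (j ℕ.<ᵇ x) ∷ col j l

cols : ℕ → List ℕ → List Column
cols n w = map (λ j → col j w) (upTo n)

col-length : ∀ j w → length (col j w) ≡ length w
col-length j [] = refl
col-length j (x ∷ l) with j ℕ.≡ᵇ x
... | true = cong suc (Listₚ.length-replicate (length l))
... | false = cong suc (col-length j l)

cols-lengths : ∀ {n} w → length w ≡ n → HasLengths n (cols n w)
cols-lengths {n} w h = Allₚ.map⁺ (All.universal (λ j → trans (col-length j w) h) (upTo n))

col-≢ : ∀ {j x} l → j ≢ x → col j (x ∷ l) ≡ (j ℕ.<ᵇ x) ∷ col j l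
col-≢ l ne rewrite ≡ᵇ-false ne = refl

col-≡ : ∀ j l → col j (j ∷ l) ≡ replicate (suc (length l)) false
col-≡ j l rewrite ≡ᵇ-refl j = refl

private
  Ones-replicate : ∀ n → Ones 0 (replicate n false)
  Ones-replicate zero = []
  Ones-replicate (suc n) = zero (Ones-replicate n)

  swap-empty : ∀ i n → suc i < n → SwapColumn i (replicate n false) (replicate n false)
  swap-empty zero (suc (suc n)) _ = fix false
  swap-empty zero (suc zero) (s≤s ())
  swap-empty (suc i) (suc n) (s≤s h) = there false (swap-empty i n h)

  col-swap : ∀ {j c b} u v → j ≢ c → c < b → SwapColumn (length u) (col j (u ++ b ∷ c ∷ v)) (col j (u ++ c ∷ b ∷ v))
  col-swap {j} {c} {b} [] v j≢c c<b rewrite ≡ᵇ-false j≢c with j ℕ.≟ b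
  ... | yes refl rewrite ≡ᵇ-refl j | <ᵇ-false (ℕₚ.<-asym c<b) = fix false
  ... | no j≢b rewrite ≡ᵇ-false j≢b with j ℕ.<? c | j ℕ.<? b
  ...   | yes p | _ rewrite <ᵇ-true p | <ᵇ-true (ℕₚ.<-trans p c<b) = fix true
  ...   | no p | yes q rewrite <ᵇ-false p | <ᵇ-true q = move
  ...   | no p | no q rewrite <ᵇ-false p | <ᵇ-false q = fix false
  col-swap {j} {c} {b} (x ∷ u) v j≢c c<b with j ℕ.≡ᵇ x
  ... | true rewrite length-at u v c b b c = swap-empty (suc (length u)) _
    (s≤s (subst (suc (length u) <_) (sym (trans (Listₚ.length-++ u) (trans (ℕₚ.+-suc (length u) _) (cong suc (ℕₚ.+-suc (length u) _)))))
      (s≤s (s≤s (ℕₚ.m≤m+n (length u) (length v))))))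
  ... | false = there (j ℕ.<ᵇ x) (col-swap u v j≢c c<b)

  col-pivot : ∀ {c b} u v → All (c <_) u → c < b →
    Ones (suc (length u)) (col c (u ++ b ∷ c ∷ v)) × Ones (length u) (col c (u ++ c ∷ b ∷ v))
  col-pivot {c} {b} [] v [] c<b rewrite col-≢ (c ∷ v) (ℕₚ.<⇒≢ c<b) | <ᵇ-true c<b | ≡ᵇ-refl c =
    one (Ones-replicate (suc (length v))) , Ones-replicate (suc (suc (length v)))
  col-pivot {c} {b} (x ∷ u) v (c<x ∷ c<u) c<b rewrite ≡ᵇ-false (ℕₚ.<⇒≢ c<x) | <ᵇ-true c<x with col-pivot u v c<u c<b
  ... | o′ , o = one o′ , one o

cols-Step : ∀ {n c b} u v → All (c <_) u → c < b → c < n → Step (length u) (cols n (u ++ b ∷ c ∷ v)) (cols n (u ++ c ∷ b ∷ v))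
cols-Step {n} {c} {b} u v c<u c<b c<n = go (upTo n) (upTo⁺ n) (∈-upTo⁺ c<n)
  where
  w′ = u ++ b ∷ c ∷ v
  w = u ++ c ∷ b ∷ v
  rest : ∀ js → All (c ≢_) js → Pointwise (SwapColumn (length u)) (map (λ j → col j w′) js) (map (λ j → col j w) js)
  rest [] [] = []
  rest (j ∷ js) (c≢j ∷ ne) = col-swap u v (λ eq → c≢j (sym eq)) c<b ∷ rest js ne
  go : ∀ js → Unique js → c ∈ js → Step (length u) (map (λ j → col j w′) js) (map (λ j → col j w) js)
  go (j ∷ js) (ne ∷ un) (here refl) = let (o′ , o) = col-pivot u v c<u c<b in pivot o′ o (rest js ne)
  go (j ∷ js) (ne ∷ un) (there c∈) = col-swap u v (λ eq → All.lookup ne c∈ eq) c<b ∷ go js un c∈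

col-Decreasing : ∀ j {w} → Decreasing w → col j w ≡ map (j ℕ.<ᵇ_) w
col-Decreasing j [] = refl
col-Decreasing j {x ∷ l} (ps ∷ dec) with j ℕ.≟ x
... | yes refl = trans (col-≡ j l) (cong₂ _∷_ (sym (<ᵇ-false (ℕₚ.<-irrefl {j} refl))) (sym (nothing-above ps)))
  where
  nothing-above : ∀ {l} → All (_< j) l → map (j ℕ.<ᵇ_) l ≡ replicate (length l) false
  nothing-above [] = refl
  nothing-above (p ∷ ps) = cong₂ _∷_ (<ᵇ-false (ℕₚ.<-asym p)) (nothing-above ps)
... | no j≢x = trans (col-≢ l j≢x) (cong ((j ℕ.<ᵇ x) ∷_) (col-Decreasing j dec))

Ones-Decreasing : ∀ j {w} → Decreasing w → ∃ λ k → Ones k (map (j ℕ.<ᵇ_) w)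
Ones-Decreasing j [] = 0 , []
Ones-Decreasing j {x ∷ l} (ps ∷ dec) with j ℕ.<? x
... | yes p rewrite <ᵇ-true p = let (k , o) = Ones-Decreasing j dec in suc k , one o
... | no p rewrite <ᵇ-false p = 0 , zero (below ps)
  where
  below : ∀ {l} → All (_< x) l → Ones 0 (map (j ℕ.<ᵇ_) l)
  below [] = []
  below (q ∷ qs) rewrite <ᵇ-false (λ h → p (ℕₚ.<-trans h q)) = zero (below qs)

countBelow : ℕ → List ℕ → ℕ
countBelow x [] = 0
countBelow x (j ∷ js) = bit (j ℕ.<ᵇ x) + countBelow x js

countBelow-upTo : ∀ n g x x′ → (∀ k → (g k ℕ.<ᵇ x) ≡ (k ℕ.<ᵇ x′)) → x′ ≤ n → countBelow x (applyUpTo g n) ≡ x′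
countBelow-upTo zero g x zero h _ = refl
countBelow-upTo (suc n) g x zero h _ rewrite h 0 = countBelow-upTo n (g ∘ suc) x zero (λ k → h (suc k)) z≤n
countBelow-upTo (suc n) g x (suc x′) h (s≤s le) rewrite h 0 = cong suc (countBelow-upTo n (g ∘ suc) x x′ (λ k → h (suc k)) le)

total-below : ∀ {n} w js → length w ≡ n → total n (map (λ j → map (j ℕ.<ᵇ_) w) js) ≡ map (λ x → countBelow x js) w
total-below [] [] refl = refl
total-below (x ∷ w) [] refl = cong (0 ∷_) (total-below w [] refl)
total-below w (j ∷ js) h = trans (cong (val (map (j ℕ.<ᵇ_) w) ⊕_) (total-below w js h)) (add-row w)
  where
  add-row : ∀ w → val (map (j ℕ.<ᵇ_) w) ⊕ map (λ x → countBelow x js) w ≡ map (λ x → countBelow x (j ∷ js)) w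
  add-row [] = refl
  add-row (x ∷ w) = cong (_ ∷_) (add-row w)

map-fixed : ∀ {f : ℕ → ℕ} {w} → All (λ x → f x ≡ x) w → map f w ≡ w
map-fixed [] = refl
map-fixed (p ∷ ps) = cong₂ _∷_ p (map-fixed ps)

-- In a decreasing word the entry x has a box in each of the columns j < x. The word is therefore
-- its own weight, and for the longest word this is the staircase exponent.
total-Decreasing : ∀ {n w} → Decreasing w → All (_< n) w → length w ≡ n → total n (cols n w) ≡ w
total-Decreasing {n} {w} dec w<n h = trans (cong (total n) (Listₚ.map-cong (λ j → col-Decreasing j dec) (upTo n)))
  (trans (total-below w (upTo n) h)
    (map-fixed (All.map (λ {x} x<n → countBelow-upTo n id x x (λ _ → refl) (ℕₚ.<⇒≤ x<n)) w<n)))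

M-Decreasing : ∀ {n w} → Decreasing w → All (_< n) w → length w ≡ n → ∀ e → M n (cols n w) e → e ≡ w
M-Decreasing {n} {w} dec w<n h e (Bs , ds , refl) = trans (cong (total n) (unique (upTo n) ds)) (total-Decreasing dec w<n h)
  where
  unique : ∀ js {Bs} → Pointwise (Dom 0) (map (λ j → col j w) js) Bs → Bs ≡ map (λ j → col j w) js
  unique [] [] = refl
  unique (j ∷ js) (d ∷ ds) = cong₂ _∷_
    (Ones-unique (subst (Ones _) (sym (col-Decreasing j dec)) (proj₂ (Ones-Decreasing j dec))) d) (unique js ds)

M-Decreasing′ : ∀ {n w} → Decreasing w → All (_< n) w → length w ≡ n → M n (cols n w) w
M-Decreasing′ {n} {w} dec w<n h = cols n w , Pointwise.refl (λ {C} → Dom-refl C) , sym (total-Decreasing dec w<n h)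

Decreasing-length : ∀ {k w} → Decreasing w → All (_< k) w → length w ≤ k
Decreasing-length [] [] = z≤n
Decreasing-length (ps ∷ dec) (p ∷ _) = ℕₚ.≤-trans (s≤s (Decreasing-length dec ps)) p

Decreasing-downFrom : ∀ {w} → Decreasing w → All (_< length w) w → w ≡ downFrom (length w)
Decreasing-downFrom [] [] = refl
Decreasing-downFrom {x ∷ l} (ps ∷ dec) (p ∷ _) with ℕₚ.≤-antisym (ℕ.s≤s⁻¹ p) (Decreasing-length dec ps)
... | refl = cong (length l ∷_) (Decreasing-downFrom dec ps)

-- The induction along first ascents

swapAt-length : ∀ u {c b v} → swapAt (length u) (u ++ c ∷ b ∷ v) ≡ u ++ b ∷ c ∷ v
swapAt-length [] = refl
swapAt-length (x ∷ u) = cong (x ∷_) (swapAt-length u)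

record MultiplicityFree (n : ℕ) (w : List ℕ) : Set where
  field
    indS : Indicates (M n (cols n w)) n (𝔖 w)
    h    : Series
    indh : Indicates (Up n (cols n w)) n h
    𝔊≗  : 𝔊 w ≗ 𝔼 h

private
  unbump : ∀ r e {k} → at e r ≡ suc k → ∃ λ e′ → bump r e′ ≡ e × r < length e′
  unbump zero (suc a ∷ e) refl = a ∷ e , refl , s≤s z≤n
  unbump (suc r) (a ∷ e) h with unbump r e h
  ... | e′ , refl , lt = a ∷ e′ , refl , s≤s lt

  from-decreasing : ∀ {n w} → Decreasing w → All (_< n) w → length w ≡ n → MultiplicityFree n w
  from-decreasing {n} {w} dec w<n refl = record
    { indS = λ e _ → (λ mem → trans (𝔖≗ e) (cong (λ b → if b then 1ℤ else 0ℤ) (trans (cong (eqE w) (M-Decreasing dec w<n refl e mem)) (eqE-refl w)))) ,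
        (λ ¬mem → trans (𝔖≗ e) (S-out e ¬mem))
    ; h = above w
    ; indh = λ e _ → (λ (α , mem , le) → cong (λ b → if b then 1ℤ else 0ℤ) (leqE-complete (subst (_≤ₑ e) (M-Decreasing dec w<n refl α mem) le))) ,
        h-out e
    ; 𝔊≗ = λ e → trans (Groth.value-nothing w (Decreasing⇒firstAscent dec) e)
        (trans (cong (λ t → term 1ℤ t e) (sym (Decreasing-downFrom dec w<n))) (sym (𝔼-above w e))) }
    where
    𝔖≗ : 𝔖 w ≗ term 1ℤ w
    𝔖≗ e = trans (𝔖-Decreasing dec e) (cong (λ t → term 1ℤ t e) (sym (Decreasing-downFrom dec w<n)))
    S-out : ∀ e → ¬ M n (cols n w) e → term 1ℤ w e ≡ 0ℤ
    S-out e ¬mem with eqE w e in eq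
    ... | true = ⊥-elim (¬mem (subst (M n (cols n w)) (eqE-sound w e eq) (M-Decreasing′ dec w<n refl)))
    ... | false = refl
    h-out : ∀ e → ¬ Up n (cols n w) e → above w e ≡ 0ℤ
    h-out e ¬up with leqE w e in eq
    ... | true = ⊥-elim (¬up (w , M-Decreasing′ dec w<n refl , leqE-sound w e eq))
    ... | false = refl

multiplicity-free : ∀ m {n} w → ascents w < m → Unique w → All (_< n) w → length w ≡ n →
  (∀ e → length e ≡ n → 𝔖 w e ≤ᶻ 1ℤ) → MultiplicityFree n w
multiplicity-free (suc m) {n} w (s≤s w≤m) un w<n |w| S≤1 with view w un
... | decreasing dec = from-decreasing dec w<n |w|
... | first u c b v refl dec c<b fa = record { indS = Inv.indS ; h = Inv.h ; indh = Inv.indh ; 𝔊≗ = 𝔊≗h }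
  where
  r = length u
  w′ = u ++ b ∷ c ∷ v
  w′≡ : swapAt r w ≡ w′
  w′≡ = swapAt-length u
  |w′| : length w′ ≡ n
  |w′| = trans (trans (cong length (sym w′≡)) (length-swapAt r w)) |w|
  un′ : Unique w′
  un′ = subst Unique w′≡ (Unique-swapAt r un)
  r<n : suc r < n
  r<n = subst (suc r <_) |w| (Asc-length (firstAscent-Asc w fa))
  S′-bump : ∀ e → length e ≡ n → 𝔖 w′ (bump r e) ≤ᶻ 𝔖 w e
  S′-bump e |e| = ℤₚ.≤-trans (𝔖-covered u c b v un dec c<b (bump r e))
    (ℤₚ.≤-reflexive (X-bump r (𝔖 w) e (subst (r <_) (sym |e|) (ℕₚ.<-trans (ℕₚ.n<1+n r) r<n))))
  -- An exponent either is 0 at the position of the ascent, where xᵣ 𝔖 has coefficient 0, or arises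
  -- by a bump, where the bound for `w` applies.
  S′≤1 : ∀ e → length e ≡ n → 𝔖 w′ e ≤ᶻ 1ℤ
  S′≤1 e |e| with at e r in eq
  ... | zero = ℤₚ.≤-trans (ℤₚ.≤-trans (𝔖-covered u c b v un dec c<b e) (ℤₚ.≤-reflexive (X-at-0 r (𝔖 w) e eq))) (ℤ.+≤+ z≤n)
  ... | suc k with unbump r e eq
  ...   | e′ , refl , _ = let |e′| = trans (sym (bump-length r e′)) |e| in ℤₚ.≤-trans (S′-bump e′ |e′|) (S≤1 e′ |e′|)
  ih : MultiplicityFree n w′
  ih = multiplicity-free m w′ (ℕₚ.<-≤-trans (subst (λ t → ascents t < ascents w) w′≡ (ascents-swapAt (firstAscent-Asc w fa))) w≤m)
    un′ (subst (All (_< n)) w′≡ (All-swapAt r w<n)) |w′| S′≤1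
  module IH = MultiplicityFree ih
  module Inv = Invariant {n} {r} {cols n w′} {cols n w} r<n (cols-lengths w′ |w′|) (cols-lengths w |w|)
    (cols-Step u v (Decreasing-∷ʳ⁻ u dec) c<b (All.head (Allₚ.++⁻ʳ u w<n)))
    (𝔖 w′) (𝔖 w) IH.h (λ e → trans (𝔖-firstAscent w fa e) (cong (λ t → ∂ r (𝔖 t) e) w′≡))
    (λ e _ → 𝔖-nonneg w un e) S≤1 S′-bump IH.indS IH.indh
  𝔊≗h : 𝔊 w ≗ 𝔼 Inv.h
  𝔊≗h e = trans (𝔊-firstAscent w fa e) (trans (cong (λ t → ∂ r (1-X (suc r) (𝔊 t)) e) w′≡)
    (trans (∂-cong r (λ e′ → trans (cong₂ _-ᶻ_ (IH.𝔊≗ e′) (X-cong (suc r) IH.𝔊≗ e′)) (sym (𝔼-1-X (suc r) IH.h e′))) e)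
      (sym (𝔼-∂ r (1-X (suc r) IH.h) e))))

-- The degree bound

some : Column → Bool
some [] = false
some (c ∷ C) = c ∨ some C

close : Column → Column
close [] = []
close (c ∷ C) = (c ∨ some C) ∷ close C

closed : ℕ → List Column → Exp
closed n [] = replicate n 0
closed n (C ∷ cs) = val (close C) ⊕ closed n cs

close-length : ∀ C → length (close C) ≡ length C
close-length [] = refl
close-length (c ∷ C) = cong suc (close-length C)

closed-length : ∀ {n} cs → HasLengths n cs → length (closed n cs) ≡ n
closed-length {n} [] [] = Listₚ.length-replicate n
closed-length (C ∷ cs) (h ∷ hs) =
  ⊕-length (val (close C)) _ (trans (val-length (close C)) (trans (close-length C) h)) (closed-length cs hs)

bit≤1 : ∀ b → bit b ≤ 1
bit≤1 true = ℕₚ.≤-refl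
bit≤1 false = z≤n

⊕-mono : ∀ {u u′ v v′} → u ≤ₑ u′ → v ≤ₑ v′ → u ⊕ v ≤ₑ u′ ⊕ v′
⊕-mono [] [] = []
⊕-mono [] (_ ∷ _) = []
⊕-mono (_ ∷ _) [] = []
⊕-mono (p ∷ ps) (q ∷ qs) = ℕₚ.+-mono-≤ p q ∷ ⊕-mono ps qs

total≤closed : ∀ n cs → total n cs ≤ₑ closed n cs
total≤closed n [] = ≤ₑ-refl
total≤closed n (C ∷ cs) = ⊕-mono (val≤close C) (total≤closed n cs)
  where
  val≤close : ∀ C → val C ≤ₑ val (close C)
  val≤close [] = []
  val≤close (true ∷ C) = ℕₚ.≤-refl ∷ val≤close C
  val≤close (false ∷ C) = z≤n ∷ val≤close C

-- The case t = 1 is what f ↦ ∂ᵢ((1 - xᵢ₊₁) f) needs. The second exponent may grow by one but stays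
-- at most p, because q < p; then ∂ᵢ leaves both exponents at most p - 1, hence at most r and s. The
-- parameter t counts pivot columns and makes the relation additive over columns.
data Shrinks (t : ℕ) : ℕ → Exp → Exp → Set where
  here  : ∀ {p q r s e′ e} → t + q ≤ p → p ≤ t + r → p ≤ t + s → e′ ≤ₑ e → Shrinks t 0 (p ∷ q ∷ e′) (r ∷ s ∷ e)
  there : ∀ {i x y e′ e} → x ≤ y → Shrinks t i e′ e → Shrinks t (suc i) (x ∷ e′) (y ∷ e)

private
  Shrinks-⊕ : ∀ {t t′ i u u′ v v′} → Shrinks t i u′ u → Shrinks t′ i v′ v → Shrinks (t + t′) i (u′ ⊕ v′) (u ⊕ v)
  Shrinks-⊕ {t} {t′} (here {p} {q} {r} {s} a b c d) (here {p′} {q′} {r′} {s′} a′ b′ c′ d′) = here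
    (ℕₚ.≤-trans (ℕₚ.≤-reflexive (interchange t t′ q q′)) (ℕₚ.+-mono-≤ a a′))
    (ℕₚ.≤-trans (ℕₚ.+-mono-≤ b b′) (ℕₚ.≤-reflexive (interchange t r t′ r′)))
    (ℕₚ.≤-trans (ℕₚ.+-mono-≤ c c′) (ℕₚ.≤-reflexive (interchange t s t′ s′))) (⊕-mono d d′)
  Shrinks-⊕ (there p sh) (there q sh′) = there (ℕₚ.+-mono-≤ p q) (Shrinks-⊕ sh sh′)

  Shrinks-refl : ∀ i n → suc i < n → Shrinks 0 i (replicate n 0) (replicate n 0)
  Shrinks-refl zero (suc (suc n)) _ = here z≤n z≤n z≤n ≤ₑ-refl
  Shrinks-refl zero (suc zero) (s≤s ())
  Shrinks-refl (suc i) (suc n) (s≤s h) = there z≤n (Shrinks-refl i n h)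

  SwapColumn-some : ∀ {i C′ C} → SwapColumn i C′ C → some C′ ≡ some C
  SwapColumn-some (fix b) = refl
  SwapColumn-some move = refl
  SwapColumn-some (there b sw) = cong (b ∨_) (SwapColumn-some sw)

  Shrinks-SwapColumn : ∀ {i C′ C} → SwapColumn i C′ C → Shrinks 0 i (val (close C′)) (val (close C))
  Shrinks-SwapColumn (fix true) = here ℕₚ.≤-refl ℕₚ.≤-refl ℕₚ.≤-refl ≤ₑ-refl
  Shrinks-SwapColumn (fix false) = here ℕₚ.≤-refl ℕₚ.≤-refl ℕₚ.≤-refl ≤ₑ-refl
  Shrinks-SwapColumn (move {C}) = here (bit≤1 (some C)) ℕₚ.≤-refl ℕₚ.≤-refl ≤ₑ-refl
  Shrinks-SwapColumn (there b sw) = there (ℕₚ.≤-reflexive (cong (λ s → bit (b ∨ s)) (SwapColumn-some sw))) (Shrinks-SwapColumn sw)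

  Ones-some : ∀ {C} → Ones 0 C → some C ≡ false
  Ones-some [] = refl
  Ones-some (zero o) = Ones-some o

  Shrinks-pivot : ∀ {i S′ S} → length S′ ≡ length S → suc i < length S → Ones (suc i) S′ → Ones i S →
    Shrinks 1 i (val (close S′)) (val (close S))
  Shrinks-pivot h _ (one (zero o′)) (zero (zero o)) rewrite Ones-some o′ | Ones-some o =
    here ℕₚ.≤-refl ℕₚ.≤-refl ℕₚ.≤-refl (zeros (ℕₚ.suc-injective (ℕₚ.suc-injective h)) o′)
    where
    zeros : ∀ {C′ C} → length C′ ≡ length C → Ones 0 C′ → val (close C′) ≤ₑ val (close C)
    zeros {[]} {[]} _ [] = []
    zeros {_ ∷ C′} {c ∷ C} h (zero o) rewrite Ones-some o = z≤n ∷ zeros (ℕₚ.suc-injective h) o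
  Shrinks-pivot h (s≤s ()) _ (zero [])
  Shrinks-pivot h (s≤s lt) (one o′) (one o) = there ℕₚ.≤-refl (Shrinks-pivot (ℕₚ.suc-injective h) lt o′ o)

  Shrinks-columns : ∀ {n i cs′ cs} → suc i < n → Pointwise (SwapColumn i) cs′ cs → Shrinks 0 i (closed n cs′) (closed n cs)
  Shrinks-columns {n} {i} i<n [] = Shrinks-refl i n i<n
  Shrinks-columns i<n (sw ∷ sws) = Shrinks-⊕ (Shrinks-SwapColumn sw) (Shrinks-columns i<n sws)

Shrinks-Step : ∀ {n i cs′ cs} → suc i < n → HasLengths n cs′ → HasLengths n cs → Step i cs′ cs →
  Shrinks 1 i (closed n cs′) (closed n cs)
Shrinks-Step i<n (h′ ∷ _) (h ∷ _) (pivot o′ o sws) =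
  Shrinks-⊕ (Shrinks-pivot (trans h′ (sym h)) (subst (_ <_) (sym h) i<n) o′ o) (Shrinks-columns i<n sws)
Shrinks-Step i<n (_ ∷ hs′) (_ ∷ hs) (sw ∷ st) = Shrinks-⊕ (Shrinks-SwapColumn sw) (Shrinks-Step i<n hs′ hs st)

private
  -- Unfolding the recursion at (a, b) meets only points with a coordinate above b, since the second
  -- argument grows while the first shrinks.
  δ-support : ∀ u a b → δ u a b ≢ 0ℤ → ∃ λ x → ∃ λ y → u x y ≢ 0ℤ × (b < x ⊎ b < y)
  δ-support u zero b ≢0 with u (suc b) 0 ℤ.≟ 0ℤ | u 0 (suc b) ℤ.≟ 0ℤ
  ... | no p | _ = suc b , 0 , p , inj₁ ℕₚ.≤-refl
  ... | yes _ | no q = 0 , suc b , q , inj₂ ℕₚ.≤-refl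
  ... | yes p | yes q = ⊥-elim (≢0 (cong₂ _-ᶻ_ p q))
  δ-support u (suc a) b ≢0 with δ u a (suc b) ℤ.≟ 0ℤ | u (suc b) (suc a) ℤ.≟ 0ℤ | u (suc a) (suc b) ℤ.≟ 0ℤ
  ... | _ | no p | _ = suc b , suc a , p , inj₁ ℕₚ.≤-refl
  ... | _ | yes _ | no q = suc a , suc b , q , inj₂ ℕₚ.≤-refl
  ... | yes o | yes p | yes q = ⊥-elim (≢0 (cong₂ _+ᶻ_ o (cong₂ _-ᶻ_ p q)))
  ... | no o | yes _ | yes _ with δ-support u a (suc b) o
  ...   | x , y , ≢ , inj₁ lt = x , y , ≢ , inj₁ (ℕₚ.<-trans (ℕₚ.n<1+n b) lt)
  ...   | x , y , ≢ , inj₂ lt = x , y , ≢ , inj₂ (ℕₚ.<-trans (ℕₚ.n<1+n b) lt)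

  τ-support : ∀ g a b → τ g a b ≢ 0ℤ → ∃ λ x → ∃ λ y → g x y ≢ 0ℤ × (b < x ⊎ b ≤ y)
  τ-support g a b ≢0 with δ-support _ a b ≢0
  ... | x , zero , ≢ , inj₁ lt = x , 0 , (λ eq → ≢ (cong (_-ᶻ 0ℤ) eq)) , inj₁ lt
  ... | x , suc y , ≢ , lt with g x (suc y) ℤ.≟ 0ℤ | g x y ℤ.≟ 0ℤ | lt
  ...   | no p | _ | inj₁ h = x , suc y , p , inj₁ h
  ...   | no p | _ | inj₂ h = x , suc y , p , inj₂ (ℕₚ.<⇒≤ h)
  ...   | yes _ | no q | inj₁ h = x , y , q , inj₁ h
  ...   | yes _ | no q | inj₂ (s≤s h) = x , y , q , inj₂ h
  ...   | yes p | yes q | _ = ⊥-elim (≢ (cong₂ _-ᶻ_ p q))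

  shrink : ∀ P {i a b x y x′ y′ Q m′ m} → length P ≡ i → Shrinks 1 i m′ m →
    P ++ x ∷ y ∷ Q ≤ₑ m′ → P ++ x′ ∷ y′ ∷ Q ≤ₑ m′ → a < x ⊎ a ≤ y → b < x′ ⊎ b ≤ y′ → P ++ a ∷ b ∷ Q ≤ₑ m
  shrink [] refl (here {p} {q} q<p p≤r p≤s e) (x≤ ∷ y≤ ∷ e≤) (x′≤ ∷ y′≤ ∷ _) a≤ b≤ =
    ℕ.s≤s⁻¹ (ℕₚ.≤-trans (below x≤ y≤ a≤) p≤r) ∷ ℕ.s≤s⁻¹ (ℕₚ.≤-trans (below x′≤ y′≤ b≤) p≤s) ∷ ≤ₑ-trans e≤ e
    where
    below : ∀ {c x y} → x ≤ p → y ≤ q → c < x ⊎ c ≤ y → c < p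
    below x≤ y≤ (inj₁ h) = ℕₚ.<-≤-trans h x≤
    below x≤ y≤ (inj₂ h) = ℕₚ.≤-<-trans (ℕₚ.≤-trans h y≤) q<p
  shrink (z ∷ P) refl (there le sh) (z≤ ∷ r) (_ ∷ r′) a≤ b≤ = ℕₚ.≤-trans z≤ le ∷ shrink P refl sh r r′ a≤ b≤

  ∂-support : ∀ {i m′ m} f → Shrinks 1 i m′ m → (∀ e → f e ≢ 0ℤ → e ≤ₑ m′) →
    ∀ e → suc i < length e → ∂ i (1-X (suc i) f) e ≢ 0ℤ → e ≤ₑ m
  ∂-support {i} f sh bound e i<n ≢0 with split-at i e i<n
  ... | P , a , b , Q , refl , hP =
    let g = λ x y → f (P ++ x ∷ y ∷ Q)
        h≡ : ∂ i (1-X (suc i) f) (P ++ a ∷ b ∷ Q) ≡ τ g a b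
        h≡ = trans (∂-at P _ hP) (δ-cong (λ x y → cong (λ u → f (P ++ x ∷ y ∷ Q) -ᶻ u) (X-at P f hP)) a b)
        (x′ , y′ , ≢′ , b≤) = τ-support g a b (λ eq → ≢0 (trans h≡ eq))
        -- `τ-support` bounds only the second exponent; the symmetry of divided differences
        -- transfers the bound to the first.
        (x , y , ≢ , a≤) = τ-support g b a (λ eq → ≢0 (trans h≡ (trans (δ-sym _ a b) eq)))
    in shrink P hP sh (bound _ ≢) (bound _ ≢′) a≤ b≤

𝔊-support : ∀ m {n} w → ascents w < m → Unique w → All (_< n) w → length w ≡ n →
  ∀ e → 𝔊 w e ≢ 0ℤ → e ≤ₑ closed n (cols n w)
𝔊-support (suc m) {n} w (s≤s w≤m) un w<n |w| e ≢0 with view w un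
... | decreasing dec = subst (_≤ₑ closed n (cols n w)) (sym e≡w)
    (subst (_≤ₑ closed n (cols n w)) (total-Decreasing dec w<n |w|) (total≤closed n (cols n w)))
  where
  e≡w : e ≡ w
  e≡w with eqE w e in eq
  ... | true = sym (eqE-sound w e eq)
  ... | false = ⊥-elim (≢0 (trans (Groth.value-nothing w (Decreasing⇒firstAscent dec) e)
    (trans (cong (λ t → term 1ℤ t e) (sym (Decreasing-downFrom dec (subst (λ k → All (_< k) w) (sym |w|) w<n))))
      (cong (λ b → if b then 1ℤ else 0ℤ) eq))))
... | first u c b v refl dec c<b fa =
  ∂-support (𝔊 w′) (Shrinks-Step r<n (cols-lengths w′ |w′|) (cols-lengths w |w|)
      (cols-Step u v (Decreasing-∷ʳ⁻ u dec) c<b (All.head (Allₚ.++⁻ʳ u w<n))))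
    (𝔊-support m w′ (ℕₚ.<-≤-trans (subst (λ t → ascents t < ascents w) w′≡ (ascents-swapAt (firstAscent-Asc w fa))) w≤m)
      (subst Unique w′≡ (Unique-swapAt r un)) (subst (All (_< n)) w′≡ (All-swapAt r w<n)) |w′|)
    e (subst (suc r <_) (sym |e|) r<n)
    (λ eq → ≢0 (trans (𝔊-firstAscent w fa e) (trans (cong (λ t → ∂ r (1-X (suc r) (𝔊 t)) e) w′≡) eq)))
  where
  r = length u
  w′ = u ++ b ∷ c ∷ v
  w′≡ : swapAt r w ≡ w′
  w′≡ = swapAt-length u
  |w′| : length w′ ≡ n
  |w′| = trans (trans (cong length (sym w′≡)) (length-swapAt r w)) |w|
  r<n : suc r < n
  r<n = subst (suc r <_) |w| (Asc-length (firstAscent-Asc w fa))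
  |e| : length e ≡ n
  |e| with length e ℕ.≟ length w
  ... | yes eq = trans eq |w|
  ... | no ne = ⊥-elim (≢0 (𝔊-length w e ne))

-- Sums over boxes and the Möbius function

-- Division by ∏ (1 - xⱼ) on coefficients, in a form that matches sums over `box`.
cumulate : Series → Series
cumulate f [] = f []
cumulate f (b ∷ e) = sumTo (suc b) (λ x → cumulate (λ e′ → f (x ∷ e′)) e)

cumulate-cong : ∀ {f g} e → (∀ γ → γ ≤ₑ e → f γ ≡ g γ) → cumulate f e ≡ cumulate g e
cumulate-cong [] h = h [] []
cumulate-cong (b ∷ e) h = sumTo-cong (suc b) (λ { x (s≤s x≤b) → cumulate-cong e (λ γ le → h (x ∷ γ) (x≤b ∷ le)) })

sumTo-minus : ∀ m φ ψ → sumTo m (λ k → φ k -ᶻ ψ k) ≡ sumTo m φ -ᶻ sumTo m ψ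
sumTo-minus zero φ ψ = refl
sumTo-minus (suc m) φ ψ = trans (cong (_+ᶻ (φ m -ᶻ ψ m)) (sumTo-minus m φ ψ)) (sum-of-subs (sumTo m φ) _ _ _)

cumulate-minus : ∀ f g e → cumulate (λ γ → f γ -ᶻ g γ) e ≡ cumulate f e -ᶻ cumulate g e
cumulate-minus f g [] = refl
cumulate-minus f g (b ∷ e) = trans (sumTo-cong (suc b) (λ x _ → cumulate-minus _ _ e))
  (sumTo-minus (suc b) (λ x → cumulate (λ e′ → f (x ∷ e′)) e) (λ x → cumulate (λ e′ → g (x ∷ e′)) e))

cumulate-zero : ∀ e → cumulate (λ _ → 0ℤ) e ≡ 0ℤ
cumulate-zero [] = refl
cumulate-zero (b ∷ e) = trans (sumTo-cong (suc b) (λ _ _ → cumulate-zero e)) (sumTo-zero (suc b))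

cumulate-𝔼 : ∀ h e → cumulate (𝔼 h) e ≡ h e
cumulate-𝔼 h [] = refl
cumulate-𝔼 h (b ∷ e) = telescope b
  where
  telescope : ∀ b → sumTo (suc b) (λ x → cumulate (λ e′ → 𝔼 h (x ∷ e′)) e) ≡ h (b ∷ e)
  telescope zero = trans (ℤₚ.+-identityˡ _) (cumulate-𝔼 _ e)
  telescope (suc b) = trans (cong₂ _+ᶻ_ (telescope b)
    (trans (cumulate-minus _ _ e) (cong₂ _-ᶻ_ (cumulate-𝔼 _ e) (cumulate-𝔼 _ e))))
    (cancel (h (b ∷ e)) (h (suc b ∷ e)))
    where
    cancel : ∀ p q → p +ᶻ (q -ᶻ p) ≡ q
    cancel = solve-∀

𝔼-vanishing : ∀ h e → (∀ γ → γ ≤ₑ e → h γ ≡ 0ℤ) → 𝔼 h e ≡ 0ℤ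
𝔼-vanishing h [] v = v [] []
𝔼-vanishing h (zero ∷ e) v = 𝔼-vanishing _ e (λ γ le → v _ (z≤n ∷ le))
𝔼-vanishing h (suc a ∷ e) v = cong₂ _-ᶻ_
  (𝔼-vanishing _ e (λ γ le → v _ (ℕₚ.≤-refl ∷ le))) (𝔼-vanishing _ e (λ γ le → v _ (ℕₚ.n≤1+n a ∷ le)))

sumTo-truncate : ∀ m b φ → b ≤ m → (∀ x → b < x → φ x ≡ 0ℤ) → sumTo (suc m) φ ≡ sumTo (suc b) φ
sumTo-truncate m b φ b≤m v with ℕₚ.m≤n⇒m<n∨m≡n b≤m
... | inj₂ refl = refl
... | inj₁ b<m with m | b<m
...   | suc m′ | lt@(s≤s b≤m′) = trans (cong₂ _+ᶻ_ (sumTo-truncate m′ b φ b≤m′ v) (v (suc m′) lt)) (ℤₚ.+-identityʳ _)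

cumulate-≤ : ∀ (g : Series) {β m} → β ≤ₑ m → cumulate (λ γ → if leqE γ β then g γ else 0ℤ) m ≡ cumulate g β
cumulate-≤ g [] = refl
cumulate-≤ g {b ∷ β} {m₀ ∷ m} (b≤m₀ ∷ le) = trans
  (sumTo-truncate m₀ b _ b≤m₀ (λ x b<x → trans (cumulate-cong m (λ γ _ → cong (λ t → if t ∧ leqE γ β then g (x ∷ γ) else 0ℤ) (≤ᵇ-false (ℕₚ.<⇒≱ b<x)))) (cumulate-zero m)))
  (sumTo-cong (suc b) λ { x (s≤s x≤b) → trans
    (cumulate-cong m (λ γ _ → cong (λ t → if t ∧ leqE γ β then g (x ∷ γ) else 0ℤ) (≤ᵇ-true x≤b))) (cumulate-≤ (λ γ → g (x ∷ γ)) le) })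

cumulate-≡ : ∀ (g : Series) {β m} → β ≤ₑ m → cumulate (λ γ → if eqE γ β then g γ else 0ℤ) m ≡ g β
cumulate-≡ g [] = refl
cumulate-≡ g {b ∷ β} {m₀ ∷ m} (b≤m₀ ∷ le) = trans (sumTo-truncate m₀ b _ b≤m₀ (λ x b<x → off x (λ eq → ℕₚ.<-irrefl (sym eq) b<x)))
  (trans (cong₂ _+ᶻ_ (trans (sumTo-cong b (λ x x<b → off x (ℕₚ.<⇒≢ x<b))) (sumTo-zero b)) on) (ℤₚ.+-identityˡ _))
  where
  off : ∀ x → x ≢ b → cumulate (λ γ → if eqE (x ∷ γ) (b ∷ β) then g (x ∷ γ) else 0ℤ) m ≡ 0ℤ
  off x ne = trans (cumulate-cong m (λ γ _ → cong (λ t → if t ∧ eqE γ β then g (x ∷ γ) else 0ℤ) (≡ᵇ-false ne))) (cumulate-zero m)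
  on : cumulate (λ γ → if eqE (b ∷ γ) (b ∷ β) then g (b ∷ γ) else 0ℤ) m ≡ g (b ∷ β)
  on = trans (cumulate-cong m (λ γ _ → cong (λ t → if t ∧ eqE γ β then g (b ∷ γ) else 0ℤ) (≡ᵇ-refl b))) (cumulate-≡ (λ γ → g (b ∷ γ)) le)

sumℤ-++ : ∀ xs ys → sumℤ (xs ++ ys) ≡ sumℤ xs +ᶻ sumℤ ys
sumℤ-++ [] ys = sym (ℤₚ.+-identityˡ _)
sumℤ-++ (x ∷ xs) ys = trans (cong (x +ᶻ_) (sumℤ-++ xs ys)) (sym (ℤₚ.+-assoc x _ _))

sum-filterB : ∀ (F : Series) q xs → sumℤ (map F (filterB q xs)) ≡ sumℤ (map (λ x → if q x then F x else 0ℤ) xs)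
sum-filterB F q [] = refl
sum-filterB F q (x ∷ xs) with q x
... | true = cong (F x +ᶻ_) (sum-filterB F q xs)
... | false = trans (sum-filterB F q xs) (sym (ℤₚ.+-identityˡ _))

sum-box : ∀ F e → sumℤ (map F (box e)) ≡ cumulate F e
sum-box F [] = ℤₚ.+-identityʳ _
sum-box F (b ∷ e) = trans (slabs (upTo (suc b)))
  (trans (cong sumℤ (Listₚ.map-upTo (λ x → cumulate (λ e′ → F (x ∷ e′)) e) (suc b))) (sum-applyUpTo (λ x → cumulate (λ e′ → F (x ∷ e′)) e) (suc b)))
  where
  slabs : ∀ xs → sumℤ (map F (concatMap (λ x → map (x ∷_) (box e)) xs)) ≡ sumℤ (map (λ x → cumulate (λ e′ → F (x ∷ e′)) e) xs)
  slabs [] = refl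
  slabs (x ∷ xs) = trans (cong sumℤ (Listₚ.map-++ F (map (x ∷_) (box e)) _)) (trans (sumℤ-++ (map F (map (x ∷_) (box e))) _)
    (cong₂ _+ᶻ_ (trans (cong sumℤ (sym (Listₚ.map-∘ (box e)))) (sum-box (λ e′ → F (x ∷ e′)) e)) (slabs xs)))

module Möbius (m : Exp) (p : Exp → Bool) (g : Series)
  (supported : ∀ γ → p γ ≡ false → g γ ≡ 0ℤ) (bounded : ∀ γ → g γ ≢ 0ℤ → γ ≤ₑ m)
  (cumulative : ∀ β → β ≤ₑ m → p β ≡ true → cumulate g β ≡ 1ℤ) where

  P : List Exp
  P = filterB p (box m)

  sum-P : ∀ F → sumℤ (map F P) ≡ cumulate (λ γ → if p γ then F γ else 0ℤ) m
  sum-P F = trans (sum-filterB F p (box m)) (sum-box _ m)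

  -- The values of `g` at all γ < β sum to 1 - g β, so -g satisfies the recursion that defines the
  -- Möbius function. Summing over the whole box rather than over `P` is harmless, since `g`
  -- vanishes off `P`.
  muF≡-g : ∀ f β → β ≤ₑ m → p β ≡ true → entrySum β < f → muF f P β ≡ -ᶻ g β
  muF≡-g (suc f) β β≤m pβ (s≤s le) = trans (cong (λ s → -ᶻ (1ℤ +ᶻ s)) below) (cancel (g β))
    where
    cancel : ∀ u → -ᶻ (1ℤ +ᶻ (u -ᶻ 1ℤ)) ≡ -ᶻ u
    cancel = solve-∀
    smaller : ∀ γ → γ ≤ₑ β → eqE γ β ≡ false → entrySum γ < entrySum β
    smaller γ γ≤β ne with ℕₚ.m≤n⇒m<n∨m≡n (entrySum-mono γ≤β)
    ... | inj₁ lt = lt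
    ... | inj₂ eq with ≤ₑ-antisym-sum γ≤β (ℕₚ.≤-reflexive (sym eq))
    ...   | refl with trans (sym (eqE-refl γ)) ne
    ...     | ()
    -- The strict order is rewritten as the difference of the indicators of γ = β and γ ≤ β, whose
    -- sums over the box are known separately.
    pointwise : ∀ γ → γ ≤ₑ m → (if p γ then (if ltE γ β then muF f P γ else 0ℤ) else 0ℤ) ≡
      (if eqE γ β then g γ else 0ℤ) -ᶻ (if leqE γ β then g γ else 0ℤ)
    pointwise γ γ≤m with p γ in pγ
    ... | false rewrite supported γ pγ with eqE γ β | leqE γ β
    ...   | true | true = refl
    ...   | true | false = refl
    ...   | false | true = refl
    ...   | false | false = refl
    pointwise γ γ≤m | true with leqE γ β in lγ | eqE γ β in eγ
    ...   | true | true = sym (ℤₚ.i≡j⇒i-j≡0 {g γ} refl)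
    ...   | true | false = trans (muF≡-g f γ γ≤m pγ (ℕₚ.<-≤-trans (smaller γ (leqE-sound γ β lγ) eγ) le)) (sym (ℤₚ.+-identityˡ _))
    ...   | false | false = refl
    ...   | false | true with eqE-sound γ β eγ
    ...     | refl with trans (sym lγ) (leqE-complete (≤ₑ-refl {γ}))
    ...       | ()
    below : sumℤ (map (muF f P) (filterB (λ γ → ltE γ β) P)) ≡ g β -ᶻ 1ℤ
    below = trans (sum-filterB (muF f P) (λ γ → ltE γ β) P) (trans (sum-P _) (trans (cumulate-cong m pointwise)
      (trans (cumulate-minus _ _ m) (cong₂ _-ᶻ_ (cumulate-≡ g β≤m) (trans (cumulate-≤ g β≤m) (cumulative β β≤m pβ))))))

  coeff-Möbius : ∀ α → coeff (map (λ β → (-ᶻ muF (suc (entrySum β)) P β , β)) P) α ≡ g α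
  coeff-Möbius α = trans (cong sumℤ (sym (Listₚ.map-∘ P))) (trans (sum-P _) (trans (cumulate-cong m pointwise) extract))
    where
    pointwise : ∀ β → β ≤ₑ m → (if p β then (if eqE β α then -ᶻ muF (suc (entrySum β)) P β else 0ℤ) else 0ℤ) ≡
      (if eqE β α then g β else 0ℤ)
    pointwise β β≤m with p β in pβ | eqE β α
    ... | true | true = trans (cong -ᶻ_ (muF≡-g (suc (entrySum β)) β β≤m pβ ℕₚ.≤-refl)) (ℤₚ.neg-involutive (g β))
    ... | true | false = refl
    ... | false | true = sym (supported β pβ)
    ... | false | false = refl
    extract : cumulate (λ β → if eqE β α then g β else 0ℤ) m ≡ g α
    extract with leqE α m in α≤m
    ... | true = cumulate-≡ g (leqE-sound α m α≤m)
    ... | false with g α ℤ.≟ 0ℤ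
    ...   | no ne with trans (sym (leqE-complete (bounded α ne))) α≤m
    ...     | ()
    extract | false | yes eq = trans (cumulate-cong m vanish) (trans (cumulate-zero m) (sym eq))
      where
      vanish : ∀ β → β ≤ₑ m → (if eqE β α then g β else 0ℤ) ≡ 0ℤ
      vanish β β≤m with eqE β α in e
      ... | false = refl
      ... | true with eqE-sound β α e
      ...   | refl = eq

-- From permutations to words

entry : Column → ℕ → Bool
entry [] k = false
entry (c ∷ C) zero = c
entry (c ∷ C) (suc k) = entry C k

private
  at-oneLine : ∀ {A : Set} {n} (f : A → ℕ) (g : Fin n → A) i → at (map f (tabulate g)) (toℕ i) ≡ f (g i)
  at-oneLine f g Fin.zero = refl
  at-oneLine f g (Fin.suc i) = at-oneLine f (g ∘ Fin.suc) i

  at-word : ∀ {n} (w : Permutation′ n) i → at (oneLine w) (toℕ i) ≡ toℕ (w ⟨$⟩ʳ i)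
  at-word w i = at-oneLine (λ i → toℕ (w ⟨$⟩ʳ i)) id i

  length-oneLine : ∀ {n} (w : Permutation′ n) → length (oneLine w) ≡ n
  length-oneLine {n} w = trans (Listₚ.length-map _ (allFin n)) (Listₚ.length-tabulate id)

  oneLine-Unique : ∀ {n} (w : Permutation′ n) → Unique (oneLine w)
  oneLine-Unique {n} w = Unique-map⁺ (λ {i} {j} eq → trans (sym (inverseˡ w)) (trans (cong (w ⟨$⟩ˡ_) (Finₚ.toℕ-injective eq)) (inverseˡ w))) (allFin⁺ n)

  oneLine-< : ∀ {n} (w : Permutation′ n) → All (_< n) (oneLine w)
  oneLine-< {n} w = Allₚ.map⁺ (All.universal (λ i → Finₚ.toℕ<n (w ⟨$⟩ʳ i)) (allFin n))

  entry-length : ∀ C k → entry C k ≡ true → k < length C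
  entry-length (c ∷ C) zero _ = s≤s z≤n
  entry-length (c ∷ C) (suc k) h = s≤s (entry-length C k h)

  entry-replicate : ∀ n k → entry (replicate n false) k ≢ true
  entry-replicate (suc n) (suc k) h = entry-replicate n k h

  entry-some : ∀ C → some C ≡ true → ∃ λ k → entry C k ≡ true
  entry-some (true ∷ C) _ = 0 , refl
  entry-some (false ∷ C) h = let (k , e) = entry-some C h in suc k , e

  entry-close : ∀ C k → entry (close C) k ≡ true → ∃ λ k′ → k ≤ k′ × entry C k′ ≡ true
  entry-close (c ∷ C) zero h = let (k , e) = entry-some (c ∷ C) h in k , z≤n , e
  entry-close (c ∷ C) (suc k) h = let (k′ , le , e) = entry-close C k h in suc k′ , s≤s le , e

  entry-col : ∀ j l k → entry (col j l) k ≡ true → j < at l k × (∀ q → q ≤ k → j ≢ at l q)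
  entry-col j (x ∷ l) k h with j ℕ.≟ x
  ... | yes refl rewrite col-≡ j l = ⊥-elim (entry-replicate (suc (length l)) k h)
  ... | no ne rewrite col-≢ l ne with k | h
  ...   | zero | h′ = <ᵇ-sound h′ , λ { zero _ → ne }
  ...   | suc k′ | h′ = let (lt , av) = entry-col j l k′ h′ in lt , λ { zero _ → ne ; (suc q) (s≤s le) → av q le }

  anyB-intro : ∀ {A : Set} (q : A → Bool) {x xs} → x ∈ xs → q x ≡ true → anyB q xs ≡ true
  anyB-intro q (here refl) h rewrite h = refl
  anyB-intro q {xs = y ∷ xs} (there x∈) h with q y
  ... | true = refl
  ... | false = anyB-intro q x∈ h

  closed-Rothe : ∀ {n} (w : Permutation′ n) i j → entry (close (col (toℕ j) (oneLine w))) (toℕ i) ≡ true → inClosedRothe w i j ≡ true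
  closed-Rothe {n} w i j h with entry-close (col (toℕ j) (oneLine w)) (toℕ i) h
  ... | k , i≤k , e with entry-col (toℕ j) (oneLine w) k e
  ...   | j<wk , avoid = anyB-intro _ (∈-allFin kF)
    (cong₂ _∧_ (≤ᵇ-true (subst (toℕ i ≤_) (sym kF≡) i≤k)) (cong₂ _∧_
      (<ᵇ-true (subst (toℕ j <_) (trans (cong (at (oneLine w)) (sym kF≡)) (at-word w kF)) j<wk))
      -- If j stood at or before row k, it would be among the entries that differ from j because the
      -- column has a box in row k.
      (<ᵇ-true (subst (_< toℕ (w ⟨$⟩ˡ j)) (sym kF≡) (ℕₚ.≰⇒> λ le →
        avoid (toℕ (w ⟨$⟩ˡ j)) le (sym (trans (at-word w (w ⟨$⟩ˡ j)) (cong toℕ (inverseʳ w)))))))))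
    where
    k<n : k < n
    k<n = subst (k <_) (trans (col-length (toℕ j) (oneLine w)) (length-oneLine w)) (entry-length (col (toℕ j) (oneLine w)) k e)
    kF : Fin n
    kF = fromℕ< k<n
    kF≡ : toℕ kF ≡ k
    kF≡ = Finₚ.toℕ-fromℕ< k<n

  at-val : ∀ C k → at (val C) k ≡ bit (entry C k)
  at-val [] k = refl
  at-val (c ∷ C) zero = refl
  at-val (c ∷ C) (suc k) = at-val C k

  at-closed : ∀ {n} {A : Set} (F : A → Column) js k → HasLengths n (map F js) →
    at (closed n (map F js)) k ≡ countB (λ j → entry (close (F j)) k) js
  at-closed {n} F [] k _ = at-replicate n k
  at-closed {n} F (j ∷ js) k (h ∷ hs) = trans
    (at-⊕ (val (close (F j))) _ k (trans (val-length (close (F j))) (trans (trans (close-length (F j)) h) (sym (closed-length (map F js) hs)))))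
    (trans (cong₂ _+_ (at-val (close (F j)) k) (at-closed F js k hs)) (count (entry (close (F j)) k) refl))
    where
    count : ∀ b → entry (close (F j)) k ≡ b → bit b + countB (λ j → entry (close (F j)) k) js ≡ countB (λ j → entry (close (F j)) k) (j ∷ js)
    count true eq rewrite eq = refl
    count false eq rewrite eq = refl

  countB-mono : ∀ {A : Set} (q r : A → Bool) xs → (∀ x → q x ≡ true → r x ≡ true) → countB q xs ≤ countB r xs
  countB-mono q r [] h = z≤n
  countB-mono q r (x ∷ xs) h with q x in qx | r x in rx
  ... | true | true = s≤s (countB-mono q r xs h)
  ... | false | true = ℕₚ.m≤n⇒m≤1+n (countB-mono q r xs h)
  ... | false | false = countB-mono q r xs h
  ... | true | false with trans (sym rx) (h x qx)
  ...   | ()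

  ≤ₑ-ext : ∀ e f → length e ≡ length f → (∀ k → k < length f → at e k ≤ at f k) → e ≤ₑ f
  ≤ₑ-ext [] [] _ _ = []
  ≤ₑ-ext (a ∷ e) (b ∷ f) h le = le 0 (s≤s z≤n) ∷ ≤ₑ-ext e f (ℕₚ.suc-injective h) (λ k lt → le (suc k) (s≤s lt))

  upTo≡allFin : ∀ n → upTo n ≡ map toℕ (allFin n)
  upTo≡allFin n = go n id
    where
    go : ∀ n (g : ℕ → ℕ) → applyUpTo g n ≡ map (g ∘ toℕ) (allFin n)
    go zero g = refl
    go (suc n) g = cong (g 0 ∷_) (trans (go n (g ∘ suc)) (trans (Listₚ.map-tabulate {n = n} id (g ∘ suc ∘ toℕ)) (sym (Listₚ.map-tabulate {n = n} Fin.suc (g ∘ toℕ)))))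

closed≤wtClosed : ∀ {n} (w : Permutation′ n) → closed n (cols n (oneLine w)) ≤ₑ wtClosed w
closed≤wtClosed {n} w = ≤ₑ-ext _ _ (trans (closed-length (cols n l) hs) (sym |wt|)) entrywise
  where
  l = oneLine w
  hs = cols-lengths {n} l (length-oneLine w)
  |wt| : length (wtClosed w) ≡ n
  |wt| = trans (Listₚ.length-map _ (allFin n)) (Listₚ.length-tabulate id)
  cols≡ : cols n l ≡ map (λ j → col (toℕ j) l) (allFin n)
  cols≡ = trans (cong (map (λ j → col j l)) (upTo≡allFin n)) (sym (Listₚ.map-∘ (allFin n)))
  at-row : ∀ i → at (closed n (cols n l)) (toℕ i) ≤ at (wtClosed w) (toℕ i)
  at-row i = subst₂ _≤_
    (sym (trans (cong (λ cs → at (closed n cs) (toℕ i)) cols≡) (at-closed (λ j → col (toℕ j) l) (allFin n) (toℕ i) (subst (HasLengths n) cols≡ hs))))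
    (sym (at-oneLine (λ i → countB (inClosedRothe w i) (allFin n)) id i))
    (countB-mono _ _ (allFin n) (λ j → closed-Rothe w i j))
  entrywise : ∀ k → k < length (wtClosed w) → at (closed n (cols n l)) k ≤ at (wtClosed w) k
  entrywise k k< = subst (λ k → at (closed n (cols n l)) k ≤ at (wtClosed w) k) (Finₚ.toℕ-fromℕ< k<n) (at-row (fromℕ< k<n))
    where k<n = subst (k <_) |wt| k<

-- The first entry starts at most `length l` increasing pairs. The added length gives the margin
-- that makes the fuel strictly sufficient for a nonempty word.
ascents-bound : ∀ l → ascents l + length l ≤ length l * length l
ascents-bound [] = z≤n
ascents-bound (x ∷ l) = begin
  countAbove x l + ascents l + suc (length l)   ≤⟨ ℕₚ.+-monoˡ-≤ (suc (length l)) (ℕₚ.+-monoˡ-≤ (ascents l) (count x l)) ⟩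
  length l + ascents l + suc (length l)         ≡⟨ rearrange (length l) (ascents l) ⟩
  suc (length l + (ascents l + length l))       ≤⟨ s≤s (ℕₚ.+-monoʳ-≤ (length l) (ascents-bound l)) ⟩
  suc (length l + length l * length l)          ≤⟨ s≤s (ℕₚ.+-monoʳ-≤ (length l) (ℕₚ.*-monoʳ-≤ (length l) (ℕₚ.n≤1+n _))) ⟩
  suc (length l) * suc (length l)               ∎
  where
  open ℕₚ.≤-Reasoning
  rearrange : ∀ m a → m + a + suc m ≡ suc (m + (a + m))
  rearrange = ℕsolve-∀
  count : ∀ x l → countAbove x l ≤ length l
  count x [] = z≤n
  count x (y ∷ l) with x ℕ.<ᵇ y
  ... | true = s≤s (count x l)
  ... | false = ℕₚ.m≤n⇒m≤1+n (count x l)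

support-nonzero : ∀ (p : Poly) α → α ∈ support p → coeff p α ≢ 0ℤ
support-nonzero p α = go p
  where
  positive≢0 : ∀ {k} → ℤ.+ suc k ≢ 0ℤ
  positive≢0 ()
  negative≢0 : ∀ {k} → ℤ.-[1+ k ] ≢ 0ℤ
  negative≢0 ()
  go : ∀ q → α ∈ map proj₂ (filterB (λ t → not (isZeroℤ (coeff p (proj₂ t)))) q) → coeff p α ≢ 0ℤ
  go ((c , e) ∷ q) α∈ with coeff p e in eq
  go ((c , e) ∷ q) α∈ | ℤ.+ zero = go q α∈
  go ((c , e) ∷ q) (here refl) | ℤ.+ suc k = λ h → positive≢0 (trans (sym eq) h)
  go ((c , e) ∷ q) (there α∈) | ℤ.+ suc k = go q α∈
  go ((c , e) ∷ q) (here refl) | ℤ.-[1+ k ] = λ h → negative≢0 (trans (sym eq) h)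
  go ((c , e) ∷ q) (there α∈) | ℤ.-[1+ k ] = go q α∈

nonzero-support : ∀ (p : Poly) α → coeff p α ≢ 0ℤ → α ∈ support p
nonzero-support p α ≢0 = Anyₚ.map⁺ (Any.map sym (filterB-Any _ (occurs p ≢0) (λ { (c , .α) refl → kept (coeff p α) ≢0 })))
  where
  occurs : ∀ q → coeff q α ≢ 0ℤ → Any (λ t → proj₂ t ≡ α) q
  occurs [] h = ⊥-elim (h refl)
  occurs ((c , e) ∷ q) h with eqE e α in eq
  ... | true = here (eqE-sound e α eq)
  ... | false = there (occurs q (λ z → h (trans (ℤₚ.+-identityˡ _) z)))
  kept : ∀ z → z ≢ 0ℤ → not (isZeroℤ z) ≡ true
  kept (ℤ.+ zero) h = ⊥-elim (h refl)
  kept (ℤ.+ suc k) _ = refl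
  kept ℤ.-[1+ k ] _ = refl
  filterB-Any : ∀ {A : Set} {Q : A → Set} (q : A → Bool) {xs} → Any Q xs → (∀ x → Q x → q x ≡ true) → Any Q (filterB q xs)
  filterB-Any q {x ∷ xs} (here Qx) h rewrite h x Qx = here Qx
  filterB-Any q {x ∷ xs} (there a) h with q x
  ... | true = there (filterB-Any q a h)
  ... | false = filterB-Any q a h

anyB-elim : ∀ {A : Set} (q : A → Bool) xs → anyB q xs ≡ true → ∃ λ x → x ∈ xs × q x ≡ true
anyB-elim q (x ∷ xs) h with q x in eq
... | true = x , here refl , eq
... | false = let (y , y∈ , e) = anyB-elim q xs h in y , there y∈ , e

private
  to-Vec : ∀ {n} e → length e ≡ n → ∃ λ (α : Vec ℕ n) → toList α ≡ e
  to-Vec e refl = fromList e , Vecₚ.toList∘fromList e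

theorem1p1 : (n : ℕ) → 1 ≤ n → (w : Permutation′ n)
    → ((α : Vec ℕ n) → coeff (Schubert n w) (toList α) ≢ 0ℤ
    → coeff (Schubert n w) (toList α) ≡ 1ℤ)
    → (α : Vec ℕ n)
    → coeff (Grothendieck n w) (toList α) ≡ coeff (mobiusPoly n w) (toList α)
theorem1p1 n 1≤n w zero-one α = sym (Möb.coeff-Möbius (toList α))
  where
  l = oneLine w
  |l| = length-oneLine w
  fuel : ascents l < n * n
  -- The length summand of `ascents-bound` is at least 1 because n ≥ 1, which makes the inequality
  -- strict.
  fuel = subst (λ k → ascents l < k * k) |l| (ℕₚ.≤-trans
    (ℕₚ.≤-trans (ℕₚ.≤-reflexive (ℕₚ.+-comm 1 (ascents l))) (ℕₚ.+-monoʳ-≤ (ascents l) (subst (1 ≤_) (sym |l|) 1≤n))) (ascents-bound l))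
  Schubert≡ : Schubert n w ≡ Schub.value l
  Schubert≡ = trans (Schub.fuel-irrelevant n (n * n) (suc (ascents l)) l fuel ℕₚ.≤-refl) (cong (λ k → schubF k (suc (ascents l)) l) (sym |l|))
  Grothendieck≡ : Grothendieck n w ≡ Groth.value l
  Grothendieck≡ = trans (Groth.fuel-irrelevant n (n * n) (suc (ascents l)) l fuel ℕₚ.≤-refl) (cong (λ k → grothF k (suc (ascents l)) l) (sym |l|))
  S≤1 : ∀ e → length e ≡ n → 𝔖 l e ≤ᶻ 1ℤ
  S≤1 e |e| with to-Vec e |e|
  ... | v , refl with 𝔖 l (toList v) ℤ.≟ 0ℤ
  ...   | yes eq = ℤₚ.≤-trans (ℤₚ.≤-reflexive eq) (ℤ.+≤+ z≤n)
  ...   | no ne = ℤₚ.≤-reflexive (trans (sym (S≡ (toList v))) (zero-one v (λ eq → ne (trans (sym (S≡ (toList v))) eq))))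
    where
    S≡ : ∀ e → coeff (Schubert n w) e ≡ 𝔖 l e
    S≡ e = cong (λ p → coeff p e) Schubert≡
  mf : MultiplicityFree n l
  mf = multiplicity-free _ l ℕₚ.≤-refl (oneLine-Unique w) (oneLine-< w) |l| S≤1
  open MultiplicityFree mf
  m = wtClosed w
  g : Series
  g = coeff (Grothendieck n w)
  g≗ : g ≗ 𝔊 l
  g≗ e = cong (λ p → coeff p e) Grothendieck≡
  p : Exp → Bool
  p β = anyB (λ α → leqE α β) (support (Grothendieck n w))
  supported : ∀ γ → p γ ≡ false → g γ ≡ 0ℤ
  supported γ pγ with g γ ℤ.≟ 0ℤ
  ... | yes eq = eq
  ... | no ne with trans (sym pγ) (anyB-intro (λ α → leqE α γ) (nonzero-support (Grothendieck n w) γ ne) (leqE-complete (≤ₑ-refl {γ})))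
  ...   | ()
  bounded : ∀ γ → g γ ≢ 0ℤ → γ ≤ₑ m
  bounded γ ne = ≤ₑ-trans (𝔊-support _ l ℕₚ.≤-refl (oneLine-Unique w) (oneLine-< w) |l| γ (λ eq → ne (trans (g≗ γ) eq))) (closed≤wtClosed w)
  cumulative : ∀ β → β ≤ₑ m → p β ≡ true → cumulate g β ≡ 1ℤ
  cumulative β β≤m pβ with anyB-elim (λ α → leqE α β) (support (Grothendieck n w)) pβ
  ... | α , α∈ , α≤ = trans (cumulate-cong β (λ γ _ → trans (g≗ γ) (𝔊≗ γ))) (trans (cumulate-𝔼 h β)
    -- The coefficient of 𝔊 at α is a signed sum of coefficients of `h` at exponents below α, so
    -- they cannot all vanish. A nonvanishing one lies above an element of M; then so does β, which
    -- forces the value 1.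
    (decidable-stable (h β ℤ.≟ 1ℤ) λ h≢1 → gα≢0 (trans (g≗ α) (trans (𝔊≗ α) (𝔼-vanishing h α λ γ γ≤α →
      proj₂ (indh γ (trans (≤ₑ-length γ≤α) |α|)) (λ (α₀ , mem , le) →
        h≢1 (proj₁ (indh β (trans (sym (≤ₑ-length α≤β)) |α|)) (α₀ , mem , ≤ₑ-trans le (≤ₑ-trans γ≤α α≤β)))))))))
    where
    α≤β = leqE-sound α β α≤
    gα≢0 : g α ≢ 0ℤ
    gα≢0 = support-nonzero (Grothendieck n w) α α∈
    |α| : length α ≡ n
    |α| with length α ℕ.≟ length l
    ... | yes eq = trans eq |l|
    ... | no ne = ⊥-elim (gα≢0 (trans (g≗ α) (𝔊-length l α ne)))
  module Möb = Möbius m p g supported bounded cumulative
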